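{- For every integer $k\ge 2$ and every sufficiently large $N$, there is a 3D $k\times N$ rectangle $R^3_{k,N}$ whose directed tile complexity at temperature 1 satisfies $K^1_{USA}\left(R^3_{k,N}\right)=O\left(N^{\frac{1}{\lfloor k/2\rfloor}}+\log N\right)$.
   Context: We work in the 3D abstract Tile Assembly Model (aTAM). A tile type is a unit cube each of whose six sides carries a glue, a pair (label, nonnegative integer strength); a tile set $T$ is a finite set of tile types, each available in unlimited copies. A tile assembly system (TAS) is $\mathcal{T}=(T,\sigma,\tau)$ where $\sigma$ is a seed assembly consisting of a single tile placed at a fixed location of $\mathbb{Z}^3$ and $\tau\in\mathbb{Z}^+$ is the temperature. Two tiles at adjacent locations bind if the glues on their abutting sides are equal (in label and strength) and have positive strength. An assembly is a connected placement of tiles on $\mathbb{Z}^3$; starting from the seed, a tile may be added at an empty location if the sum of strengths of glues with which it binds to the current assembly is at least $\tau$ (at temperature 1: it binds to at least one adjacent tile). Assemblies obtainable this way are producible; a producible assembly is terminal if no tile can be added; $\mathcal{T}$ is directed if it has exactly one terminal producible assembly. A shape $X\subseteq\mathbb{Z}^3$ uniquely self-assembles in $\mathcal{T}$ if $\mathcal{T}$ is directed and its unique terminal assembly has domain exactly $X$. The directed tile complexity $K^\tau_{USA}(X)$ is the minimum of $|T|$ over all TAS $(T,\sigma,\tau)$ in which $X$ uniquely self-assembles. For $k,N\in\mathbb{Z}^+$, a 3D $k\times N$ rectangle $R^3_{k,N}$ is any set $R$ with $\{0,\dots,N-1\}\times\{0,\dots,k-1\}\times\{0\}\subseteq R\subseteq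 \{0,\dots,N-1\}\times\{0,\dots,k-1\}\times\{0,1\}$. Logarithms are base 2. -}

module Defs where

open import Data.Nat using (ℕ; zero; suc; _+_; _*_; _≤_; _<_)
open import Data.Integer using (ℤ; +_; -[1+_]) renaming (_+_ to _+ℤ_)
open import Data.Fin using (Fin)
open import Data.Maybe using (Maybe; just; nothing)
open import Data.Bool using (Bool; if_then_else_; _∧_)
open import Data.List using (List; []; _∷_; map)
open import Data.Nat.ListAction using (sum)
open import Data.Product using (Σ; ∃; ∃-syntax; _×_; _,_)
open import Data.Sum using (_⊎_)
open import Relation.Nullary.Decidable using (⌊_⌋)
open import Relation.Binary.PropositionalEquality using (_≡_; _≢_)
import Data.Nat as ℕ

Pos : Set
Pos = ℤ × ℤ × ℤ

data Dir : Set where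
  north east south west up down : Dir

allDirs : List Dir
allDirs = north ∷ east ∷ south ∷ west ∷ up ∷ down ∷ []

opp : Dir → Dir
opp north = south
opp south = north
opp east  = west
opp west  = east
opp up    = down
opp down  = up

neighbour : Pos → Dir → Pos
neighbour (x , y , z) north = x , y +ℤ + 1 , z
neighbour (x , y , z) south = x , y +ℤ -[1+ 0 ] , z
neighbour (x , y , z) east  = x +ℤ + 1 , y , z
neighbour (x , y , z) west  = x +ℤ -[1+ 0 ] , y , z
neighbour (x , y , z) up    = x , y , z +ℤ + 1
neighbour (x , y , z) down  = x , y , z +ℤ -[1+ 0 ]

record Glue : Set where
  constructor glue
  field
    label    : ℕ
    strength : ℕ
open Glue public

sameGlue : Glue → Glue → Bool
sameGlue g h = ⌊ label g ℕ.≟ label h ⌋ ∧ ⌊ strength g ℕ.≟ strength h ⌋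

-- A TAS (T, σ, τ).  The tile set T consists of the `size` tile types
-- `tile i`, i : Fin size, which are required to be pairwise distinct
-- (so |T| = size).  The seed is a single tile of type `seedTile`
-- placed at location `seedPos`.
record TAS : Set where
  field
    size        : ℕ
    tile        : Fin size → Dir → Glue
    distinct    : ∀ i j → (∀ d → tile i d ≡ tile j d) → i ≡ j
    seedTile    : Fin size
    seedPos     : Pos
    temperature : ℕ
    temperature-pos : 1 ≤ temperature

module _ (𝒯 : TAS) where
  open TAS 𝒯

  Assembly : Set
  Assembly = Pos → Maybe (Fin size)

  _≈A_ : Assembly → Assembly → Set
  A ≈A B = ∀ p → A p ≡ B p

  IsSeed : Assembly → Set
  IsSeed A = A seedPos ≡ just seedTile × (∀ q → q ≢ seedPos → A q ≡ nothing)

  sideStrength : Assembly → Pos → Fin size → Dir → ℕ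
  sideStrength A p i d with A (neighbour p d)
  ... | nothing = 0
  ... | just j  = if sameGlue (tile i d) (tile j (opp d)) then strength (tile i d) else 0

  bindStrength : Assembly → Pos → Fin size → ℕ
  bindStrength A p i = sum (map (sideStrength A p i) allDirs)

  Step : Assembly → Assembly → Set
  Step A B = ∃[ p ] ∃[ i ]
      A p ≡ nothing
    × temperature ≤ bindStrength A p i
    × B p ≡ just i
    × (∀ q → q ≢ p → B q ≡ A q)

  -- producible: the result of a (finite or infinite) assembly sequence
  -- starting from the seed.  Finite sequences are represented by
  -- eventually-stuttering sequences; the result is the union.
  Producible : Assembly → Set
  Producible A = Σ (ℕ → Assembly) λ s →
      IsSeed (s 0)
    × (∀ n → Step (s n) (s (suc n)) ⊎ (s (suc n) ≈A s n))
    × (∀ p i → (A p ≡ just i → ∃[ n ] s n p ≡ just i)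
             × (∃[ n ] s n p ≡ just i → A p ≡ just i))

  Terminal : Assembly → Set
  Terminal A = ∀ p i → A p ≡ nothing → bindStrength A p i < temperature

  Dom : Assembly → Pos → Set
  Dom A p = ∃[ i ] A p ≡ just i

  UniquelySelfAssembles : (Pos → Set) → Set
  UniquelySelfAssembles X = ∃[ α ]
      Producible α
    × Terminal α
    × (∀ β → Producible β → Terminal β → β ≈A α)
    × (∀ p → (X p → Dom α p) × (Dom α p → X p))

-- K^τ_USA(X) ≤ B : the minimum of |T| over all TAS at temperature τ in
-- which X uniquely self-assembles is at most B (i.e. some such TAS has
-- at most B tile types)
KUSA≤ : (τ : ℕ) → (Pos → Set) → ℕ → Set
KUSA≤ τ X B = ∃[ 𝒯 ] TAS.temperature 𝒯 ≡ τ × TAS.size 𝒯 ≤ B × UniquelySelfAssembles 𝒯 X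

IsRect3 : ℕ → ℕ → (Pos → Set) → Set
IsRect3 k N R =
    (∀ x y → x < N → y < k → R (+ x , + y , + 0))
  × (∀ p → R p → ∃[ x ] ∃[ y ] ∃[ z ] p ≡ (+ x , + y , + z) × x < N × y < k × z ≤ 1)

-- Let d = ⌊k/2⌋.  A counter with d − 1 digits in base 2ⁿ ≈ N^(1/d) is run from west to east by a
-- single path of tiles.  Where a tile of the path offers two continuations, one of them is
-- blocked by an earlier tile of the path, so at temperature 1 the assembly is forced.
--
-- A digit owns two rows, on top of those of the lower digits; the row below the digits is a hard-coded
-- run of about 2ⁿ tiles.  A digit is kept as geometry: each bit is a bump that blocks either the way
-- straight ahead in the row below or the way around it in the upper layer.  To increment it, the
-- path lets the lower digits run until they overflow, walks back west along the first row of the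
-- digit, reads the bumps (the tile types remember the bits read so far), and takes the value
-- east along the second row to write its successor.  The walks have unknown length but need no
-- counting: a walker also offers a turn towards the complete row beneath it, which opens only
-- where a hole was left in front of an obstacle.  Hence O(2ⁿ) tile types produce about 2ⁿᵈ
-- columns.  Cells left over in layer 0 are covered by fillers growing south, which never meet
-- another choice, and the exact width N comes from the initial digits and some padding.

module Submission where

open import Defs
open import Data.Nat using (ℕ; _+_; _*_; _^_; _≤_; _/_; zero; suc; _∸_; _<_; _≤?_; _<?_; z≤n; s≤s; s≤s⁻¹; _%_)
open import Data.Product using (∃-syntax; _×_; _,_; proj₁; proj₂)
open import Data.Nat.Properties
import Data.Nat as ℕ
import Data.Integer as ℤ
open import Data.Integer using (ℤ; +_; -[1+_])
import Data.Integer.Properties as ℤP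
open import Data.Fin using (Fin; toℕ; fromℕ<; splitAt; _↑ˡ_; _↑ʳ_; combine; remQuot)
open import Data.Fin.Properties using (toℕ-injective; toℕ-fromℕ<; splitAt-↑ˡ; splitAt-↑ʳ; remQuot-combine)
import Data.Fin as Fin
open import Data.Bool using (Bool; true; false; if_then_else_; _∧_; not)
open import Data.Maybe using (Maybe; just; nothing; fromMaybe)
open import Data.Maybe.Properties using (just-injective)
open import Data.List using (List; []; _∷_; map; length; _++_; replicate)
open import Data.List.Relation.Unary.Any using (Any; here; there)
open import Data.List.Relation.Unary.All using (All; []; _∷_)
open import Data.List.Membership.Propositional using (_∈_; _∉_)
open import Data.Product.Properties using (≡-dec)
open import Data.Sum using (_⊎_; inj₁; inj₂; [_,_]′)
open import Data.Empty using (⊥)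
open import Data.Unit using (⊤; tt)
open import Function using (_∘_; case_of_)
open import Relation.Nullary using (¬_; Dec; yes; no; contradiction)
open import Relation.Nullary.Decidable using (map′; True; toWitness; ¬?; _×-dec_; _→-dec_)
open import Relation.Binary.PropositionalEquality
open import Data.Nat.ListAction using (sum)
import Data.List.Relation.Unary.All as All
open import Data.List.Relation.Unary.AllPairs using (AllPairs; []; _∷_; allPairs?)
open import Data.List.Membership.Propositional.Properties using (∈-map⁻; ∈-++⁻; ∈-++⁺ˡ; ∈-++⁺ʳ)
import Data.Bool.Properties as Boolₚ
open import Data.List.Properties using (++-identityʳ; length-++; length-replicate)
open import Data.Nat.Tactic.RingSolver using (solve-∀)
open import Data.List.Relation.Unary.All.Properties using (++⁺; map⁺)
open import Data.Nat.DivMod using (m≡m%n+[m/n]*n; m≥n⇒m/n>0)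

-- At temperature 1 one glue suffices, and the only certainty about the order of growth is that a
-- tile comes after the tile that handed it its input glue. A cell can therefore close a branch only
-- if it holds an ancestor of the tile that offers the branch. This is why there is a single path:
-- on it everything earlier is an ancestor, whereas a filler may come arbitrarily late and must
-- never serve as an obstacle. The criterion for uniqueness is phrased in these terms: each output
-- glue leads to a tile of the intended assembly, or into a cell that belongs to every parent-closed
-- set containing the tile that offers it. The upper layer lets the path pass over cells that it
-- needs later: `leave` passes over the hole where `back` descends, `enter` and `again` over the
-- column in which `lift` climbs, `turn` over the pocket of `stop`. Rounding the root of N down to a
-- power B of two costs a factor of up to 2 in B, hence 2ᵈ in the capacity of the counter. The
-- hard-coded row makes up for it with a length of 2ᵈ B.

opp-opp : ∀ d → opp (opp d) ≡ d
opp-opp north = refl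
opp-opp east = refl
opp-opp south = refl
opp-opp west = refl
opp-opp up = refl
opp-opp down = refl

opp-≢ : ∀ d → d ≢ opp d
opp-≢ north ()
opp-≢ east ()
opp-≢ south ()
opp-≢ west ()
opp-≢ up ()
opp-≢ down ()

dirCode : Dir → ℕ
dirCode north = 0
dirCode east = 1
dirCode south = 2
dirCode west = 3
dirCode up = 4
dirCode down = 5

codeDir : ℕ → Dir
codeDir 0 = north
codeDir 1 = east
codeDir 2 = south
codeDir 3 = west
codeDir 4 = up
codeDir _ = down

codeDir-dirCode : ∀ d → codeDir (dirCode d) ≡ d
codeDir-dirCode north = refl
codeDir-dirCode east = refl
codeDir-dirCode south = refl
codeDir-dirCode west = refl
codeDir-dirCode up = refl
codeDir-dirCode down = refl

infix 4 _≟D_ _≟P_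

_≟D_ : (d e : Dir) → Dec (d ≡ e)
d ≟D e = map′ (λ eq → trans (sym (codeDir-dirCode d)) (trans (cong codeDir eq) (codeDir-dirCode e)))
              (cong dirCode) (dirCode d ℕ.≟ dirCode e)

_≟P_ : (p q : Pos) → Dec (p ≡ q)
_≟P_ = ≡-dec ℤ._≟_ (≡-dec ℤ._≟_ ℤ._≟_)

+1-1 : ∀ x → (x ℤ.+ + 1) ℤ.+ -[1+ 0 ] ≡ x
+1-1 x = trans (ℤP.+-assoc x (+ 1) -[1+ 0 ]) (ℤP.+-identityʳ x)

-1+1 : ∀ x → (x ℤ.+ -[1+ 0 ]) ℤ.+ + 1 ≡ x
-1+1 x = trans (ℤP.+-assoc x -[1+ 0 ] (+ 1)) (ℤP.+-identityʳ x)

neighbour-opp : ∀ p d → neighbour (neighbour p d) (opp d) ≡ p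
neighbour-opp (x , y , z) north = cong (λ y → x , y , z) (+1-1 y)
neighbour-opp (x , y , z) east = cong (λ x → x , y , z) (+1-1 x)
neighbour-opp (x , y , z) south = cong (λ y → x , y , z) (-1+1 y)
neighbour-opp (x , y , z) west = cong (λ x → x , y , z) (-1+1 x)
neighbour-opp (x , y , z) up = cong (λ z → x , y , z) (+1-1 z)
neighbour-opp (x , y , z) down = cong (λ z → x , y , z) (-1+1 z)

∈-allDirs : ∀ d → d ∈ allDirs
∈-allDirs north = here refl
∈-allDirs east = there (here refl)
∈-allDirs south = there (there (here refl))
∈-allDirs west = there (there (there (here refl)))
∈-allDirs up = there (there (there (there (here refl))))
∈-allDirs down = there (there (there (there (there (here refl)))))

sum-map-≥ : ∀ {A : Set} (f : A → ℕ) {x xs} → x ∈ xs → f x ≤ sum (map f xs)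
sum-map-≥ f {xs = y ∷ ys} (here refl) = m≤m+n (f y) _
sum-map-≥ f {xs = y ∷ ys} (there x∈) = ≤-trans (sum-map-≥ f x∈) (m≤n+m _ (f y))

sum-map-pos : ∀ {A : Set} (f : A → ℕ) xs → 1 ≤ sum (map f xs) → ∃[ x ] 1 ≤ f x
sum-map-pos f (x ∷ xs) le with f x in eq
... | zero = sum-map-pos f xs le
... | suc n = x , subst (1 ≤_) (sym eq) (s≤s z≤n)

-- Tile sets with one input glue per type, and a criterion for unique assembly.

-- Temperature-1 tile sets whose tile types carry one input glue each: tile i may
-- follow tile j, placed in direction enter i, when i ∈ targets j.
module FinMachine (m : ℕ) (enter : Fin m → Dir) (targets : Fin m → List (Fin m))
                  (seed : Fin m) (p₀ : Pos) where

  pick : Dir → List (Fin m) → Maybe (Fin m)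
  pick d [] = nothing
  pick d (t ∷ ts) with enter t ≟D d
  ... | yes _ = just t
  ... | no _ = pick d ts

  pick-enter : ∀ {d t} ts → pick d ts ≡ just t → enter t ≡ d
  pick-enter {d} (t ∷ ts) eq with enter t ≟D d
  pick-enter (t ∷ ts) refl | yes e = e
  ... | no _ = pick-enter ts eq

  pick-∈ : ∀ {d t} ts → pick d ts ≡ just t → t ∈ ts
  pick-∈ {d} (t ∷ ts) eq with enter t ≟D d
  pick-∈ (t ∷ ts) refl | yes e = here refl
  ... | no _ = there (pick-∈ ts eq)

  out : Fin m → Dir → Maybe (Fin m)
  out i d = pick d (targets i)

  out-enter : ∀ {i d t} → out i d ≡ just t → enter t ≡ d
  out-enter {i} = pick-enter (targets i)

  -- The label of a glue is the index of the type that it admits. The seed gets no input glue, so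
  -- nothing can attach as its parent. Where an output would share the input side, the input wins;
  -- `no-back` excludes this conflict for outputs into free cells.
  tileOf : Fin m → Dir → Glue
  tileOf i d with d ≟D opp (enter i) | i Fin.≟ seed | out i d
  ... | yes _ | yes _ | _ = glue 0 0
  ... | yes _ | no _ | _ = glue (toℕ i) 1
  ... | no _ | _ | just t = glue (toℕ t) 1
  ... | no _ | _ | nothing = glue 0 0

  data GlueView (i : Fin m) (d : Dir) : Glue → Set where
    input  : d ≡ opp (enter i) → i ≢ seed → GlueView i d (glue (toℕ i) 1)
    output : ∀ {t} → d ≢ opp (enter i) → out i d ≡ just t → GlueView i d (glue (toℕ t) 1)
    null   : GlueView i d (glue 0 0)

  glueView : ∀ i d → GlueView i d (tileOf i d)
  glueView i d with d ≟D opp (enter i) | i Fin.≟ seed | out i d in eq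
  ... | yes _ | yes _ | _ = null
  ... | yes e | no n | _ = input e n
  ... | no n | _ | just t = output n eq
  ... | no _ | _ | nothing = null

  input-glue : ∀ i → i ≢ seed → tileOf i (opp (enter i)) ≡ glue (toℕ i) 1
  input-glue i i≢ with opp (enter i) ≟D opp (enter i) | i Fin.≟ seed
  ... | yes _ | yes e = contradiction e i≢
  ... | yes _ | no _ = refl
  ... | no n | _ = contradiction refl n

  output-glue : ∀ {i d t} → d ≢ opp (enter i) → out i d ≡ just t → tileOf i d ≡ glue (toℕ t) 1
  output-glue {i} {d} d≢ eq with d ≟D opp (enter i) | i Fin.≟ seed | out i d
  ... | yes e | _ | _ = contradiction e d≢
  output-glue d≢ refl | no _ | _ | just t = refl

  -- The input glue identifies the type: an output glue labelled `i` on the same side would mean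
  -- that `i` is entered in the direction opposite to `enter i`.
  distinctInput : ∀ i j → i ≢ seed → (∀ d → tileOf j d ≡ tileOf i d) → i ≡ j
  distinctInput i j i≢ same
    with tileOf j (opp (enter i)) | glueView j (opp (enter i)) | trans (same (opp (enter i))) (input-glue i i≢)
  ... | _ | input _ _ | eq = sym (toℕ-injective (cong label eq))
  ... | _ | output {t} _ o | eq = contradiction
          (trans (cong enter (sym (toℕ-injective (cong label eq)))) (out-enter {j} o)) (opp-≢ (enter i))
  ... | _ | null | ()

  distinctTiles : ∀ i j → (∀ d → tileOf i d ≡ tileOf j d) → i ≡ j
  distinctTiles i j same = byCases (i Fin.≟ seed) (j Fin.≟ seed)
    where
    byCases : Dec (i ≡ seed) → Dec (j ≡ seed) → i ≡ j
    byCases (yes e) (yes f) = trans e (sym f)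
    byCases (no i≢) _ = distinctInput i j i≢ (λ d → sym (same d))
    byCases (yes _) (no j≢) = sym (distinctInput j i j≢ same)

  𝒯 : TAS
  𝒯 = record
    { size = m ; tile = tileOf ; distinct = distinctTiles ; seedTile = seed ; seedPos = p₀
    ; temperature = 1 ; temperature-pos = s≤s z≤n }

  sameGlue-refl : ∀ g → sameGlue g g ≡ true
  sameGlue-refl g with label g ℕ.≟ label g | strength g ℕ.≟ strength g
  ... | yes _ | yes _ = refl
  ... | yes _ | no n = contradiction refl n
  ... | no n | _ = contradiction refl n

  sameGlue-label : ∀ g h → sameGlue g h ≡ true → label g ≡ label h
  sameGlue-label g h eq with label g ℕ.≟ label h
  ... | yes e = e

  -- A tile `i` can bind to `j` as its child or, with the bond run backwards, as its parent. The
  -- second case is the one that could spoil determinism.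
  Bound : Fin m → Dir → Fin m → Set
  Bound i d j = out j (opp d) ≡ just i ⊎ (enter j ≡ d × j ≢ seed)

  glue-bound : ∀ i d j → sameGlue (tileOf i d) (tileOf j (opp d)) ≡ true → 1 ≤ strength (tileOf i d) → Bound i d j
  glue-bound i d j same pos with tileOf i d | glueView i d | tileOf j (opp d) | glueView j (opp d) | same
  ... | _ | null | _ | _ | _ = contradiction pos λ ()
  ... | _ | input e _ | _ | input f n | sm with sameGlue-label (glue (toℕ i) 1) (glue (toℕ j) 1) sm
  ...   | l rewrite toℕ-injective l = contradiction (trans (sym (opp-opp d)) (trans (cong opp f) (trans (opp-opp (enter j)) (trans (sym (opp-opp (enter j))) (cong opp (sym e)))))) (opp-≢ d)
  glue-bound i d j same pos | _ | input e _ | _ | output {t} n o | sm with sameGlue-label (glue (toℕ i) 1) (glue (toℕ t) 1) sm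
  ...   | l rewrite toℕ-injective l = inj₁ o
  glue-bound i d j same pos | _ | output n o | _ | input f n′ | sm =
    inj₂ (trans (sym (opp-opp (enter j))) (trans (cong opp (sym f)) (opp-opp d)) , n′)
  glue-bound i d j same pos | _ | output {t} n o | _ | output {t′} n′ o′ | sm with sameGlue-label (glue (toℕ t) 1) (glue (toℕ t′) 1) sm
  ...   | l rewrite toℕ-injective l = contradiction (trans (sym (out-enter {i} o)) (out-enter {j} o′)) (opp-≢ d)
  glue-bound i d j same pos | _ | input e _ | _ | null | sm = contradiction (sm′ sm) λ ()
    where sm′ : sameGlue (glue (toℕ i) 1) (glue 0 0) ≡ true → 1 ≡ 0
          sm′ e with toℕ i ℕ.≟ 0
          sm′ () | yes _
          sm′ () | no _
  glue-bound i d j same pos | _ | output {t} e _ | _ | null | sm = contradiction (sm′ sm) λ ()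
    where sm′ : sameGlue (glue (toℕ t) 1) (glue 0 0) ≡ true → 1 ≡ 0
          sm′ e with toℕ t ℕ.≟ 0
          sm′ () | yes _
          sm′ () | no _

  bind-inv : ∀ A p i → 1 ≤ bindStrength 𝒯 A p i → ∃[ d ] ∃[ j ] A (neighbour p d) ≡ just j × Bound i d j
  bind-inv A p i pos with sum-map-pos (sideStrength 𝒯 A p i) allDirs pos
  ... | d , le = d , helper le
    where
    helper : 1 ≤ sideStrength 𝒯 A p i d → ∃[ j ] A (neighbour p d) ≡ just j × Bound i d j
    helper le with A (neighbour p d)
    ... | just j with sameGlue (tileOf i d) (tileOf j (opp d)) in eq
    ...   | true = j , refl , glue-bound i d j eq le

  bind-intro : ∀ A p i d j → A (neighbour p d) ≡ just j → enter i ≡ opp d → i ≢ seed →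
               opp d ≢ opp (enter j) → out j (opp d) ≡ just i → 1 ≤ bindStrength 𝒯 A p i
  bind-intro A p i d j Aj ei i≢ d≢ o =
    ≤-trans helper (sum-map-≥ (sideStrength 𝒯 A p i) (∈-allDirs d))
    where
    tᵢ : tileOf i d ≡ glue (toℕ i) 1
    tᵢ = trans (cong (tileOf i) (trans (sym (opp-opp d)) (cong opp (sym ei)))) (input-glue i i≢)
    helper : 1 ≤ sideStrength 𝒯 A p i d
    helper rewrite Aj | output-glue d≢ o | tᵢ | sameGlue-refl (glue (toℕ i) 1) = s≤s z≤n

  Entry : Set
  Entry = Pos × Fin m

  data Tree : List Entry → Set where
    root : Tree ((p₀ , seed) ∷ [])
    node : ∀ {L p i d t} → Tree L → (p , i) ∈ L → out i d ≡ just t → t ≢ seed →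
           (∀ j → (neighbour p d , j) ∉ L) → Tree ((neighbour p d , t) ∷ L)

  Closed : List Entry → (Pos → Set) → Set
  Closed L A = ∀ q i → (q , i) ∈ L → q ≢ p₀ → A q → A (neighbour q (opp (enter i)))

  -- Only the ancestors of a tile are certain to be present with it, so blocking quantifies over all
  -- parent-closed sets instead of referring to one order of growth.
  Blocked : List Entry → Pos → Pos → Set₁
  Blocked L p q = ∀ (A : Pos → Set) → Closed L A → A p → A q

  Satisfied : List Entry → Set₁
  Satisfied L = ∀ p i d t → (p , i) ∈ L → out i d ≡ just t →
                (neighbour p d , t) ∈ L ⊎ Blocked L p (neighbour p d)

  look : List Entry → Pos → Maybe (Fin m)
  look [] p = nothing
  look ((q , i) ∷ L) p with p ≟P q
  ... | yes _ = just i
  ... | no _ = look L p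

  look-∈ : ∀ L p {i} → look L p ≡ just i → (p , i) ∈ L
  look-∈ ((q , i) ∷ L) p eq with p ≟P q
  look-∈ ((q , i) ∷ L) p refl | yes refl = here refl
  ... | no _ = there (look-∈ L p eq)

  look-∉ : ∀ L p → (∀ j → (p , j) ∉ L) → look L p ≡ nothing
  look-∉ [] p f = refl
  look-∉ ((q , i) ∷ L) p f with p ≟P q
  ... | yes refl = contradiction (here refl) (f i)
  ... | no _ = look-∉ L p (λ j → f j ∘ there)

  nothing-∉ : ∀ L p → look L p ≡ nothing → ∀ j → (p , j) ∉ L
  nothing-∉ ((q , i) ∷ L) p eq j j∈ with p ≟P q
  nothing-∉ ((q , i) ∷ L) p () j j∈ | yes _
  nothing-∉ ((q , i) ∷ L) p eq j (here refl) | no n = n refl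
  nothing-∉ ((q , i) ∷ L) p eq j (there j∈) | no n = nothing-∉ L p eq j j∈

  ∈-look : ∀ {L} → Tree L → ∀ {p i} → (p , i) ∈ L → look L p ≡ just i
  ∈-look root {p} (here refl) with p ≟P p
  ... | yes _ = refl
  ... | no n = contradiction refl n
  ∈-look (node {p = p} {d = d} T _ _ _ fr) {q} q∈ with q ≟P neighbour p d
  ∈-look (node T _ _ _ fr) (here refl) | yes e = refl
  ∈-look (node T _ _ _ fr) {i = j} (there q∈) | yes refl = contradiction q∈ (fr j)
  ∈-look (node T _ _ _ fr) (here refl) | no n = contradiction refl n
  ∈-look (node T _ _ _ fr) (there q∈) | no n = ∈-look T q∈

  ∈-unique : ∀ {L} → Tree L → ∀ {p i j} → (p , i) ∈ L → (p , j) ∈ L → i ≡ j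
  ∈-unique T a b = just-injective (trans (sym (∈-look T a)) (∈-look T b))

  root-∈ : ∀ {L} → Tree L → (p₀ , seed) ∈ L
  root-∈ root = here refl
  root-∈ (node T _ _ _ _) = there (root-∈ T)

  parent : ∀ {L} → Tree L → ∀ {q t} → (q , t) ∈ L → q ≢ p₀ →
           t ≢ seed × ∃[ j ] (neighbour q (opp (enter t)) , j) ∈ L × out j (enter t) ≡ just t
  parent root (here refl) q≢ = contradiction refl q≢
  parent (node {L = L} {p = p} {i} {d} {t} T p∈ o t≢ fr) (here refl) q≢ with refl ← out-enter {i} o =
    t≢ , i , subst (λ r → (r , i) ∈ (neighbour p d , t) ∷ L) (sym (neighbour-opp p d)) (there p∈) , o
  parent (node T _ _ _ _) (there q∈) q≢ with parent T q∈ q≢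
  ... | t≢ , j , j∈ , o = t≢ , j , there j∈ , o

  -- Lists have their newest entry first, so this keeps at most the `suc n` oldest entries; beyond
  -- the length of `L` the assembly sequence stutters.
  prefix : List Entry → ℕ → List Entry
  prefix [] n = []
  prefix (e ∷ L) n with length L ≤? n
  ... | yes _ = e ∷ L
  ... | no _ = prefix L n

  prefix-full : ∀ L n → length L ≤ suc n → prefix L n ≡ L
  prefix-full [] n _ = refl
  prefix-full (e ∷ L) n (s≤s le) with length L ≤? n
  ... | yes _ = refl
  ... | no n≰ = contradiction le n≰

  prefix-⊆ : ∀ L n {e} → e ∈ prefix L n → e ∈ L
  prefix-⊆ (x ∷ L) n e∈ with length L ≤? n
  ... | yes _ = e∈
  ... | no _ = there (prefix-⊆ L n e∈)

  module _ (seed-out : ∀ d t → out seed d ≡ just t → d ≢ opp (enter seed)) where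

    -- The input side faces the cell of the parent, which is occupied; only the seed, which has no
    -- parent, relies on `seed-out`.
    no-back : ∀ {L} → Tree L → ∀ {p i d t} → (p , i) ∈ L → out i d ≡ just t →
              (∀ j → (neighbour p d , j) ∉ L) → d ≢ opp (enter i)
    no-back T {p} {i} {d} {t} p∈ o fr refl with p ≟P p₀
    ... | no p≢ = let _ , j , j∈ , _ = parent T p∈ p≢ in fr j j∈
    ... | yes refl with ∈-unique T p∈ (root-∈ T)
    ...   | refl = seed-out d t o refl

    prefix-tree : ∀ {L} → Tree L → ∀ n →
      Step 𝒯 (look (prefix L n)) (look (prefix L (suc n))) ⊎
      (_≈A_ 𝒯 (look (prefix L (suc n))) (look (prefix L n)))
    prefix-tree root n = inj₂ λ p → refl
    prefix-tree {_ ∷ L} T@(node {p = p} {i} {d} {t} T′ p∈ o t≢ fr) n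
      with length L ≤? n | length L ≤? suc n
    ... | yes _ | yes _ = inj₂ λ p → refl
    ... | yes a | no b = contradiction (m≤n⇒m≤1+n a) b
    ... | no _ | no _ = prefix-tree T′ n
    ... | no a | yes b rewrite prefix-full L n b =
      inj₁ (neighbour p d , t , look-∉ L (neighbour p d) fr ,
        bind-intro (look L) (neighbour p d) t (opp d) i
          (trans (cong (look L) (neighbour-opp p d)) (∈-look T′ p∈))
          (trans (out-enter {i} o) (sym (opp-opp d))) t≢
          (subst (_≢ opp (enter i)) (sym (opp-opp d)) (no-back T′ p∈ o fr))
          (trans (cong (out i) (opp-opp d)) o) ,
        ∈-look T (here refl) , λ q q≢ → other q q≢)
      where
      other : ∀ q → q ≢ neighbour p d → look ((neighbour p d , t) ∷ L) q ≡ look L q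
      other q q≢ with q ≟P neighbour p d
      ... | yes e = contradiction e q≢
      ... | no _ = refl

    look-producible : ∀ {L} → Tree L → Producible 𝒯 (look L)
    look-producible {L} T = (λ n → look (prefix L n)) , start T , prefix-tree T ,
      λ p i → (λ eq → length L , trans (cong (λ K → look K p) (prefix-full L (length L) (n≤1+n _))) eq) ,
              λ (n , eq) → ∈-look T (prefix-⊆ L n (look-∈ (prefix L n) p eq))
      where
      first : ∀ {L} → Tree L → prefix L 0 ≡ (p₀ , seed) ∷ []
      first root = refl
      first (node root _ _ _ _) = refl
      first (node T@(node _ _ _ _ _) _ _ _ _) = first T
      start : ∀ {L} → Tree L → IsSeed 𝒯 (look (prefix L 0))
      start T rewrite first T = ∈-look root (here refl) , off
        where off : ∀ q → q ≢ p₀ → look ((p₀ , seed) ∷ []) q ≡ nothing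
              off q q≢ with q ≟P p₀
              ... | yes e = contradiction e q≢
              ... | no _ = refl

    module Unique {L : List Entry} (T : Tree L) (sat : Satisfied L) where

      record Good (A : Pos → Maybe (Fin m)) : Set where
        field
          below  : ∀ p i → A p ≡ just i → (p , i) ∈ L
          closed : ∀ q i → A q ≡ just i → q ≢ p₀ → ∃[ j ] A (neighbour q (opp (enter i))) ≡ just j
      open Good

      Good-closed : ∀ {A} → Good A → Closed L (λ p → ∃[ i ] A p ≡ just i)
      Good-closed g q i q∈ q≢ (j , eq) with ∈-unique T q∈ (below g q j eq)
      ... | refl = closed g q i eq q≢

      -- A bond to a parent leads into `L` or into a blocked cell, and the latter is already filled
      -- because `A` is parent-closed. A bond to a child is impossible for the same reason: the cell
      -- of the child's parent is filled. So attachments stay inside `L` and preserve closedness.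
      attach : ∀ {A} → Good A → ∀ p i → A p ≡ nothing → 1 ≤ bindStrength 𝒯 A p i →
               (p , i) ∈ L × ∃[ j ] A (neighbour p (opp (enter i))) ≡ just j
      attach {A} g p i Ap pos with bind-inv A p i pos
      ... | d , j , Aj , inj₁ o
          with sat (neighbour p d) j (opp d) i (below g _ j Aj) o | out-enter {j} o
      ...   | inj₁ i∈ | e = subst (λ q → (q , i) ∈ L) (neighbour-opp p d) i∈ ,
              j , trans (cong (λ e → A (neighbour p e)) (trans (cong opp e) (opp-opp d))) Aj
      ...   | inj₂ bl | _ with bl _ (Good-closed g) (j , Aj)
      ...     | j′ , eq with trans (sym eq) (trans (cong A (neighbour-opp p d)) Ap)
      ...       | ()
      attach {A} g p i Ap pos | d , j , Aj , inj₂ (refl , j≢) with neighbour p d ≟P p₀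
      ... | yes e = contradiction (∈-unique T (below g _ j Aj) (subst (λ q → (q , seed) ∈ L) (sym e) (root-∈ T))) j≢
      ... | no n with closed g _ j Aj n
      ...   | j′ , eq with trans (sym eq) (trans (cong A (neighbour-opp p d)) Ap)
      ...     | ()

      Good-cong : ∀ {A B} → _≈A_ 𝒯 B A → Good A → Good B
      Good-cong eq g .below p i e = below g p i (trans (sym (eq p)) e)
      Good-cong eq g .closed q i e q≢ = let j , f = closed g q i (trans (sym (eq q)) e) q≢ in j , trans (eq _) f

      Good-step : ∀ {A B} → Step 𝒯 A B → Good A → Good B
      Good-step {A} {B} (p , i , Ap , pos , Bp , same) g = record { below = bel ; closed = clo }
        where
        kept : ∀ {q j} → A q ≡ just j → B q ≡ just j
        kept {q} e with q ≟P p
        ... | no n = trans (same q n) e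
        ... | yes refl with trans (sym e) Ap
        ...   | ()
        att : (p , i) ∈ L × ∃[ j ] A (neighbour p (opp (enter i))) ≡ just j
        att = attach g p i Ap pos
        bel : ∀ q j → B q ≡ just j → (q , j) ∈ L
        bel q j e with q ≟P p
        ... | no n = below g q j (trans (sym (same q n)) e)
        ... | yes refl with trans (sym e) Bp
        ...   | refl = proj₁ att
        clo : ∀ q j → B q ≡ just j → q ≢ p₀ → ∃[ j′ ] B (neighbour q (opp (enter j))) ≡ just j′
        clo q j e q≢ with q ≟P p
        ... | no n = let j′ , f = closed g q j (trans (sym (same q n)) e) q≢ in j′ , kept f
        ... | yes refl with trans (sym e) Bp
        ...   | refl = let j′ , f = proj₂ att in j′ , kept f

      Good-seed : ∀ {A} → IsSeed 𝒯 A → Good A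
      Good-seed {A} (s , off) = record { below = bel ; closed = λ q i e q≢ → case trans (sym e) (off q q≢) of λ () }
        where
        bel : ∀ p i → A p ≡ just i → (p , i) ∈ L
        bel p i e with p ≟P p₀
        ... | no n = case trans (sym e) (off p n) of λ ()
        ... | yes refl with trans (sym e) s
        ...   | refl = root-∈ T

      Good-producible : ∀ {A} → Producible 𝒯 A → Good A
      Good-producible {A} (s , is , steps , lim) = record
        { below = λ p i e → let n , f = proj₁ (lim p i) e in below (good n) p i f
        ; closed = λ q i e q≢ → let n , f = proj₁ (lim q i) e
                                    j , h = closed (good n) q i f q≢
                                in j , proj₂ (lim _ j) (n , h) }
        where
        good : ∀ n → Good (s n)
        good zero = Good-seed is
        good (suc n) with steps n
        ... | inj₁ st = Good-step st (good n)
        ... | inj₂ eq = Good-cong eq (good n)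

      look-good : Good (look L)
      look-good = Good-producible (look-producible T)

      look-terminal : Terminal 𝒯 (look L)
      look-terminal p i eq with 1 ≤? bindStrength 𝒯 (look L) p i
      ... | no n = ≰⇒> n
      ... | yes pos = contradiction (proj₁ (attach look-good p i eq pos)) (nothing-∉ L p eq i)

      seed-stays : ∀ {A} → Producible 𝒯 A → A p₀ ≡ just seed
      seed-stays (s , (is , _) , _ , lim) = proj₂ (lim p₀ seed) (0 , is)

      -- `K` runs through the stages in which `L` grew: once the parent is present, terminality
      -- forces the cell of the child to be filled, and `below` leaves only one type for it.
      terminal-full : ∀ {A} → Producible 𝒯 A → Terminal 𝒯 A →
                      ∀ {K} → Tree K → (∀ {e} → e ∈ K → e ∈ L) → ∀ {p i} → (p , i) ∈ K → A p ≡ just i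
      terminal-full pr te root sub (here refl) = seed-stays pr
      terminal-full pr te (node T′ _ _ _ _) sub (there p∈) = terminal-full pr te T′ (sub ∘ there) p∈
      terminal-full {A} pr te (node {p = p} {i} {d} {t} T′ p∈ o t≢ fr) sub (here refl)
        with A (neighbour p d) in eq
      ... | just j = cong just (∈-unique T (below (Good-producible pr) _ j eq) (sub (here refl)))
      ... | nothing = contradiction
        (bind-intro A (neighbour p d) t (opp d) i
          (trans (cong A (neighbour-opp p d)) (terminal-full pr te T′ (sub ∘ there) p∈))
          (trans (out-enter {i} o) (sym (opp-opp d))) t≢
          (subst (_≢ opp (enter i)) (sym (opp-opp d)) (no-back T′ p∈ o fr))
          (trans (cong (out i) (opp-opp d)) o))
        (<⇒≱ (te _ t eq))

      uniquelySelfAssembles : ∀ {X : Pos → Set} →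
        (∀ p → (X p → ∃[ i ] (p , i) ∈ L) × (∃[ i ] (p , i) ∈ L → X p)) → UniquelySelfAssembles 𝒯 X
      uniquelySelfAssembles dom = look L , look-producible T , look-terminal , uniq ,
        λ p → (λ x → let i , i∈ = proj₁ (dom p) x in i , ∈-look T i∈) ,
              λ (i , e) → proj₂ (dom p) (i , look-∈ L p e)
        where
        uniq : ∀ β → Producible 𝒯 β → Terminal 𝒯 β → _≈A_ 𝒯 β (look L)
        uniq β pr te p with look L p in eq
        ... | just i = terminal-full pr te T (λ x → x) (look-∈ L p eq)
        ... | nothing with β p in eq′
        ...   | nothing = refl
        ...   | just i = contradiction (below (Good-producible pr) p i eq′) (nothing-∉ L p eq i)

-- Assemblies consisting of one path with filler columns.

Cell : Set
Cell = ℕ × ℕ × ℕ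

emb : Cell → Pos
emb (x , y , z) = + x , + y , + z

emb-injective : ∀ {c c′} → emb c ≡ emb c′ → c ≡ c′
emb-injective {_ , _ , _} {_ , _ , _} refl = refl

step : Dir → Cell → Maybe Cell
step north (x , y , z) = just (x , suc y , z)
step east (x , y , z) = just (suc x , y , z)
step south (x , suc y , z) = just (x , y , z)
step south (x , zero , z) = nothing
step west (suc x , y , z) = just (x , y , z)
step west (zero , y , z) = nothing
step up (x , y , z) = just (x , y , suc z)
step down (x , y , suc z) = just (x , y , z)
step down (x , y , zero) = nothing

emb-step : ∀ d {c c′} → step d c ≡ just c′ → neighbour (emb c) d ≡ emb c′
emb-step north {x , y , z} refl = cong (λ y → + x , + y , + z) (+-comm y 1)
emb-step east {x , y , z} refl = cong (λ x → + x , + y , + z) (+-comm x 1)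
emb-step south {x , suc y , z} refl = refl
emb-step west {suc x , y , z} refl = refl
emb-step up {x , y , z} refl = cong (λ z → + x , + y , + z) (+-comm z 1)
emb-step down {x , y , suc z} refl = refl

-- A path of tiles (the trunk); fillTop s ≡ just h makes a trunk tile s at (x , h + 1 , 0)
-- grow a column of fillers down to (x , 0 , 0).
module Trunk {State : Set} (enterS : State → Dir) (trunkOuts : State → List State)
             (fillTop : State → Maybe ℕ) (filler : ℕ → State) (start : State) (c₀ : Cell) where

  fillOuts : Maybe ℕ → List State
  fillOuts (just h) = filler h ∷ []
  fillOuts nothing = []

  outs : State → List State
  outs s = trunkOuts s ++ fillOuts (fillTop s)

  Placed : Set
  Placed = Cell × State

  Foot : Placed → Cell → Set
  Foot (c@(x , _ , _) , s) q@(x′ , y′ , z′) =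
    q ≡ c ⊎ ∃[ h ] fillTop s ≡ just h × x′ ≡ x × y′ ≤ h × z′ ≡ 0

  Occ : List Placed → Cell → Set
  Occ ρ q = Any (λ e → Foot e q) ρ

  -- Fillers count in `Occ`, which decides whether a cell is free, but not in `Tr`, which decides
  -- what may block: they may be placed arbitrarily late.
  Tr : List Placed → Cell → Set
  Tr ρ q = ∃[ s ] (q , s) ∈ ρ

  Tr-Occ : ∀ {ρ q} → Tr ρ q → Occ ρ q
  Tr-Occ (s , here refl) = here (inj₁ refl)
  Tr-Occ (s , there e∈) = there (Tr-Occ (s , e∈))

  Free : List Placed → Cell → State → Set
  Free ρ c s = ¬ Occ ρ c ×
    (∀ h → fillTop s ≡ just h → ∃[ x ] c ≡ (x , suc h , 0) × (∀ y → y ≤ h → ¬ Occ ρ (x , y , 0)))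

  Distinct : State → Set
  Distinct s = AllPairs (λ a b → enterS a ≢ enterS b) (outs s)

  data Go (ρ : List Placed) (c : Cell) : List State → Cell → State → Set where
    only   : ∀ {c′ s′} → step (enterS s′) c ≡ just c′ → Go ρ c (s′ ∷ []) c′ s′
    first  : ∀ {c′ s′ c₂ s₂} → step (enterS s′) c ≡ just c′ →
             step (enterS s₂) c ≡ just c₂ → Tr ρ c₂ → Go ρ c (s′ ∷ s₂ ∷ []) c′ s′
    second : ∀ {c′ s′ c₂ s₂} → step (enterS s′) c ≡ just c′ →
             step (enterS s₂) c ≡ just c₂ → Tr ρ c₂ → Go ρ c (s₂ ∷ s′ ∷ []) c′ s′

  -- The tile `s` at `c` has been chosen but is not yet in the list; freeness is demanded only when
  -- the path moves on. A stretch of path can thus end with a step into a cell whose freeness is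
  -- left to the next stretch.
  data Ready : List Placed → Cell → State → Set where
    init  : Ready [] c₀ start
    place : ∀ {ρ c s c′ s′} → Ready ρ c s → Free ρ c s → Distinct s →
            Go ((c , s) ∷ ρ) c (trunkOuts s) c′ s′ → Ready ((c , s) ∷ ρ) c′ s′

  data Finished : List Placed → Set where
    finished : ∀ {ρ c s} → Ready ρ c s → Free ρ c s → Distinct s → trunkOuts s ≡ [] → Finished ((c , s) ∷ ρ)

  Go-∈ : ∀ {ρ c ss c′ s′} → Go ρ c ss c′ s′ → s′ ∈ ss
  Go-∈ (only _) = here refl
  Go-∈ (first _ _ _) = here refl
  Go-∈ (second _ _ _) = there (here refl)

  Go-step : ∀ {ρ c ss c′ s′} → Go ρ c ss c′ s′ → step (enterS s′) c ≡ just c′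
  Go-step (only e) = e
  Go-step (first e _ _) = e
  Go-step (second e _ _) = e

  -- `State` is infinite. The predicate `V` holds of the start and is closed under successors, and
  -- only on it must `enc` be faithful.
  module Assemble
    {m : ℕ} (enc : State → Fin m) (dec : Fin m → State) (V : State → Set)
    (dec-enc : ∀ s → V s → dec (enc s) ≡ s)
    (V-start : V start) (V-outs : ∀ s → V s → All V (outs s))
    (start-∉ : ∀ s → All (_≢ start) (outs s))
    (start-out : All (λ s → enterS s ≢ opp (enterS start)) (outs start))
    (enter-filler : ∀ h → enterS (filler h) ≡ south)
    (trunk-filler : ∀ h → trunkOuts (filler (suc h)) ≡ filler h ∷ [])
    (trunk-filler₀ : trunkOuts (filler 0) ≡ [])
    (fill-filler : ∀ h → fillTop (filler h) ≡ nothing) where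

    open FinMachine m (enterS ∘ dec) (map enc ∘ outs ∘ dec) (enc start) (emb c₀) public

    enc-injective : ∀ {s t} → V s → V t → enc s ≡ enc t → s ≡ t
    enc-injective v w e = trans (sym (dec-enc _ v)) (trans (cong dec e) (dec-enc _ w))

    enter-enc : ∀ {s} → V s → enterS (dec (enc s)) ≡ enterS s
    enter-enc v = cong enterS (dec-enc _ v)

    out-inv : ∀ {s d t} → V s → out (enc s) d ≡ just t →
              ∃[ s′ ] s′ ∈ outs s × V s′ × t ≡ enc s′ × enterS s′ ≡ d
    out-inv {s} {d} {t} v o with ∈-map⁻ enc (pick-∈ (map enc (outs (dec (enc s)))) o)
    ... | s′ , s′∈ , refl with subst (λ r → s′ ∈ outs r) (dec-enc _ v) s′∈
    ...   | s′∈′ with All.lookup (V-outs _ v) s′∈′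
    ...     | v′ = s′ , s′∈′ , v′ , refl , trans (sym (enter-enc v′)) (out-enter {enc s} o)

    pick-first : ∀ {s′} ss → All V ss → AllPairs (λ a b → enterS a ≢ enterS b) ss → s′ ∈ ss →
                 pick (enterS s′) (map enc ss) ≡ just (enc s′)
    pick-first (s ∷ ss) (v ∷ vs) (_ ∷ _) (here refl) with enterS (dec (enc s)) ≟D enterS s
    ... | yes _ = refl
    ... | no n = contradiction (enter-enc v) n
    pick-first {s′} (s ∷ ss) (v ∷ vs) (d ∷ ds) (there s′∈) with enterS (dec (enc s)) ≟D enterS s′
    ... | yes e = contradiction (trans (sym (enter-enc v)) e) (All.lookup d s′∈)
    ... | no n = pick-first ss vs ds s′∈

    out-enc : ∀ {s s′} → V s → Distinct s → s′ ∈ outs s → out (enc s) (enterS s′) ≡ just (enc s′)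
    out-enc {s} {s′} v di s′∈ = subst (λ r → pick (enterS s′) (map enc (outs r)) ≡ just (enc s′))
                                      (sym (dec-enc _ v)) (pick-first (outs s) (V-outs _ v) di s′∈)

    enc-≢-start : ∀ {s s′} → V s → s′ ∈ outs s → enc s′ ≢ enc start
    enc-≢-start {s} v s′∈ e =
      All.lookup (start-∉ s) s′∈ (enc-injective (All.lookup (V-outs _ v) s′∈) V-start e)

    column : ℕ → ℕ → List Entry → List Entry
    column x zero L = (emb (x , 0 , 0) , enc (filler 0)) ∷ L
    column x (suc h) L = column x h ((emb (x , suc h , 0) , enc (filler (suc h))) ∷ L)

    addFill : Cell → Maybe ℕ → List Entry → List Entry
    addFill (x , _) (just h) L = column x h L
    addFill _ nothing L = L

    entries : List Placed → List Entry
    entries [] = []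
    entries ((c , s) ∷ ρ) = addFill c (fillTop s) ((emb c , enc s) ∷ entries ρ)

    column-old : ∀ x h {L e} → e ∈ L → e ∈ column x h L
    column-old x zero e∈ = there e∈
    column-old x (suc h) e∈ = column-old x h (there e∈)

    column-new : ∀ x h {L y} → y ≤ h → (emb (x , y , 0) , enc (filler y)) ∈ column x h L
    column-new x zero z≤n = here refl
    column-new x (suc h) {y = y} y≤ with m≤n⇒m<n∨m≡n y≤
    ... | inj₁ (s≤s lt) = column-new x h lt
    ... | inj₂ refl = column-old x h (here refl)

    column-inv : ∀ x h {L p i} → (p , i) ∈ column x h L →
                 (p , i) ∈ L ⊎ ∃[ y ] y ≤ h × p ≡ emb (x , y , 0) × i ≡ enc (filler y)
    column-inv x zero (here refl) = inj₂ (0 , z≤n , refl , refl)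
    column-inv x zero (there e∈) = inj₁ e∈
    column-inv x (suc h) e∈ with column-inv x h e∈
    ... | inj₁ (here refl) = inj₂ (suc h , ≤-refl , refl , refl)
    ... | inj₁ (there e∈′) = inj₁ e∈′
    ... | inj₂ (y , y≤ , r) = inj₂ (y , m≤n⇒m≤1+n y≤ , r)

    addFill-old : ∀ c f {L e} → e ∈ L → e ∈ addFill c f L
    addFill-old c (just h) = column-old (proj₁ c) h
    addFill-old c nothing e∈ = e∈

    entries-trunk : ∀ {ρ c s} → (c , s) ∈ ρ → (emb c , enc s) ∈ entries ρ
    entries-trunk {(c , s) ∷ ρ} (here refl) = addFill-old c (fillTop s) (here refl)
    entries-trunk {(c , s) ∷ ρ} (there e∈) = addFill-old c (fillTop s) (there (entries-trunk e∈))

    entries-filler : ∀ {ρ x y₁ z₁ s h y} → ((x , y₁ , z₁) , s) ∈ ρ → fillTop s ≡ just h → y ≤ h →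
                     (emb (x , y , 0) , enc (filler y)) ∈ entries ρ
    entries-filler {(c , s) ∷ ρ} (here refl) f y≤ rewrite f = column-new _ _ y≤
    entries-filler {(c , s) ∷ ρ} (there e∈) f y≤ = addFill-old c (fillTop s) (there (entries-filler e∈ f y≤))

    data Kind (ρ : List Placed) : Pos → Fin m → Set where
      trunk : ∀ {c s} → (c , s) ∈ ρ → Kind ρ (emb c) (enc s)
      fill  : ∀ {x y₁ z₁ s h y} → ((x , y₁ , z₁) , s) ∈ ρ → fillTop s ≡ just h → y ≤ h →
              Kind ρ (emb (x , y , 0)) (enc (filler y))

    Kind-∷ : ∀ {e ρ p i} → Kind ρ p i → Kind (e ∷ ρ) p i
    Kind-∷ (trunk e∈) = trunk (there e∈)
    Kind-∷ (fill e∈ f y≤) = fill (there e∈) f y≤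

    kind : ∀ ρ {p i} → (p , i) ∈ entries ρ → Kind ρ p i
    kind-new : ∀ ρ c s {p i} → (p , i) ∈ (emb c , enc s) ∷ entries ρ → Kind ((c , s) ∷ ρ) p i
    kind-new ρ c s (here refl) = trunk (here refl)
    kind-new ρ c s (there e∈) = Kind-∷ (kind ρ e∈)
    kind ((c , s) ∷ ρ) e∈ with fillTop s in eq
    ... | nothing = kind-new ρ c s e∈
    ... | just h with column-inv (proj₁ c) h e∈
    ...   | inj₁ e∈′ = kind-new ρ c s e∈′
    ...   | inj₂ (y , y≤ , refl , refl) = fill (here refl) eq y≤

    Kind-Occ : ∀ {ρ p i} → Kind ρ p i → ∃[ q ] p ≡ emb q × Occ ρ q
    Kind-Occ {ρ} (trunk {c} e∈) = c , refl , go e∈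
      where go : ∀ {ρ c s} → (c , s) ∈ ρ → Occ ρ c
            go (here refl) = here (inj₁ refl)
            go (there e∈) = there (go e∈)
    Kind-Occ (fill {x} {y = y} e∈ f y≤) = (x , y , 0) , refl , go e∈ f y≤
      where go : ∀ {ρ x y₁ z₁ s h y} → ((x , y₁ , z₁) , s) ∈ ρ → fillTop s ≡ just h → y ≤ h → Occ ρ (x , y , 0)
            go (here refl) f y≤ = here (inj₂ (_ , f , refl , y≤ , refl))
            go (there e∈) f y≤ = there (go e∈ f y≤)

    Occ-entry : ∀ {ρ q} → Occ ρ q → ∃[ i ] (emb q , i) ∈ entries ρ
    Occ-entry {(c , s) ∷ ρ} (here (inj₁ refl)) = enc s , addFill-old c (fillTop s) (here refl)
    Occ-entry {(c , s) ∷ ρ} (here (inj₂ (h , f , refl , y≤ , refl))) rewrite f = _ , column-new _ h y≤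
    Occ-entry {(c , s) ∷ ρ} (there o) = let i , i∈ = Occ-entry o in i , addFill-old c (fillTop s) (there i∈)

    ¬Occ-entry : ∀ {ρ q} → ¬ Occ ρ q → ∀ j → (emb q , j) ∉ entries ρ
    ¬Occ-entry {ρ} {q} ¬o j j∈ with Kind-Occ (kind ρ j∈)
    ... | q′ , e , o = ¬o (subst (Occ ρ) (sym (emb-injective e)) o)

    ready-V : ∀ {ρ c s} → Ready ρ c s → V s
    ready-V init = V-start
    ready-V (place {s = s} r _ _ g) = All.lookup (V-outs _ (ready-V r)) (∈-++⁺ˡ (Go-∈ g))

    V-filler : ∀ h → V (filler (suc h)) → V (filler h)
    V-filler h v = All.lookup (V-outs _ v) (∈-++⁺ˡ (subst (filler h ∈_) (sym (trunk-filler h)) (here refl)))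

    V-fill : ∀ {s h} → V s → fillTop s ≡ just h → V (filler h)
    V-fill {s} {h} v f = All.lookup (V-outs _ v)
      (∈-++⁺ʳ (trunkOuts s) (subst (λ f → filler h ∈ fillOuts f) (sym f) (here refl)))

    filler-outs : ∀ y {s′} → s′ ∈ outs (filler y) → ∃[ y′ ] y ≡ suc y′ × s′ ≡ filler y′
    filler-outs zero s′∈ rewrite trunk-filler₀ | fill-filler 0 with s′∈
    ... | ()
    filler-outs (suc y) s′∈ rewrite trunk-filler y | fill-filler (suc y) with s′∈
    ... | here e = y , refl , e

    filler-distinct : ∀ h → Distinct (filler h)
    filler-distinct zero rewrite trunk-filler₀ | fill-filler 0 = []
    filler-distinct (suc h) rewrite trunk-filler h | fill-filler (suc h) = [] ∷ []

    column-tree : ∀ {x y L i} h → Tree L → y ≡ suc h → (emb (x , y , 0) , i) ∈ L →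
                  out i south ≡ just (enc (filler h)) → enc (filler h) ≢ enc start → V (filler h) →
                  (∀ y → y ≤ h → ∀ j → (emb (x , y , 0) , j) ∉ L) → Tree (column x h L)
    column-tree zero T refl i∈ o n v fr = node T i∈ o n (fr 0 z≤n)
    column-tree {x} (suc h) T refl i∈ o n v fr =
      column-tree h (node T i∈ o n (fr (suc h) ≤-refl)) refl (here refl)
        (trans (cong (out (enc (filler (suc h)))) (sym (enter-filler h)))
               (out-enc v (filler-distinct (suc h)) h∈))
        (enc-≢-start v h∈) (V-filler h v) fr′
      where
      h∈ : filler h ∈ outs (filler (suc h))
      h∈ = ∈-++⁺ˡ (subst (filler h ∈_) (sym (trunk-filler h)) (here refl))
      fr′ : ∀ y → y ≤ h → ∀ j → (emb (x , y , 0) , j) ∉ (emb (x , suc h , 0) , _) ∷ _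
      fr′ y y≤ j (here e) with emb-injective (cong proj₁ e)
      ... | refl = 1+n≰n y≤
      fr′ y y≤ j (there j∈) = fr y (m≤n⇒m≤1+n y≤) j j∈

    addFill-tree : ∀ {c s ρ L} → V s → Distinct s → Free ρ c s → Tree L → (emb c , enc s) ∈ L →
                   (∀ {q j} → (emb q , j) ∈ L → q ≡ c ⊎ Occ ρ q) → Tree (addFill c (fillTop s) L)
    addFill-tree {c} {s} v di fr T c∈ old with fillTop s in eq
    ... | nothing = T
    ... | just h with proj₂ fr h refl
    ...   | x , refl , free =
      column-tree h T refl c∈
        (trans (cong (out (enc s)) (sym (enter-filler h))) (out-enc v di′ h∈))
        (enc-≢-start v h∈) (V-fill v eq)
        λ y y≤ j j∈ → case old j∈ of λ where
          (inj₁ refl) → 1+n≰n y≤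
          (inj₂ o) → free y y≤ o
      where
      h∈ : filler h ∈ outs s
      h∈ = ∈-++⁺ʳ (trunkOuts s) (subst (λ f → filler h ∈ fillOuts f) (sym eq) (here refl))
      di′ : Distinct s
      di′ = subst (λ f → AllPairs (λ a b → enterS a ≢ enterS b) (trunkOuts s ++ fillOuts f)) (sym eq) di

    ready-tree : ∀ {ρ c s} → Ready ρ c s → Free ρ c s → Distinct s → Tree (entries ((c , s) ∷ ρ))
    ready-tree {s = s} init fr di =
      addFill-tree V-start di fr root (here refl) λ where
        (here e) → inj₁ (emb-injective (cong proj₁ e))
    ready-tree {s = s} r@(place {ρ} {c₁} {s₁} {c} {s} r₁ fr₁ di₁ g) fr di =
      addFill-tree (ready-V r) di fr
        (subst (λ p → Tree ((p , enc s) ∷ entries ((c₁ , s₁) ∷ ρ))) ec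
          (node (ready-tree r₁ fr₁ di₁) (entries-trunk {(c₁ , s₁) ∷ ρ} (here refl))
            (out-enc (ready-V r₁) di₁ (∈-++⁺ˡ (Go-∈ g))) (enc-≢-start (ready-V r₁) (∈-++⁺ˡ (Go-∈ g)))
            (λ j j∈ → ¬Occ-entry (proj₁ fr) j (subst (λ p → (p , j) ∈ entries ((c₁ , s₁) ∷ ρ)) ec j∈))))
        (here refl) λ where
          (here e) → inj₁ (emb-injective (cong proj₁ e))
          (there j∈) → let q , e , o = Kind-Occ (kind ((c₁ , s₁) ∷ ρ) j∈)
                       in inj₂ (subst (Occ ((c₁ , s₁) ∷ ρ)) (sym (emb-injective e)) o)
      where
      ec : neighbour (emb c₁) (enterS s) ≡ emb c
      ec = emb-step (enterS s) (Go-step g)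

    -- The cell `q` belonged to the trunk by the time the tile at `c` was placed. Membership in the
    -- finished trunk would be too weak, since a later tile is no ancestor.
    data Older : List Placed → Cell → Cell → Set where
      now   : ∀ {c s ρ q} → Tr ((c , s) ∷ ρ) q → Older ((c , s) ∷ ρ) c q
      later : ∀ {e ρ c q} → Older ρ c q → Older (e ∷ ρ) c q

    Settled : List Placed → List Placed → Set
    Settled ρ⁺ ρ = ∀ c s s′ → (c , s) ∈ ρ → s′ ∈ trunkOuts s →
      ∃[ c′ ] step (enterS s′) c ≡ just c′ × ((c′ , s′) ∈ ρ⁺ ⊎ Older ρ c c′)

    go-settled : ∀ {ρ c ss c′ s′} s t → Go ((c , s) ∷ ρ) c ss c′ s′ → t ∈ ss →
                 ∃[ c₁ ] step (enterS t) c ≡ just c₁ ×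
                   ((c₁ , t) ∈ (c′ , s′) ∷ (c , s) ∷ ρ ⊎ Older ((c , s) ∷ ρ) c c₁)
    go-settled s t (only e) (here refl) = _ , e , inj₁ (here refl)
    go-settled s t (first e e₂ tr) (here refl) = _ , e , inj₁ (here refl)
    go-settled s t (first e e₂ tr) (there (here refl)) = _ , e₂ , inj₂ (now tr)
    go-settled s t (second e e₂ tr) (here refl) = _ , e₂ , inj₂ (now tr)
    go-settled s t (second e e₂ tr) (there (here refl)) = _ , e , inj₁ (here refl)

    ready-settled : ∀ {ρ c s} → Ready ρ c s → Settled ((c , s) ∷ ρ) ρ
    ready-settled init c s s′ ()
    ready-settled (place {s = s₁} r _ _ g) c s s′ (here refl) s′∈ = go-settled s₁ s′ g s′∈
    ready-settled (place r _ _ g) c s s′ (there c∈) s′∈ with ready-settled r c s s′ c∈ s′∈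
    ... | c′ , e , inj₁ i = c′ , e , inj₁ (there i)
    ... | c′ , e , inj₂ o = c′ , e , inj₂ (later o)

    finished-settled : ∀ {ρ} → Finished ρ → Settled ρ ρ
    finished-settled (finished r _ _ e) c s s′ (here refl) s′∈ rewrite e with s′∈
    ... | ()
    finished-settled (finished r _ _ e) c s s′ (there c∈) s′∈ with ready-settled r c s s′ c∈ s′∈
    ... | c′ , f , inj₁ i = c′ , f , inj₁ i
    ... | c′ , f , inj₂ o = c′ , f , inj₂ (later o)

    start-Tr : ∀ {ρ c s} → Ready ρ c s → Tr ((c , s) ∷ ρ) c₀
    start-Tr init = _ , here refl
    start-Tr (place r _ _ _) = let s , e∈ = start-Tr r in s , there e∈

    module _ {L : List Entry} {A : Pos → Set} (cl : Closed L A) where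

      -- The trunk does not branch, so the chain of parents from its last tile passes through every
      -- earlier trunk cell.
      descend : ∀ {ρ c s q} → Ready ρ c s → Free ρ c s → (∀ {e} → e ∈ entries ((c , s) ∷ ρ) → e ∈ L) →
                A (emb c) → Tr ((c , s) ∷ ρ) q → A (emb q)
      descend r fr sub a (_ , here refl) = a
      descend {q = q} r@(place {ρ} {c₁} {s₁} {c} {s} r₁ fr₁ di₁ g) fr sub a (t , there q∈) =
        descend r₁ fr₁ (λ {e} e∈ → sub (addFill-old c (fillTop s) (there e∈)))
          (subst A back (cl (emb c) (enc s) (sub (entries-trunk {(c , s) ∷ (c₁ , s₁) ∷ ρ} (here refl))) away a))
          (t , q∈)
        where
        away : emb c ≢ emb c₀
        away e = proj₁ fr (subst (Occ ((c₁ , s₁) ∷ ρ)) (sym (emb-injective e)) (Tr-Occ (start-Tr r₁)))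
        back : neighbour (emb c) (opp (enterS (dec (enc s)))) ≡ emb c₁
        back rewrite enter-enc (ready-V r) | sym (emb-step (enterS s) (Go-step g)) = neighbour-opp (emb c₁) (enterS s)

      descend-older : ∀ {ρ c s c₁ q} → Ready ρ c s → Free ρ c s →
                      (∀ {e} → e ∈ entries ((c , s) ∷ ρ) → e ∈ L) →
                      Older ((c , s) ∷ ρ) c₁ q → A (emb c₁) → A (emb q)
      descend-older r fr sub (now tr) a = descend r fr sub a tr
      descend-older (place {s = s₁} r fr di g) _ sub (later o) a =
        descend-older r fr (λ {e} e∈ → sub (addFill-old _ (fillTop _) (there e∈))) o a

    assembles : ∀ {ρ} → Finished ρ → {X : Pos → Set} →
                (∀ p → X p → ∃[ q ] p ≡ emb q × Occ ρ q) → (∀ q → Occ ρ q → X (emb q)) →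
                UniquelySelfAssembles 𝒯 X
    assembles {ρ} F@(finished {ρ′} {c} {s} r fr di e) {X} into onto =
      Unique.uniquelySelfAssembles seed-out T sat dom
      where
      T : Tree (entries ρ)
      T = ready-tree r fr di
      seed-out : ∀ d t → out (enc start) d ≡ just t → d ≢ opp (enterS (dec (enc start)))
      seed-out d t o f with out-inv V-start o
      ... | s′ , s′∈ , _ , _ , en = All.lookup start-out s′∈ (trans en (trans f (cong opp (enter-enc V-start))))
      trunk-V : ∀ {ρ c s} → Ready ρ c s → ∀ {c₁ s₁} → (c₁ , s₁) ∈ (c , s) ∷ ρ → V s₁
      trunk-V r (here refl) = ready-V r
      trunk-V (place r _ _ _) (there i) = trunk-V r i
      filler-V : ∀ {h y} → y ≤ h → V (filler h) → V (filler y)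
      filler-V {zero} z≤n v = v
      filler-V {suc h} y≤ v with m≤n⇒m<n∨m≡n y≤
      ... | inj₁ (s≤s lt) = filler-V lt (V-filler h v)
      ... | inj₂ refl = v
      sat : Satisfied (entries ρ)
      sat p i d t p∈ o = satK (kind ρ p∈) o
        where
        fillAt : ∀ {ρ c s} → Ready ρ c s → Free ρ c s → ∀ {c₁ s₁ h} → (c₁ , s₁) ∈ (c , s) ∷ ρ →
                 fillTop s₁ ≡ just h → ∃[ x ] c₁ ≡ (x , suc h , 0)
        fillAt r fr (here refl) f = let x , e , _ = proj₂ fr _ f in x , e
        fillAt (place r fr _ _) _ (there i) f = fillAt r fr i f
        satK : ∀ {p i} → Kind ρ p i → out i d ≡ just t →
               (neighbour p d , t) ∈ entries ρ ⊎ Blocked (entries ρ) p (neighbour p d)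
        satK (trunk {c₁} {s₁} c∈) o with out-inv (trunk-V r c∈) o
        ... | s′ , s′∈ , v′ , refl , refl with ∈-++⁻ (trunkOuts s₁) s′∈
        ...   | inj₁ s′∈t with finished-settled F c₁ s₁ s′ c∈ s′∈t
        ...     | c′ , st , inj₁ c′∈ = inj₁ (subst (λ p → (p , enc s′) ∈ entries ρ) (sym (emb-step _ st)) (entries-trunk c′∈))
        ...     | c′ , st , inj₂ ol = inj₂ λ A cl a →
                    subst A (sym (emb-step _ st)) (descend-older cl r fr (λ e∈ → e∈) ol a)
        satK (trunk {c₁} {s₁} c∈) o | s′ , s′∈ , v′ , refl , refl | inj₂ s′∈f with fillTop s₁ in eq
        satK (trunk {c₁} {s₁} c∈) o | s′ , s′∈ , v′ , refl , refl | inj₂ (here refl) | just h with fillAt r fr c∈ eq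
        ... | x , refl rewrite enter-filler h = inj₁ (entries-filler c∈ eq ≤-refl)
        satK (fill {x} {y = y} c∈ f y≤) o with out-inv (filler-V y≤ (V-fill (trunk-V r c∈) f)) o
        ... | s′ , s′∈ , v′ , refl , refl with filler-outs y s′∈
        ...   | y′ , refl , refl rewrite enter-filler y′ = inj₁ (entries-filler c∈ f (≤-trans (n≤1+n y′) y≤))
      dom : ∀ p → (X p → ∃[ i ] (p , i) ∈ entries ρ) × (∃[ i ] (p , i) ∈ entries ρ → X p)
      dom p = (λ x → let q , e , o = into p x ; i , i∈ = Occ-entry o
                     in i , subst (λ p → (p , i) ∈ entries ρ) (sym e) i∈) ,
              λ (i , i∈) → let q , e , o = Kind-Occ (kind ρ i∈) in subst X (sym e) (onto q o)

-- The counter as a program for the path, and the execution of straight programs.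

allTrue : List Bool → Bool
allTrue [] = true
allTrue (b ∷ bs) = b ∧ allTrue bs

-- Digits are little-endian bit lists.
next : List Bool → List Bool
next [] = []
next (false ∷ bs) = true ∷ bs
next (true ∷ bs) = false ∷ next bs

Move : Set
Move = Dir × Bool

pattern N = (north , false)
pattern E = (east , false)
pattern S = (south , false)
pattern W = (west , false)
pattern U = (up , false)
pattern D = (down , false)

-- a move onto a cell that starts a filler column
pattern E• = (east , true)
pattern S• = (south , true)
pattern W• = (west , true)
pattern D• = (down , true)

-- A node is a straight program of moves, and a tile type is a position in such a program.
-- One cycle of digit j: write and wbit lay its bits, leave descends to the lower digits, whose
-- run (enter, …) ends in turn, which builds the pillar that will stop carry; back returns west,
-- dip, test and bit read the digit, lift climbs to the second row of the digit, carry takes the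
-- value east, and from the pocket left by turn (stop) the next cycle begins (again) unless the
-- digit overflows.
data Node : Set where
  origin : Node
  pad   : ℕ → Node
  enter : Bool → ℕ → Node
  row   : ℕ → Node
  turn  : ℕ → Node
  back  : ℕ → Node
  dip   : ℕ → Node
  test  : ℕ → List Bool → Node
  bit   : ℕ → Bool → List Bool → Node
  lift  : ℕ → List Bool → Node
  carry : ℕ → List Bool → Node
  stop  : ℕ → List Bool → Node
  again : ℕ → List Bool → Node
  write : Bool → ℕ → List Bool → Node
  wbit  : Bool → ℕ → Bool → List Bool → Node
  leave : Bool → ℕ → Node
  fill  : ℕ → Node

State : Set
State = Node × ℕ

prog : Node → List Move
prog origin = E• ∷ []
prog (pad zero) = U ∷ []
prog (pad (suc i)) = E• ∷ []
prog (enter _ zero) = E ∷ D• ∷ []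
prog (enter _ (suc j)) = E ∷ E ∷ S ∷ []
prog (row zero) = U ∷ S ∷ []
prog (row (suc i)) = E• ∷ []
prog (turn j) = E ∷ N ∷ D• ∷ E• ∷ E• ∷ N ∷ N ∷ U ∷ W ∷ W ∷ S ∷ D ∷ []
prog (back j) = W ∷ []
prog (dip j) = S• ∷ W• ∷ []
prog (test j bs) = W• ∷ []
prog (bit j false bs) = W• ∷ W• ∷ W• ∷ []
prog (bit j true bs) = U ∷ W ∷ W ∷ W ∷ D• ∷ []
prog (lift j bs) = W• ∷ W• ∷ N ∷ N ∷ []
prog (carry j bs) = E ∷ []
prog (stop j bs) = S ∷ U ∷ E ∷ []
prog (again j bs) = E ∷ E ∷ []
prog (write f j bs) = D ∷ []
prog (wbit f j false bs) = E ∷ E ∷ E ∷ U ∷ S ∷ E ∷ N ∷ D ∷ []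
prog (wbit f j true bs) = E ∷ E ∷ S• ∷ E• ∷ N ∷ E ∷ []
prog (leave f j) = E ∷ U ∷ E ∷ S ∷ []
prog (fill h) = S ∷ []

at : List Move → ℕ → Maybe Move
at [] _ = nothing
at (m ∷ ms) zero = just m
at (m ∷ ms) (suc i) = at ms i

moveDir : Maybe Move → Dir
moveDir (just (d , _)) = d
moveDir nothing = east

-- The state `(nd , i)` is the tile laid by move `i` of the program, so the direction of entry is
-- part of the type. Past the end of a program the direction `east` is a dummy.
enterS : State → Dir
enterS (nd , i) = moveDir (at (prog nd) i)

infix 8 _⊕_
_⊕_ : Cell → ℕ × ℕ → Cell
(i , j , z) ⊕ (X , Y) = i + X , j + Y , z

-- An impossible step stays put. Distinctness of the offsets of a program therefore also shows that
-- all its steps exist.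
move : Dir → Cell → Cell
move d o = fromMaybe o (step d o)

step-⊕ : ∀ d o b → move d o ≢ o → step d (o ⊕ b) ≡ just (move d o ⊕ b)
step-⊕ north o b _ = refl
step-⊕ east o b _ = refl
step-⊕ south (x , zero , z) b n = contradiction refl n
step-⊕ south (x , suc y , z) b n = refl
step-⊕ west (zero , y , z) b n = contradiction refl n
step-⊕ west (suc x , y , z) b n = refl
step-⊕ up o b _ = refl
step-⊕ down (x , y , zero) b n = contradiction refl n
step-⊕ down (x , y , suc z) b n = refl

⊕-injective : ∀ o o′ b → o ⊕ b ≡ o′ ⊕ b → o ≡ o′
⊕-injective (i , j , z) (i′ , j′ , z′) (X , Y) e
  with +-cancelʳ-≡ X i i′ (cong proj₁ e) | +-cancelʳ-≡ Y j j′ (cong (proj₁ ∘ proj₂) e) | cong (proj₂ ∘ proj₂) e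
... | refl | refl | refl = refl

Mark : Set
Mark = Cell × Bool

offsets : Cell → Move → List Move → List Mark
offsets o (_ , f) [] = (o , f) ∷ []
offsets o (_ , f) (m@(d , _) ∷ ms) = (o , f) ∷ offsets (move d o) m ms

lastOffset : Cell → List Move → Cell
lastOffset o [] = o
lastOffset o ((d , _) ∷ ms) = lastOffset (move d o) ms

lastMark : Move → List Move → Bool
lastMark (_ , f) [] = f
lastMark _ (m ∷ ms) = lastMark m ms

-- Relative to its base row, a program keeps above row 0 in layer 0 and starts fillers only from row
-- 1 of layer 0, so no filler runs into the program that started it.
MarkOK : Mark → Set
MarkOK ((i , j , z) , f) = (z ≡ 0 → 1 ≤ j) × (f ≡ true → j ≡ 1 × z ≡ 0)

Sound : List Mark → Set
Sound os = AllPairs (λ a b → proj₁ a ≢ proj₁ b) os × All MarkOK os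

_≟C_ : (c c′ : Cell) → Dec (c ≡ c′)
_≟C_ = ≡-dec ℕ._≟_ (≡-dec ℕ._≟_ ℕ._≟_)

markOK? : ∀ m → Dec (MarkOK m)
markOK? ((i , j , z) , f) =
  ((z ℕ.≟ 0) →-dec (1 ≤? j)) ×-dec ((f Boolₚ.≟ true) →-dec ((j ℕ.≟ 1) ×-dec (z ℕ.≟ 0)))

-- Offsets are relative, so one evaluation of this test covers a program wherever it is run.
sound? : ∀ os → Dec (Sound os)
sound? os = allPairs? (λ a b → ¬? (proj₁ a ≟C proj₁ b)) os ×-dec All.all? markOK? os

-- n bits per digit, digits 0, …, digits − 1, rows and padding of lengths rowLen and padLen;
-- initial j is the first value of digit j.
module Program (n digits padLen rowLen y₀ : ℕ) (initial : ℕ → List Bool) where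

  base : ℕ → ℕ
  base zero = y₀
  base (suc j) = 2 + base j

  height : Node → ℕ
  height origin = base digits
  height (pad _) = base digits
  height (enter _ zero) = base 0
  height (enter _ (suc j)) = base j
  height (row _) = base 0
  height (turn j) = base j
  height (back j) = base j
  height (dip j) = base j
  height (test j _) = base j
  height (bit j _ _) = base j
  height (lift j _) = base j
  height (carry j _) = base j
  height (stop j _) = base j
  height (again j _) = base j
  height (write _ j _) = base j
  height (wbit _ j _ _) = base j
  height (leave _ j) = base j
  height (fill h) = h

  -- The digits below `j` have overflowed, and digit `j` takes over; if there is no digit `j`, the
  -- path ends.
  ascend : ℕ → List Node
  ascend j with j <? digits
  ... | yes _ = turn j ∷ []
  ... | no _ = []

  read : ℕ → List Bool → Node
  read j bs with length bs ℕ.≟ n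
  ... | yes _ = lift j bs
  ... | no _ = test j bs

  writeRest : Bool → ℕ → List Bool → Node
  writeRest f j [] = leave f j
  writeRest f j (b ∷ bs) = wbit f j b bs

  exits : Node → List Node
  exits origin = pad (suc padLen) ∷ []
  exits (pad zero) = enter true digits ∷ []
  exits (pad (suc i)) = pad i ∷ []
  exits (enter _ zero) = row (suc rowLen) ∷ []
  -- The flag is `true` only on the first descent, where each digit takes its initial value; every
  -- later descent starts from zeros.
  exits (enter true (suc j)) = write true j (initial j) ∷ []
  exits (enter false (suc j)) = write false j (replicate n false) ∷ []
  exits (row zero) = ascend 0
  exits (row (suc i)) = row i ∷ []
  exits (turn j) = back j ∷ []
  exits (back j) = back j ∷ dip j ∷ []
  exits (dip j) = read j [] ∷ []
  exits (test j bs) = bit j false bs ∷ bit j true bs ∷ []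
  exits (bit j b bs) = read j (b ∷ bs) ∷ []
  exits (lift j bs) = carry j bs ∷ []
  exits (carry j bs) = carry j bs ∷ stop j bs ∷ []
  exits (stop j bs) = if allTrue bs then ascend (suc j) else again j (next bs) ∷ []
  exits (again j bs) = write false j bs ∷ []
  exits (write f j bs) = writeRest f j bs ∷ []
  exits (wbit f j b bs) = writeRest f j bs ∷ []
  exits (leave f j) = enter f j ∷ []
  exits (fill zero) = []
  exits (fill (suc h)) = fill h ∷ []

  first₀ : Node → State
  first₀ nd = nd , 0

  continue : Node → ℕ → Maybe Move → List State
  continue nd i (just _) = (nd , suc i) ∷ []
  continue nd i nothing = map first₀ (exits nd)

  trunkOuts : State → List State
  trunkOuts (nd , i) = continue nd i (at (prog nd) (suc i))

  markTop : ℕ → Bool → Maybe ℕ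
  markTop h true = just h
  markTop h false = nothing

  moveTop : ℕ → Maybe Move → Maybe ℕ
  moveTop h (just (_ , f)) = markTop h f
  moveTop h nothing = nothing

  fillTop : State → Maybe ℕ
  fillTop (nd , i) = moveTop (height nd) (at (prog nd) i)

  filler : ℕ → State
  filler h = fill h , 0

  open Trunk enterS trunkOuts fillTop filler (origin , 0) (0 , suc (base digits) , 0) public

  -- `P` confines the cells added, so freeness carries over outside `P`, while trunk cells once laid
  -- keep blocking.
  record Ext (ρ ρ′ : List Placed) (P : Cell → Set) : Set where
    field
      occ : ∀ {q} → Occ ρ′ q → P q ⊎ Occ ρ q
      old : ∀ {q} → Occ ρ q → Occ ρ′ q
      tr  : ∀ {q} → Tr ρ q → Tr ρ′ q
  open Ext public

  Ext-refl : ∀ {ρ P} → Ext ρ ρ P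
  Ext-refl .occ = inj₂
  Ext-refl .old o = o
  Ext-refl .tr t = t

  Ext-trans : ∀ {ρ ρ′ ρ″ P Q} → Ext ρ ρ′ P → Ext ρ′ ρ″ Q → Ext ρ ρ″ (λ q → P q ⊎ Q q)
  Ext-trans a b .occ o with occ b o
  ... | inj₁ q = inj₁ (inj₂ q)
  ... | inj₂ o′ with occ a o′
  ...   | inj₁ p = inj₁ (inj₁ p)
  ...   | inj₂ o″ = inj₂ o″
  Ext-trans a b .old = old b ∘ old a
  Ext-trans a b .tr = tr b ∘ tr a

  Ext-weaken : ∀ {ρ ρ′ P Q} → (∀ {q} → P q → Q q) → Ext ρ ρ′ P → Ext ρ ρ′ Q
  Ext-weaken f a .occ o with occ a o
  ... | inj₁ p = inj₁ (f p)
  ... | inj₂ o′ = inj₂ o′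
  Ext-weaken f a .old = old a
  Ext-weaken f a .tr = tr a

  Ext-free : ∀ {ρ ρ′ P q} → Ext ρ ρ′ P → ¬ P q → ¬ Occ ρ q → ¬ Occ ρ′ q
  Ext-free a ¬p ¬o o with occ a o
  ... | inj₁ p = ¬p p
  ... | inj₂ o′ = ¬o o′

  InMark : ℕ × ℕ → Cell → Mark → Set
  InMark b (x , y , z) (o , f) = (x , y , z) ≡ o ⊕ b ⊎ (f ≡ true × x ≡ proj₁ o + proj₁ b × y ≤ proj₂ b × z ≡ 0)

  InMarks : List Mark → ℕ × ℕ → Cell → Set
  InMarks os b q = Any (InMark b q) os

  MarkFree : List Placed → ℕ × ℕ → Mark → Set
  MarkFree ρ b (o , f) = ¬ Occ ρ (o ⊕ b) × (f ≡ true → ∀ y → y ≤ proj₂ b → ¬ Occ ρ (proj₁ o + proj₁ b , y , 0))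

  markTop-true : ∀ {h g f} → markTop h f ≡ just g → f ≡ true × h ≡ g
  markTop-true {f = true} refl = refl , refl

  placed-Ext : ∀ {ρ nd i o d f b} → at (prog nd) i ≡ just (d , f) → height nd ≡ proj₂ b →
               Ext ρ ((o ⊕ b , (nd , i)) ∷ ρ) (λ q → InMark b q (o , f))
  placed-Ext a h .occ (here (inj₁ e)) = inj₁ (inj₁ e)
  placed-Ext {f = f} a h .occ (here (inj₂ (g , e , x≡ , y≤ , z≡))) rewrite a with markTop-true {f = f} e
  ... | refl , refl = inj₁ (inj₂ (refl , x≡ , ≤-trans y≤ (≤-reflexive h) , z≡))
  placed-Ext a h .occ (there o) = inj₂ o
  placed-Ext a h .old = there
  placed-Ext a h .tr (s , e∈) = s , there e∈

  placed-Occ : ∀ {ρ nd i o d f b q} → at (prog nd) i ≡ just (d , f) → height nd ≡ proj₂ b →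
               InMark b q (o , f) → Occ ((o ⊕ b , (nd , i)) ∷ ρ) q
  placed-Occ a h (inj₁ e) = here (inj₁ e)
  placed-Occ {nd = nd} {i} {f = true} a h (inj₂ (refl , x≡ , y≤ , z≡)) =
    here (inj₂ (height nd , cong (moveTop (height nd)) a , x≡ , ≤-trans y≤ (≤-reflexive (sym h)) , z≡))

  mark-Free : ∀ {ρ nd i o d f b} → at (prog nd) i ≡ just (d , f) → height nd ≡ proj₂ b →
              MarkOK (o , f) → MarkFree ρ b (o , f) → Free ρ (o ⊕ b) (nd , i)
  mark-Free {ρ} {nd} {o = o} {f = f} {b} a h (_ , ok) (¬o , fr) = ¬o , λ g e → aux g (trans (sym (cong (moveTop _) a)) e)
    where
    aux : ∀ g → markTop (height nd) f ≡ just g →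
          ∃[ x ] o ⊕ b ≡ (x , suc g , 0) × (∀ y → y ≤ g → ¬ Occ ρ (x , y , 0))
    aux g e with markTop-true {f = f} e
    ... | refl , refl with ok refl
    ...   | refl , refl = proj₁ o + proj₁ b , cong (λ g → proj₁ o + proj₁ b , suc g , 0) (sym h) ,
                           λ y y≤ → fr refl y (≤-trans y≤ (≤-reflexive h))

  MarkOut : (Cell → Set) → ℕ × ℕ → Mark → Set
  MarkOut P b (o , f) = ¬ P (o ⊕ b) × (f ≡ true → ∀ y → y ≤ proj₂ b → ¬ P (proj₁ o + proj₁ b , y , 0))

  MarkOut-Ext : ∀ {ρ ρ′ P b m} → Ext ρ ρ′ P → MarkOut P b m → MarkFree ρ b m → MarkFree ρ′ b m
  MarkOut-Ext e (a , a′) (c , c′) = Ext-free e a c , λ t y y≤ → Ext-free e (a′ t y y≤) (c′ t y y≤)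

  -- fillers stay below row 1 of the program that starts them
  mark-out : ∀ {o f m b} → o ≢ proj₁ m → MarkOK (o , f) → MarkOK m → MarkOut (λ q → InMark b q (o , f)) b m
  mark-out {o} {f} {o′ , f′} {b} n (low , ok) (low′ , ok′) =
    (λ where
      (inj₁ e) → n (sym (⊕-injective o′ o b e))
      (inj₂ (_ , _ , y≤ , refl)) → <⇒≱ (+-monoˡ-≤ (proj₂ b) (low′ refl)) y≤) ,
    λ t y y≤ → λ where
      (inj₁ e) → <⇒≱ (+-monoˡ-≤ (proj₂ b) (low (sym (cong (proj₂ ∘ proj₂) e))))
                     (subst (_≤ proj₂ b) (cong (proj₁ ∘ proj₂) e) y≤)
      (inj₂ (t′ , x≡ , _ , _)) → same (ok t′) (ok′ t) (+-cancelʳ-≡ (proj₁ b) _ _ x≡)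
    where
    same : proj₁ (proj₂ o) ≡ 1 × proj₂ (proj₂ o) ≡ 0 → proj₁ (proj₂ o′) ≡ 1 × proj₂ (proj₂ o′) ≡ 0 →
           proj₁ o′ ≡ proj₁ o → ⊥
    same (refl , refl) (refl , refl) refl = n refl

  headAll : ∀ {P : Mark → Set} o m ms → All P (offsets o m ms) → P (o , proj₂ m)
  headAll o m [] (p ∷ _) = p
  headAll o m (_ ∷ ms) (p ∷ _) = p

  record Stage (ρ : List Placed) (P : Cell → Set) (os : List Mark) (b : ℕ × ℕ) (c : Cell) (s : State) : Set where
    field
      {ρ′} : List Placed
      ready : Ready ρ′ c s
      ext : Ext ρ ρ′ P
      trs : All (λ (o , _) → Tr ρ′ (o ⊕ b)) os
      occs : ∀ {q} → InMarks os b q → Occ ρ′ q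
  open Stage public using (ready; ext; trs; occs)

  DistinctEnter : List State → Set
  DistinctEnter = AllPairs (λ a b → enterS a ≢ enterS b)

  -- Unlike `Stage`, this stops with the last tile of the program pending, because the path may end
  -- there.
  record Last (ρ : List Placed) (os : List Mark) (b : ℕ × ℕ) (c : Cell) (nd : Node) (f : Bool) : Set where
    field
      {ρ′} : List Placed
      {i} : ℕ
      pending : Ready ρ′ c (nd , i)
      free : Free ρ′ c (nd , i)
      final : at (prog nd) (suc i) ≡ nothing
      mark : ∃[ d ] at (prog nd) i ≡ just (d , f)
      ext : Ext ρ ((c , (nd , i)) ∷ ρ′) (InMarks os b)
      trs : All (λ (o , _) → Tr ((c , (nd , i)) ∷ ρ′) (o ⊕ b)) os
      occs : ∀ {q} → InMarks os b q → Occ ((c , (nd , i)) ∷ ρ′) q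

  Suffix : Node → ℕ → List Move → Set
  Suffix nd i ms = ∀ k → at (prog nd) (i + k) ≡ at ms k

  Suffix-tail : ∀ {nd i m ms} → Suffix nd i (m ∷ ms) → Suffix nd (suc i) ms
  Suffix-tail {nd} {i} s k = trans (cong (at (prog nd)) (sym (+-suc i k))) (s (suc k))

  runTo : ∀ {nd ρ} i o m ms b → Suffix nd i (m ∷ ms) → height nd ≡ proj₂ b →
          Ready ρ (o ⊕ b) (nd , i) → Sound (offsets o m ms) → All (MarkFree ρ b) (offsets o m ms) →
          Last ρ (offsets o m ms) b (lastOffset o ms ⊕ b) nd (lastMark m ms)
  runTo {nd} {ρ} i o m@(d , f) [] b suf h r (_ , ok ∷ []) (fr ∷ []) = record
    { pending = r
    ; free = mark-Free {nd = nd} {i} {o} {b = b} a h ok fr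
    ; final = trans (cong (at (prog nd)) (+-comm 1 i)) (suf 1)
    ; mark = d , a
    ; ext = Ext-weaken here (placed-Ext {nd = nd} {i} {o} {b = b} a h)
    ; trs = (_ , here refl) ∷ []
    ; occs = λ where (here p) → placed-Occ {nd = nd} {i} {o} {b = b} a h p }
    where
    a : at (prog nd) i ≡ just m
    a = trans (cong (at (prog nd)) (sym (+-identityʳ i))) (suf 0)
  runTo {nd} {ρ} i o m@(d , f) (m′@(d′ , f′) ∷ ms) b suf h r (ap ∷ aps , ok ∷ oks) (fr ∷ frs) =
    record
      { pending = L.pending
      ; free = L.free
      ; final = L.final
      ; mark = L.mark
      ; ext = Ext-weaken (λ { (inj₁ p) → here p ; (inj₂ p) → there p }) (Ext-trans placedExt L.ext)
      ; trs = tr L.ext (_ , here refl) ∷ L.trs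
      ; occs = λ where
          (here p) → old L.ext (placed-Occ {nd = nd} {i} {o} {b = b} a h p)
          (there p) → L.occs p }
    where
    a : at (prog nd) i ≡ just m
    a = trans (cong (at (prog nd)) (sym (+-identityʳ i))) (suf 0)
    a′ : at (prog nd) (suc i) ≡ just m′
    a′ = trans (cong (at (prog nd)) (+-comm 1 i)) (suf 1)
    placedExt : Ext ρ ((o ⊕ b , (nd , i)) ∷ ρ) (λ q → InMark b q (o , f))
    placedExt = placed-Ext {nd = nd} {i} {o} {b = b} a h
    moved : move d′ o ≢ o × MarkOK (move d′ o , f′)
    moved = headAll (move d′ o) m′ ms ap ∘ sym , headAll (move d′ o) m′ ms oks
    go : Go ((o ⊕ b , (nd , i)) ∷ ρ) (o ⊕ b) (trunkOuts (nd , i)) (move d′ o ⊕ b) (nd , suc i)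
    go rewrite a′ = only (subst (λ d → step d (o ⊕ b) ≡ _) (sym (cong moveDir a′)) (step-⊕ d′ o b (proj₁ moved)))
    -- A marked tile lies in row 1 of layer 0, and `MarkOK` forbids row 0 of that layer. So the next
    -- trunk tile never leaves in the direction of the filler.
    south-off : ∀ d o → d ≡ south → move d o ≢ o → MarkOK (o , true) → ¬ (∃[ f ] MarkOK (move d o , f))
    south-off .south (x , suc y , z) refl _ (_ , ok) (_ , (low , _)) with ok refl
    ... | refl , refl = case low refl of λ ()
    south-off .south (x , zero , z) refl n _ _ = n refl
    clash : ∀ f → MarkOK (o , f) → DistinctEnter (((nd , suc i) ∷ []) ++ fillOuts (markTop (height nd) f))
    clash false _ = [] ∷ []
    clash true ok = ((λ e → south-off d′ o (trans (sym (cong moveDir a′)) e) (proj₁ moved) ok (_ , proj₂ moved)) ∷ []) ∷ [] ∷ []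
    di : Distinct (nd , i)
    di rewrite a | a′ = clash f ok
    rest : ∀ {os} → All (λ b → o ≢ proj₁ b) os → All MarkOK os → All (MarkFree ρ b) os →
           All (MarkFree ((o ⊕ b , (nd , i)) ∷ ρ) b) os
    rest [] [] [] = []
    rest {m ∷ _} (n ∷ ns) (k ∷ ks) (g ∷ gs) =
      MarkOut-Ext {b = b} {m} placedExt (mark-out {m = m} {b} n ok k) g ∷ rest ns ks gs
    module L = Last (runTo (suc i) (move d′ o) m′ ms b (Suffix-tail {nd} {i} suf) h
                      (place r (mark-Free {nd = nd} {i} {o} {b = b} a h ok fr) di go) (aps , oks) (rest ap oks frs))

  headMove : List Move → Move
  headMove [] = E
  headMove (m ∷ _) = m

  tailMoves : List Move → List Move
  tailMoves [] = []
  tailMoves (_ ∷ ms) = ms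

  marks : Node → Cell → List Mark
  marks nd o = offsets o (headMove (prog nd)) (tailMoves (prog nd))

  endOffset : Node → Cell → Cell
  endOffset nd o = lastOffset o (tailMoves (prog nd))

  endMark : Node → Bool
  endMark nd = lastMark (headMove (prog nd)) (tailMoves (prog nd))

  runLast : ∀ nd o b → prog nd ≡ headMove (prog nd) ∷ tailMoves (prog nd) → height nd ≡ proj₂ b →
            {True (sound? (marks nd o))} → ∀ {ρ} → Ready ρ (o ⊕ b) (nd , 0) → All (MarkFree ρ b) (marks nd o) →
            Last ρ (marks nd o) b (endOffset nd o ⊕ b) nd (endMark nd)
  runLast nd o b e h {sd} r fr = runTo 0 o _ _ b (λ k → cong (λ ms → at ms k) e) h r (toWitness sd) fr

  run : ∀ nd o b → prog nd ≡ headMove (prog nd) ∷ tailMoves (prog nd) → height nd ≡ proj₂ b →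
        {True (sound? (marks nd o))} → ∀ {ρ c s} → Ready ρ (o ⊕ b) (nd , 0) → All (MarkFree ρ b) (marks nd o) →
        DistinctEnter (map first₀ (exits nd) ++ fillOuts (markTop (height nd) (endMark nd))) →
        (∀ {ρ′} → Ext ρ ρ′ (InMarks (marks nd o) b) →
           Go ρ′ (endOffset nd o ⊕ b) (map first₀ (exits nd)) c s) →
        Stage ρ (InMarks (marks nd o) b) (marks nd o) b c s
  run nd o b e h {sd} r fr di g = record
    { ready = place L.pending L.free di′ go′ ; ext = L.ext ; trs = L.trs ; occs = L.occs }
    where
    module L = Last (runLast nd o b e h {sd} r fr)
    go′ : Go _ (endOffset nd o ⊕ b) (trunkOuts (nd , L.i)) _ _
    go′ rewrite L.final = g L.ext
    di′ : Distinct (nd , L.i)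
    di′ rewrite L.final | proj₂ L.mark = di

-- Writing and reading one digit.

module Gadgets (n digits padLen rowLen y₀ : ℕ) (initial : ℕ → List Bool) where
  open Program n digits padLen rowLen y₀ initial public

  still-free : ∀ {ρ ρ′ P b os} → Ext ρ ρ′ P → All (MarkOut P b) os → All (MarkFree ρ b) os → All (MarkFree ρ′ b) os
  still-free e [] [] = []
  still-free {b = b} {m ∷ _} e (a ∷ as) (c ∷ cs) = MarkOut-Ext {b = b} {m} e a c ∷ still-free e as cs

  Disjoint : List Mark → List Mark → Set
  Disjoint os os′ = All (λ a → All (λ b → proj₁ b ≢ proj₁ a) os) os′

  disjoint? : ∀ os os′ → Dec (Disjoint os os′)
  disjoint? os os′ = All.all? (λ a → All.all? (λ b → ¬? (proj₁ b ≟C proj₁ a)) os) os′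

  marks-out₁ : ∀ {os m b} → All (λ a → proj₁ a ≢ proj₁ m) os → All MarkOK os → MarkOK m →
               MarkOut (InMarks os b) b m
  marks-out₁ [] [] k = (λ ()) , λ _ _ _ ()
  marks-out₁ {o ∷ os} {m} {b} (n ∷ ns) (k ∷ ks) k′ =
    let p , p′ = mark-out {m = m} {b} n k k′ ; r , r′ = marks-out₁ {m = m} {b} ns ks k′
    in (λ { (here i) → p i ; (there i) → r i }) ,
       λ { t y y≤ (here i) → p′ t y y≤ i ; t y y≤ (there i) → r′ t y y≤ i }

  marks-out : ∀ os os′ {b} → {True (sound? os)} → {True (All.all? markOK? os′)} → {True (disjoint? os os′)} →
              All (MarkOut (InMarks os b) b) os′
  marks-out os os′ {b} {so} {so′} {di} = go (toWitness so′) (toWitness di)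
    where
    go : ∀ {os′} → All MarkOK os′ → Disjoint os os′ → All (MarkOut (InMarks os b) b) os′
    go [] [] = []
    go (k ∷ ks) (d ∷ ds) = marks-out₁ d (proj₂ (toWitness so)) k ∷ go ks ds

  box-out : ∀ (P : Cell → Set) {X Y} J os → {True (All.all? (λ ((i , j , z) , f) → j ≤? J) os)} →
            (∀ x y z → X ≤ x → y ≤ J + Y → ¬ P (x , y , z)) → All (MarkOut P (X , Y)) os
  box-out P {X} {Y} J os {w} free = All.map
    (λ {m} j≤ → free _ _ _ (m≤n+m X (proj₁ (proj₁ m))) (+-monoˡ-≤ Y j≤) ,
                λ _ y y≤ → free _ y 0 (m≤n+m X (proj₁ (proj₁ m))) (≤-trans y≤ (m≤n+m Y J))) (toWitness w)

  marks-bound : ∀ I J {X Y} os → {True (All.all? (λ ((i , j , z) , f) → (i ≤? I) ×-dec ((j ≤? J) ×-dec (z ≤? 1))) os)} →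
                ∀ {x y z} → InMarks os (X , Y) (x , y , z) → X ≤ x × x ≤ I + X × y ≤ J + Y × z ≤ 1
  marks-bound I J {X} {Y} os {w} p = go (toWitness w) p
    where
    go : ∀ {os x y z} → All (λ ((i , j , z) , f) → i ≤ I × j ≤ J × z ≤ 1) os → InMarks os (X , Y) (x , y , z) →
         X ≤ x × x ≤ I + X × y ≤ J + Y × z ≤ 1
    go {((i , j , z) , f) ∷ os} ((i≤ , j≤ , z≤) ∷ _) (here (inj₁ refl)) =
      m≤n+m X i , +-monoˡ-≤ X i≤ , +-monoˡ-≤ Y j≤ , z≤
    go {((i , j , z) , f) ∷ os} ((i≤ , j≤ , z≤) ∷ _) (here (inj₂ (_ , refl , y≤ , refl))) =
      m≤n+m X i , +-monoˡ-≤ X i≤ , ≤-trans y≤ (m≤n+m Y J) , z≤n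
    go (_ ∷ ws) (there p) = go ws p

  Box : ℕ → ℕ → ℕ → Cell → Set
  Box lo hi top (x , y , z) = lo ≤ x × x < hi × y ≤ top × z ≤ 1

  Lane : ℕ → ℕ → ℕ → Cell → Set
  Lane lo hi r (x , y , z) = lo ≤ x × x ≤ hi × y ≡ r × z ≡ 0

  FreeFrom : List Placed → ℕ → ℕ → Set
  FreeFrom ρ X top = ∀ x y z → X ≤ x → y ≤ top → ¬ Occ ρ (x , y , z)

  enter-writeRest : ∀ f j bs → enterS (writeRest f j bs , 0) ≡ east
  enter-writeRest f j [] = refl
  enter-writeRest f j (false ∷ bs) = refl
  enter-writeRest f j (true ∷ bs) = refl

  enter-enter : ∀ f j → enterS (enter f j , 0) ≡ east
  enter-enter f zero = refl
  enter-enter f (suc j) = refl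

  enter-read : ∀ j bs → enterS (read j bs , 0) ≡ west
  enter-read j bs with length bs ℕ.≟ n
  ... | yes _ = refl
  ... | no _ = refl

  only-by : ∀ {ρ c d c′ s′} → enterS s′ ≡ d → step d c ≡ just c′ → Go ρ c (s′ ∷ []) c′ s′
  only-by {c = c} e st = only (subst (λ d → step d c ≡ _) (sym e) st)

  step-west : ∀ {p x y z} → suc p ≡ x → step west (x , y , z) ≡ just (p , y , z)
  step-west refl = refl

  endCol : List Bool → ℕ → ℕ
  endCol [] x = x
  endCol (b ∷ bs) x = endCol bs (4 + x)

  endCol-≥ : ∀ bs x → x ≤ endCol bs x
  endCol-≥ [] x = ≤-refl
  endCol-≥ (b ∷ bs) x = ≤-trans (m≤n+m x 4) (endCol-≥ bs (4 + x))

  endCol-length : ∀ bs x → endCol bs x ≡ length bs * 4 + x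
  endCol-length [] x = refl
  endCol-length (b ∷ bs) x = trans (endCol-length bs (4 + x))
    (trans (sym (+-assoc (length bs * 4) 4 x)) (cong (_+ x) (+-comm (length bs * 4) 4)))

  -- Programs ignore the level and the remaining bits, so by computation the marks of one sample
  -- node serve for all.
  wmarks : Bool → List Mark
  wmarks b = marks (wbit false 0 b []) (0 , 2 , 0)

  -- The first cell of each branch out of `test` at (3, 1, 0): west in layer 0 for `false`, up for
  -- `true`. The bump of a written bit covers the start of the opposite branch.
  bitStart : Bool → Cell
  bitStart false = 2 , 1 , 0
  bitStart true = 3 , 1 , 1

  tmarks : List Mark
  tmarks = marks (test 0 []) (3 , 1 , 0)

  bmarks : Bool → List Mark
  bmarks b = marks (bit 0 b []) (bitStart b)

  -- Rows are counted from base j: row 1 is the top row of the digits below j, rows 2 and 3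
  -- belong to digit j.
  module Level (j : ℕ) where

    Y : ℕ
    Y = base j

    Written : List Bool → ℕ → Cell → Set
    Written [] x q = ⊥
    Written (b ∷ bs) x q = InMarks (wmarks b) (x , Y) q ⊎ Written bs (4 + x) q

    Scanned : List Bool → ℕ → Cell → Set
    Scanned [] x q = ⊥
    Scanned (b ∷ bs) x q = (InMarks tmarks (x , Y) q ⊎ InMarks (bmarks b) (x , Y) q) ⊎ Scanned bs (4 + x) q

    -- what the scan relies on: its own cells are free, and the branch not taken is blocked
    Legible : List Bool → ℕ → List Placed → Set
    Legible [] x ρ = ⊤
    Legible (b ∷ bs) x ρ = (All (MarkFree ρ (x , Y)) tmarks × All (MarkFree ρ (x , Y)) (bmarks b) ×
                            Tr ρ (bitStart (not b) ⊕ (x , Y))) × Legible bs (4 + x) ρ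

    wmarks-bound : ∀ b {x x′ y z} → InMarks (wmarks b) (x , Y) (x′ , y , z) → x ≤ x′ × x′ ≤ 3 + x × y ≤ 2 + Y × z ≤ 1
    wmarks-bound false = marks-bound 3 2 (wmarks false)
    wmarks-bound true = marks-bound 3 2 (wmarks true)

    Written-bound : ∀ bs {x x′ y z} → Written bs x (x′ , y , z) → x ≤ x′ × x′ < endCol bs x × y ≤ 2 + Y × z ≤ 1
    Written-bound (b ∷ bs) {x} (inj₁ i) =
      let l , u , r = wmarks-bound b i in l , ≤-trans (s≤s u) (endCol-≥ bs (4 + x)) , r
    Written-bound (b ∷ bs) {x} (inj₂ w) =
      let l , r = Written-bound bs w in ≤-trans (m≤n+m x 4) l , r

    bmarks-bound : ∀ b {x x′ y z} → InMarks (bmarks b) (x , Y) (x′ , y , z) → x ≤ x′ × x′ ≤ 3 + x × y ≤ 1 + Y × z ≤ 1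
    bmarks-bound false = marks-bound 3 1 (bmarks false)
    bmarks-bound true = marks-bound 3 1 (bmarks true)

    Scanned-bound : ∀ bs {x x′ y z} → Scanned bs x (x′ , y , z) → x ≤ x′ × x′ < endCol bs x × y ≤ 1 + Y × z ≤ 1
    Scanned-bound (b ∷ bs) {x} (inj₁ (inj₁ i)) =
      let l , u , r = marks-bound 3 1 tmarks i in l , ≤-trans (s≤s u) (endCol-≥ bs (4 + x)) , r
    Scanned-bound (b ∷ bs) {x} (inj₁ (inj₂ i)) =
      let l , u , r = bmarks-bound b i in l , ≤-trans (s≤s u) (endCol-≥ bs (4 + x)) , r
    Scanned-bound (b ∷ bs) {x} (inj₂ w) =
      let l , r = Scanned-bound bs w in ≤-trans (m≤n+m x 4) l , r

    beyond : ∀ {P : Cell → Set} {x lo} os → x + 3 < lo →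
             {True (All.all? (λ ((i , j , z) , f) → i ≤? 3) os)} →
             (∀ x′ y z → P (x′ , y , z) → lo ≤ x′) → All (MarkOut P (x , Y)) os
    beyond {P} {x} {lo} os lt {w} bound = All.map
      (λ {m} i≤ → (λ p → far {m} i≤ (bound _ _ _ p)) , λ _ y _ p → far {m} i≤ (bound _ y 0 p)) (toWitness w)
      where
      far : ∀ {m : Mark} → proj₁ (proj₁ m) ≤ 3 → lo ≤ proj₁ (proj₁ m) + x → ⊥
      far i≤ le = <⇒≱ lt (≤-trans le (≤-trans (+-monoˡ-≤ x i≤) (≤-reflexive (+-comm 3 x))))

    beyond-bit : ∀ {P : Cell → Set} {x lo} b → x + 3 < lo → (∀ x′ y z → P (x′ , y , z) → lo ≤ x′) →
                 All (MarkOut P (x , Y)) (bmarks b)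
    beyond-bit false lt bd = beyond (bmarks false) lt bd
    beyond-bit true lt bd = beyond (bmarks true) lt bd

    -- What is built between writing and reading a digit lies east of its bits, so it takes none of
    -- the cells that the scan needs.
    Legible-Ext : ∀ {P : Cell → Set} {ρ ρ′} bs x → Ext ρ ρ′ P →
                  (∀ x′ y z → P (x′ , y , z) → endCol bs x ≤ x′) → Legible bs x ρ → Legible bs x ρ′
    Legible-Ext [] x e bd l = tt
    Legible-Ext (b ∷ bs) x e bd ((t , m , tr′) , l) =
      (still-free e (beyond tmarks lt bd) t , still-free e (beyond-bit b lt bd) m , tr e tr′) ,
      Legible-Ext bs (4 + x) e bd l
      where
      lt : x + 3 < endCol bs (4 + x)
      lt = ≤-trans (s≤s (≤-reflexive (+-comm x 3))) (endCol-≥ bs (4 + x))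

    record Wrote (f : Bool) (bs : List Bool) (x : ℕ) (ρ : List Placed) : Set where
      field
        {ρ′} : List Placed
        ready : Ready ρ′ (endCol bs x , 2 + Y , 0) (leave f j , 0)
        ext : Ext ρ ρ′ (Written bs x)
        occs : ∀ {q} → Written bs x q → Occ ρ′ q
        -- With row 2 complete, `carry` finds no way south while it walks in row 3.
        rail : ∀ x′ → x ≤ x′ → x′ < endCol bs x → Tr ρ′ (x′ , 2 + Y , 0)
        legible : Legible bs x ρ′

    four : ∀ {x x′} → x ≤ x′ → x′ ≡ x ⊎ x′ ≡ 1 + x ⊎ x′ ≡ 2 + x ⊎ x′ ≡ 3 + x ⊎ 4 + x ≤ x′
    four x≤ with m≤n⇒m<n∨m≡n x≤
    ... | inj₂ e = inj₁ (sym e)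
    ... | inj₁ x≤ with m≤n⇒m<n∨m≡n x≤
    ...   | inj₂ e = inj₂ (inj₁ (sym e))
    ...   | inj₁ x≤ with m≤n⇒m<n∨m≡n x≤
    ...     | inj₂ e = inj₂ (inj₂ (inj₁ (sym e)))
    ...     | inj₁ x≤ with m≤n⇒m<n∨m≡n x≤
    ...       | inj₂ e = inj₂ (inj₂ (inj₂ (inj₁ (sym e))))
    ...       | inj₁ x≤ = inj₂ (inj₂ (inj₂ (inj₂ x≤)))

    writeBits : ∀ f bs x {ρ} → Ready ρ (x , 2 + Y , 0) (writeRest f j bs , 0) → FreeFrom ρ x (2 + Y) → Wrote f bs x ρ
    writeBit : ∀ f b bs x {ρ} → Stage ρ (InMarks (wmarks b) (x , Y)) (wmarks b) (x , Y) (4 + x , 2 + Y , 0) (writeRest f j bs , 0) →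
               FreeFrom ρ x (2 + Y) →
               (∀ {ρ′} → All (λ (o , _) → Tr ρ′ (o ⊕ (x , Y))) (wmarks b) →
                  (∀ i → i ≤ 3 → Tr ρ′ (i + x , 2 + Y , 0)) × Tr ρ′ (bitStart (not b) ⊕ (x , Y))) →
               All (MarkOut (InMarks (wmarks b) (x , Y)) (x , Y)) tmarks →
               All (MarkOut (InMarks (wmarks b) (x , Y)) (x , Y)) (bmarks b) →
               All (MarkFree ρ (x , Y)) tmarks → All (MarkFree ρ (x , Y)) (bmarks b) →
               Wrote f (b ∷ bs) x ρ
    writeBits f [] x r fr = record
      { ready = r ; ext = Ext-refl ; occs = λ () ; rail = λ x′ l u → contradiction l (<⇒≱ u) ; legible = tt }
    writeBits f (false ∷ bs) x r fr =
      writeBit f false bs x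
        (run (wbit f j false bs) (0 , 2 , 0) (x , Y) refl refl r (box-out _ 2 (wmarks false) fr) ([] ∷ [])
          (λ _ → only-by (enter-writeRest f j bs) refl)) fr
        -- In path order: `a`, `b`, `c`, `d` are the cells of row 2, and `g` is the cell of the bump
        -- that blocks the branch for `true`.
        (λ { (a ∷ b ∷ c ∷ _ ∷ _ ∷ g ∷ _ ∷ d ∷ []) →
             (λ { 0 _ → a ; 1 _ → b ; 2 _ → c ; 3 _ → d ; (suc (suc (suc (suc _)))) (s≤s (s≤s (s≤s ()))) }) , g })
        (marks-out (wmarks false) tmarks) (marks-out (wmarks false) (bmarks false))
        (box-out _ 2 tmarks fr) (box-out _ 2 (bmarks false) fr)
    writeBits f (true ∷ bs) x r fr =
      writeBit f true bs x
        (run (wbit f j true bs) (0 , 2 , 0) (x , Y) refl refl r (box-out _ 2 (wmarks true) fr) ([] ∷ [])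
          (λ _ → only-by (enter-writeRest f j bs) refl)) fr
        (λ { (a ∷ b ∷ _ ∷ g ∷ c ∷ d ∷ []) →
             (λ { 0 _ → a ; 1 _ → b ; 2 _ → c ; 3 _ → d ; (suc (suc (suc (suc _)))) (s≤s (s≤s (s≤s ()))) }) , g })
        (marks-out (wmarks true) tmarks) (marks-out (wmarks true) (bmarks true))
        (box-out _ 2 tmarks fr) (box-out _ 2 (bmarks true) fr)
    writeBit f b bs x st fr trunk tout bout tfree bfree = record
      { ready = Rest.ready
      ; ext = Ext-trans (ext st) Rest.ext
      ; occs = λ where
          (inj₁ i) → old Rest.ext (occs st i)
          (inj₂ w) → Rest.occs w
      ; rail = rail
      ; legible = ( still-free Rest.ext (beyond tmarks lt far) (still-free (ext st) tout tfree)
                  , still-free Rest.ext (beyond-bit b lt far) (still-free (ext st) bout bfree)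
                  , tr Rest.ext (proj₂ (trunk (trs st)))) , Rest.legible }
      where
      module Rest = Wrote (writeBits f bs (4 + x) (ready st)
        λ x′ y z l u → Ext-free (ext st) (λ i → <⇒≱ l (proj₁ (proj₂ (wmarks-bound b i))))
                                (fr x′ y z (≤-trans (m≤n+m x 4) l) u))
      lt : x + 3 < 4 + x
      lt = s≤s (≤-reflexive (+-comm x 3))
      far : ∀ x′ y z → Written bs (4 + x) (x′ , y , z) → 4 + x ≤ x′
      far _ _ _ w = proj₁ (Written-bound bs w)
      rail : ∀ x′ → x ≤ x′ → x′ < endCol bs (4 + x) → Tr Rest.ρ′ (x′ , 2 + Y , 0)
      rail x′ l u with four l
      ... | inj₁ refl = tr Rest.ext (proj₁ (trunk (trs st)) 0 z≤n)
      ... | inj₂ (inj₁ refl) = tr Rest.ext (proj₁ (trunk (trs st)) 1 (s≤s z≤n))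
      ... | inj₂ (inj₂ (inj₁ refl)) = tr Rest.ext (proj₁ (trunk (trs st)) 2 (s≤s (s≤s z≤n)))
      ... | inj₂ (inj₂ (inj₂ (inj₁ refl))) = tr Rest.ext (proj₁ (trunk (trs st)) 3 ≤-refl)
      ... | inj₂ (inj₂ (inj₂ (inj₂ l′))) = Rest.rail x′ l′ u

    -- Each bit has four cells in row 1. For `false` the scan takes all of them; for `true` the bump
    -- takes the middle two, and the scan passes over these and takes the outer two. Each of these
    -- tiles starts a filler column.
    region-filled : ∀ bs {x} x′ y → x ≤ x′ → x′ < endCol bs x → y ≤ 1 + Y →
                    Written bs x (x′ , y , 0) ⊎ Scanned bs x (x′ , y , 0)
    region-filled [] x′ y l u _ = contradiction l (<⇒≱ u)
    region-filled (b ∷ bs) {x} x′ y l u y≤ with four l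
    ... | inj₂ (inj₂ (inj₂ (inj₂ l′))) = [ inj₁ ∘ inj₂ , inj₂ ∘ inj₂ ]′ (region-filled bs x′ y l′ u y≤)
    ... | inj₂ (inj₂ (inj₂ (inj₁ refl))) = inj₂ (inj₁ (inj₁ (here (filledMark (m≤n⇒m<n∨m≡n y≤)))))
      where
      filledMark : y < 1 + Y ⊎ y ≡ 1 + Y → InMark (x , Y) (3 + x , y , 0) ((3 , 1 , 0) , true)
      filledMark (inj₁ (s≤s y≤)) = inj₂ (refl , refl , y≤ , refl)
      filledMark (inj₂ refl) = inj₁ refl
    region-filled (true ∷ bs) {x} x′ y l u y≤ | inj₂ (inj₂ (inj₁ refl)) with m≤n⇒m<n∨m≡n y≤
    ... | inj₁ (s≤s y≤) = inj₁ (inj₁ (there (there (there (here (inj₂ (refl , refl , y≤ , refl)))))))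
    ... | inj₂ refl = inj₁ (inj₁ (there (there (there (here (inj₁ refl))))))
    region-filled (true ∷ bs) {x} x′ y l u y≤ | inj₂ (inj₁ refl) with m≤n⇒m<n∨m≡n y≤
    ... | inj₁ (s≤s y≤) = inj₁ (inj₁ (there (there (here (inj₂ (refl , refl , y≤ , refl))))))
    ... | inj₂ refl = inj₁ (inj₁ (there (there (here (inj₁ refl)))))
    region-filled (true ∷ bs) {x} x′ y l u y≤ | inj₁ refl with m≤n⇒m<n∨m≡n y≤
    ... | inj₁ (s≤s y≤) = inj₂ (inj₁ (inj₂ (there (there (there (there (here (inj₂ (refl , refl , y≤ , refl)))))))))
    ... | inj₂ refl = inj₂ (inj₁ (inj₂ (there (there (there (there (here (inj₁ refl))))))))
    region-filled (false ∷ bs) {x} x′ y l u y≤ | inj₂ (inj₂ (inj₁ refl)) with m≤n⇒m<n∨m≡n y≤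
    ... | inj₁ (s≤s y≤) = inj₂ (inj₁ (inj₂ (here (inj₂ (refl , refl , y≤ , refl)))))
    ... | inj₂ refl = inj₂ (inj₁ (inj₂ (here (inj₁ refl))))
    region-filled (false ∷ bs) {x} x′ y l u y≤ | inj₂ (inj₁ refl) with m≤n⇒m<n∨m≡n y≤
    ... | inj₁ (s≤s y≤) = inj₂ (inj₁ (inj₂ (there (here (inj₂ (refl , refl , y≤ , refl))))))
    ... | inj₂ refl = inj₂ (inj₁ (inj₂ (there (here (inj₁ refl)))))
    region-filled (false ∷ bs) {x} x′ y l u y≤ | inj₁ refl with m≤n⇒m<n∨m≡n y≤
    ... | inj₁ (s≤s y≤) = inj₂ (inj₁ (inj₂ (there (there (here (inj₂ (refl , refl , y≤ , refl)))))))
    ... | inj₂ refl = inj₂ (inj₁ (inj₂ (there (there (here (inj₁ refl))))))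

    record Read (bs acc : List Bool) (x p : ℕ) (ρ : List Placed) : Set where
      field
        {ρ′} : List Placed
        ready : Ready ρ′ (p , 1 + Y , 0) (read j (bs ++ acc) , 0)
        ext : Ext ρ ρ′ (Scanned bs x)
        occs : ∀ {q} → Scanned bs x q → Occ ρ′ q

    read-short : ∀ acc → length acc < n → read j acc ≡ test j acc
    read-short acc lt with length acc ℕ.≟ n
    ... | yes e = contradiction e (<⇒≢ lt)
    ... | no _ = refl

    read-full : ∀ acc → length acc ≡ n → read j acc ≡ lift j acc
    read-full acc e with length acc ℕ.≟ n
    ... | yes _ = refl
    ... | no ne = contradiction e ne

    -- The walk goes west, so the bits `bs` east of `b` are read before `b`; consing onto `acc`
    -- restores the order in which they were written.
    readBits : ∀ bs acc x {p p′ ρ} → suc p ≡ endCol bs x → suc p′ ≡ x → length bs + length acc ≤ n →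
               Ready ρ (p , 1 + Y , 0) (read j acc , 0) → Legible bs x ρ → Read bs acc x p′ ρ
    readBits [] acc x e e′ le r l with refl ← suc-injective (trans e (sym e′)) =
      record { ready = r ; ext = Ext-refl ; occs = λ () }
    readBits (b ∷ bs) acc x {p} {p′} {ρ} e refl le r ((tfree , bfree , block) , l) = record
      { ready = ready st₂
      ; ext = Ext-weaken (λ { (inj₁ s) → inj₂ s ; (inj₂ (inj₁ t)) → inj₁ (inj₁ t) ; (inj₂ (inj₂ t)) → inj₁ (inj₂ t) })
                (Ext-trans Rest.ext (Ext-trans (ext st₁) (ext st₂)))
      ; occs = λ where
          (inj₁ (inj₁ i)) → old (ext st₂) (occs st₁ i)
          (inj₁ (inj₂ i)) → occs st₂ i
          (inj₂ s) → old (ext st₂) (old (ext st₁) (Rest.occs s)) }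
      where
      module Rest = Read (readBits bs acc (4 + x) {p} {3 + x} e refl (≤-trans (n≤1+n _) le) r l)
      short : length (bs ++ acc) < n
      short = ≤-trans (s≤s (≤-reflexive (length-++ bs))) le
      far : ∀ x′ y z → Scanned bs (4 + x) (x′ , y , z) → 4 + x ≤ x′
      far _ _ _ s = proj₁ (Scanned-bound bs s)
      lt : x + 3 < 4 + x
      lt = s≤s (≤-reflexive (+-comm x 3))
      branch : ∀ b → Tr Rest.ρ′ (bitStart (not b) ⊕ (x , Y)) → ∀ {ρ′} → Ext Rest.ρ′ ρ′ (InMarks tmarks (x , Y)) →
               Go ρ′ (3 + x , 1 + Y , 0) ((bit j false (bs ++ acc) , 0) ∷ (bit j true (bs ++ acc) , 0) ∷ [])
                  (bitStart b ⊕ (x , Y)) (bit j b (bs ++ acc) , 0)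
      branch false t ex = first refl refl (tr ex t)
      branch true t ex = second refl refl (tr ex t)
      st₁ : Stage Rest.ρ′ (InMarks tmarks (x , Y)) tmarks (x , Y) (bitStart b ⊕ (x , Y)) (bit j b (bs ++ acc) , 0)
      st₁ = run (test j (bs ++ acc)) (3 , 1 , 0) (x , Y) refl refl
              (subst (λ nd → Ready Rest.ρ′ (3 + x , 1 + Y , 0) (nd , 0)) (read-short (bs ++ acc) short) Rest.ready)
              (still-free Rest.ext (beyond tmarks lt far) tfree)
              (((λ ()) ∷ (λ ()) ∷ []) ∷ ((λ ()) ∷ []) ∷ [] ∷ [])
              (branch b (tr Rest.ext block))
      west≢south : enterS (read j (b ∷ bs ++ acc) , 0) ≢ south
      west≢south e = case trans (sym (enter-read j (b ∷ bs ++ acc))) e of λ ()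
      bit-run : ∀ b {ρ} → Ready ρ (bitStart b ⊕ (suc p′ , Y)) (bit j b (bs ++ acc) , 0) →
                All (MarkFree ρ (suc p′ , Y)) (bmarks b) → enterS (read j (b ∷ bs ++ acc) , 0) ≢ south →
                Stage ρ (InMarks (bmarks b) (suc p′ , Y)) (bmarks b) (suc p′ , Y) (p′ , 1 + Y , 0) (read j (b ∷ bs ++ acc) , 0)
      bit-run false r fr ne = run (bit j false (bs ++ acc)) (2 , 1 , 0) (suc p′ , Y) refl refl r fr
        ((ne ∷ []) ∷ [] ∷ []) (λ _ → only-by (enter-read j (false ∷ bs ++ acc)) refl)
      bit-run true r fr ne = run (bit j true (bs ++ acc)) (3 , 1 , 1) (suc p′ , Y) refl refl r fr
        ((ne ∷ []) ∷ [] ∷ []) (λ _ → only-by (enter-read j (true ∷ bs ++ acc)) refl)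
      apart : ∀ b → All (MarkOut (InMarks tmarks (x , Y)) (x , Y)) (bmarks b)
      apart false = marks-out tmarks (bmarks false)
      apart true = marks-out tmarks (bmarks true)
      st₂ : Stage (Stage.ρ′ st₁) (InMarks (bmarks b) (x , Y)) (bmarks b) (x , Y) (p′ , 1 + Y , 0) (read j (b ∷ bs ++ acc) , 0)
      st₂ = bit-run b (ready st₁)
              (still-free (ext st₁) (apart b) (still-free Rest.ext (beyond-bit b lt far) bfree)) west≢south

-- One increment of a digit, given a run of the lower digits.

module Passing (n digits padLen rowLen y₀ : ℕ) (initial : ℕ → List Bool) where
  open Gadgets n digits padLen rowLen y₀ initial public

  -- The contract of a run of the digits below `j`, started in column `X`. By `top` its upper row is
  -- a floor of trunk tiles through which `back` cannot turn south. The last tile stays pending,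
  -- since its successor depends on whether a digit `j` exists.
  record Passed (ρ : List Placed) (X j w : ℕ) : Set where
    field
      {ρ′} : List Placed
      {s} : State
      {f′} : ℕ
      width : suc f′ ≡ w + X
      wide : X ≤ f′
      pending : Ready ρ′ (f′ , base j , 1) s
      free : Free ρ′ (f′ , base j , 1) s
      unmarked : fillTop s ≡ nothing
      outs≡ : trunkOuts s ≡ map first₀ (ascend j)
      ext : Ext ρ (((f′ , base j , 1) , s) ∷ ρ′) (Box X (suc f′) (1 + base j))
      filled : ∀ x y → X ≤ x → x ≤ f′ → y ≤ 1 + base j → Occ (((f′ , base j , 1) , s) ∷ ρ′) (x , y , 0)
      top : ∀ x → X ≤ x → x ≤ f′ → Tr (((f′ , base j , 1) , s) ∷ ρ′) (x , 1 + base j , 0)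

  ascend-< : ∀ {j} → j < digits → ascend j ≡ turn j ∷ []
  ascend-< {j} lt with j <? digits
  ... | yes _ = refl
  ... | no ¬lt = contradiction lt ¬lt

  ascend-top : ascend digits ≡ []
  ascend-top with digits <? digits
  ... | yes lt = contradiction lt (<-irrefl refl)
  ... | no _ = refl

  Passed-turn : ∀ {ρ X j w} (p : Passed ρ X j w) → j < digits →
                Ready (((Passed.f′ p , base j , 1) , Passed.s p) ∷ Passed.ρ′ p) (suc (Passed.f′ p) , base j , 1) (turn j , 0)
  Passed-turn {j = j} p lt = place pending free distinct go
    where
    open Passed p
    outs≡′ : trunkOuts s ≡ (turn j , 0) ∷ []
    outs≡′ = trans outs≡ (cong (map first₀) (ascend-< lt))
    distinct : Distinct s
    distinct rewrite outs≡′ | unmarked = [] ∷ []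
    go : Go _ (f′ , base j , 1) (trunkOuts s) (suc f′ , base j , 1) (turn j , 0)
    go rewrite outs≡′ = only refl

  Passed-cons : ∀ {ρ ρ₁ P X X′ j w w′} → Ext ρ ρ₁ P → X ≤ X′ → w′ + X′ ≡ w + X → (p : Passed ρ₁ X′ j w′) →
                (∀ {x y z} → P (x , y , z) → Box X (suc (Passed.f′ p)) (1 + base j) (x , y , z)) →
                (∀ x y → X ≤ x → x < X′ → y ≤ 1 + base j → Occ ρ₁ (x , y , 0)) →
                (∀ x → X ≤ x → x < X′ → Tr ρ₁ (x , 1 + base j , 0)) → Passed ρ X j w
  Passed-cons {X = X} {X′} e X≤ w≡ p inBox fil tp = record
    { width = trans width w≡
    ; wide = ≤-trans X≤ wide
    ; pending = pending
    ; free = free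
    ; unmarked = unmarked
    ; outs≡ = outs≡
    ; ext = Ext-weaken (λ { (inj₁ i) → inBox i ; (inj₂ (l , r)) → ≤-trans X≤ l , r }) (Ext-trans e (Passed.ext p))
    ; filled = λ x y l u y≤ → case x <? X′ of λ where
        (yes lt) → old (Passed.ext p) (fil x y l lt y≤)
        (no ge) → filled x y (≮⇒≥ ge) u y≤
    ; top = λ x l u → case x <? X′ of λ where
        (yes lt) → tr (Passed.ext p) (tp x l lt)
        (no ge) → top x (≮⇒≥ ge) u }
    where open Passed p hiding (ext)

  left-out : ∀ (P : Cell → Set) {X Y} os → (∀ x y z → P (x , y , z) → x < X) → All (MarkOut P (X , Y)) os
  left-out P [] lt = []
  left-out P {X} (((i , _) , _) ∷ os) lt =
    ((λ p → <⇒≱ (lt _ _ _ p) (m≤n+m X i)) , λ _ _ _ p → <⇒≱ (lt _ _ _ p) (m≤n+m X i)) ∷ left-out P os lt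

  record Railed (ρ : List Placed) (c : Cell) (s : State) (lo hi r : ℕ) : Set where
    field
      {ρ′} : List Placed
      ready : Ready ρ′ c s
      ext : Ext ρ ρ′ (Lane lo hi r)
      rail : ∀ x → lo ≤ x → x ≤ hi → Tr ρ′ (x , r , 0)

  -- A cycle starts in column q; its bits end before column e, the lower digits end in column f.
  data Column (q e f x : ℕ) : Set where
    at-q   : x ≡ q → Column q e f x
    at-1+q : x ≡ 1 + q → Column q e f x
    region : 2 + q ≤ x → x < e → Column q e f x
    at-e   : x ≡ e → Column q e f x
    at-1+e : x ≡ 1 + e → Column q e f x
    below  : 2 + e ≤ x → x ≤ f → Column q e f x
    at-F   : x ≡ 1 + f → Column q e f x
    at-1+F : x ≡ 2 + f → Column q e f x
    at-2+F : x ≡ 3 + f → Column q e f x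

  columnOf : ∀ {q e f x} → 2 + e ≤ f → q ≤ x → x < 4 + f → Column q e f x
  columnOf {q} {e} {f} {x} e≤ l u with m≤n⇒m<n∨m≡n l
  ... | inj₂ eq = at-q (sym eq)
  ... | inj₁ l with m≤n⇒m<n∨m≡n l
  ...   | inj₂ eq = at-1+q (sym eq)
  ...   | inj₁ l with x <? e
  ...     | yes lt = region l lt
  ...     | no ge with m≤n⇒m<n∨m≡n (≮⇒≥ ge)
  ...       | inj₂ eq = at-e (sym eq)
  ...       | inj₁ l with m≤n⇒m<n∨m≡n l
  ...         | inj₂ eq = at-1+e (sym eq)
  ...         | inj₁ l with x <? suc f
  ...           | yes (s≤s lt) = below l lt
  ...           | no ge with m≤n⇒m<n∨m≡n (≮⇒≥ ge)
  ...             | inj₂ eq = at-F (sym eq)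
  ...             | inj₁ l with m≤n⇒m<n∨m≡n l
  ...               | inj₂ eq = at-1+F (sym eq)
  ...               | inj₁ l = at-2+F (≤-antisym (s≤s⁻¹ u) l)

  module Lanes (j : ℕ) where
    open Level j public

    -- `guide` closes the turn south in every column but the last, and `wall` closes the way west in
    -- the last one, so each tile has exactly one continuation left. Freeness of the hole itself is
    -- left to `dip`.
    backRun : ∀ m e {ρ} → Ready ρ (m + suc e , 2 + Y , 0) (back j , 0) →
              (∀ x → suc e < x → x ≤ m + suc e → Tr ρ (x , 1 + Y , 0)) → Tr ρ (e , 2 + Y , 0) →
              (∀ x → suc e ≤ x → x ≤ m + suc e → ¬ Occ ρ (x , 2 + Y , 0)) →
              Railed ρ (suc e , 1 + Y , 0) (dip j , 0) (suc e) (m + suc e) (2 + Y)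
    backRun zero e {ρ} r guide wall fr = record
      { ready = ready st
      ; ext = Ext-weaken (λ { (here (inj₁ refl)) → ≤-refl , ≤-refl , refl , refl ; (here (inj₂ (() , _))) }) (ext st)
      ; rail = λ { x l u → subst (λ x → Tr _ (x , 2 + Y , 0)) (≤-antisym l u) (All.head (trs st)) } }
      where
      st : Stage ρ _ _ _ (suc e , 1 + Y , 0) (dip j , 0)
      st = run (back j) (0 , 2 , 0) (suc e , Y) refl refl r ((fr (suc e) ≤-refl ≤-refl , λ ()) ∷ [])
             (((λ ()) ∷ []) ∷ [] ∷ []) (λ ex → second refl refl (tr ex wall))
    backRun (suc m) e {ρ} r guide wall fr = record
      { ready = Rest.ready
      ; ext = Ext-weaken (λ { (inj₁ (here (inj₁ refl))) → m≤n+m (suc e) (suc m) , ≤-refl , refl , refl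
                            ; (inj₁ (here (inj₂ (() , _))))
                            ; (inj₂ (l , u , r)) → l , m≤n⇒m≤1+n u , r }) (Ext-trans (ext st) Rest.ext)
      ; rail = rail }
      where
      st : Stage ρ _ _ _ (m + suc e , 2 + Y , 0) (back j , 0)
      st = run (back j) (0 , 2 , 0) (suc m + suc e , Y) refl refl r
             ((fr (suc m + suc e) (m≤n+m (suc e) (suc m)) ≤-refl , λ ()) ∷ []) (((λ ()) ∷ []) ∷ [] ∷ [])
             (λ ex → first refl refl (tr ex (guide (suc m + suc e) (s≤s (m≤n+m (suc e) m)) ≤-refl)))
      ahead : ∀ x → suc e ≤ x → x ≤ m + suc e → ¬ Occ (Stage.ρ′ st) (x , 2 + Y , 0)
      ahead x l u = Ext-free (ext st) (λ { (here (inj₁ refl)) → 1+n≰n u ; (here (inj₂ (() , _))) }) (fr x l (m≤n⇒m≤1+n u))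
      module Rest = Railed (backRun m e (ready st)
        (λ x l u → tr (ext st) (guide x l (m≤n⇒m≤1+n u))) (tr (ext st) wall)
        ahead)
      rail : ∀ x → suc e ≤ x → x ≤ suc m + suc e → Tr Rest.ρ′ (x , 2 + Y , 0)
      rail x l u with m≤n⇒m<n∨m≡n u
      ... | inj₁ (s≤s u′) = Rest.rail x l u′
      ... | inj₂ refl = tr Rest.ext (All.head (trs st))

    -- The mirror image of `backRun`, one row higher: row 2 is the floor, the pillar is the wall,
    -- and the pocket in column `f` is the hole.
    carryRun : ∀ bs m x {f ρ} → m + x ≡ f → Ready ρ (x , 3 + Y , 0) (carry j bs , 0) →
               (∀ x′ → x ≤ x′ → x′ < f → Tr ρ (x′ , 2 + Y , 0)) → Tr ρ (suc f , 3 + Y , 0) →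
               (∀ x′ → x ≤ x′ → x′ ≤ f → ¬ Occ ρ (x′ , 3 + Y , 0)) →
               Railed ρ (f , 2 + Y , 0) (stop j bs , 0) x f (3 + Y)
    carryRun bs zero x {ρ = ρ} refl r guide wall fr = record
      { ready = ready st
      ; ext = Ext-weaken (λ { (here (inj₁ refl)) → ≤-refl , ≤-refl , refl , refl ; (here (inj₂ (() , _))) }) (ext st)
      ; rail = λ { x′ l u → subst (λ x → Tr _ (x , 3 + Y , 0)) (≤-antisym l u) (All.head (trs st)) } }
      where
      st : Stage ρ _ _ _ (x , 2 + Y , 0) (stop j bs , 0)
      st = run (carry j bs) (0 , 3 , 0) (x , Y) refl refl r ((fr x ≤-refl ≤-refl , λ ()) ∷ [])
             (((λ ()) ∷ []) ∷ [] ∷ []) (λ ex → second refl refl (tr ex wall))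
    carryRun bs (suc m) x {f} {ρ} refl r guide wall fr = record
      { ready = Rest.ready
      ; ext = Ext-weaken (λ { (inj₁ (here (inj₁ refl))) → ≤-refl , x≤f , refl , refl
                            ; (inj₁ (here (inj₂ (() , _))))
                            ; (inj₂ (l , r)) → ≤-trans (n≤1+n x) l , r }) (Ext-trans (ext st) Rest.ext)
      ; rail = rail }
      where
      x≤f : x ≤ suc m + x
      x≤f = m≤n+m x (suc m)
      st : Stage ρ _ _ _ (suc x , 3 + Y , 0) (carry j bs , 0)
      st = run (carry j bs) (0 , 3 , 0) (x , Y) refl refl r ((fr x ≤-refl x≤f , λ ()) ∷ [])
             (((λ ()) ∷ []) ∷ [] ∷ [])
             (λ ex → first refl refl (tr ex (guide x ≤-refl (s≤s (m≤n+m x m)))))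
      ahead : ∀ x′ → suc x ≤ x′ → x′ ≤ suc m + x → ¬ Occ (Stage.ρ′ st) (x′ , 3 + Y , 0)
      ahead x′ l u = Ext-free (ext st) (λ { (here (inj₁ refl)) → 1+n≰n l ; (here (inj₂ (() , _))) })
                       (fr x′ (≤-trans (n≤1+n x) l) u)
      module Rest = Railed (carryRun bs m (suc x) (+-suc m x) (ready st)
        (λ x′ l u → tr (ext st) (guide x′ (≤-trans (n≤1+n x) l) u)) (tr (ext st) wall)
        ahead)
      rail : ∀ x′ → x ≤ x′ → x′ ≤ suc m + x → Tr Rest.ρ′ (x′ , 3 + Y , 0)
      rail x′ l u with m≤n⇒m<n∨m≡n l
      ... | inj₁ l′ = Rest.rail x′ l′ u
      ... | inj₂ refl = tr Rest.ext (All.head (trs st))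

    -- The exception is for columns `q` and `1 + q` of the upper layer, where `enter` or `again` has
    -- just passed above cells that the cycle needs in layer 0.
    LoopFree : List Placed → ℕ → Set
    LoopFree ρ q = ∀ x y z → q ≤ x → y ≤ 3 + Y → z ≡ 0 ⊎ 2 + q ≤ x → ¬ Occ ρ (x , y , z)

    SubPass : Bool → ℕ → Set
    SubPass f A = ∀ {ρ} X → Ready ρ (X , 1 + Y , 1) (enter f j , 0) → FreeFrom ρ X (1 + Y) → Passed ρ X j A

    stopMarks : List Mark
    stopMarks = marks (stop j []) (1 , 2 , 0)

    leave-floor : ∀ {e x y} → InMarks (marks (leave false j) (0 , 2 , 0)) (e , Y) (x , y , 0) → x ≡ e × y ≡ 2 + Y
    leave-floor (here (inj₁ refl)) = refl , refl
    leave-floor (here (inj₂ (() , _)))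
    leave-floor (there (here (inj₂ (() , _))))
    leave-floor (there (there (here (inj₂ (() , _)))))
    leave-floor (there (there (there (here (inj₂ (() , _))))))

    3+n≰n : ∀ {n} → ¬ (3 + n ≤ n)
    3+n≰n le = 1+n≰n (≤-trans (m≤n+m _ 2) le)

    off-roof : ∀ o {x X} → (x , 3 + Y , 0) ≡ o ⊕ (X , Y) → (3 , 0) ≡ proj₂ o
    off-roof (i , j′ , z) e = cong₂ _,_ (+-cancelʳ-≡ Y 3 j′ (cong (proj₁ ∘ proj₂) e)) (cong (proj₂ ∘ proj₂) e)

    lift-roof : ∀ {q x} → InMarks (marks (lift j []) (1 , 1 , 0)) (q , Y) (x , 3 + Y , 0) → x ≡ q
    lift-roof (here (inj₁ e)) = case off-roof (1 , 1 , 0) e of λ ()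
    lift-roof (here (inj₂ (_ , _ , y≤ , _))) = contradiction y≤ 3+n≰n
    lift-roof (there (here (inj₁ e))) = case off-roof (0 , 1 , 0) e of λ ()
    lift-roof (there (here (inj₂ (_ , _ , y≤ , _)))) = contradiction y≤ 3+n≰n
    lift-roof (there (there (here (inj₁ e)))) = case off-roof (0 , 2 , 0) e of λ ()
    lift-roof (there (there (here (inj₂ (() , _)))))
    lift-roof (there (there (there (here (inj₁ e))))) = cong proj₁ e
    lift-roof (there (there (there (here (inj₂ (() , _))))))

    -- Of all cells of `turn`, only the pillar lies in row 3 of layer 0, so it does not obstruct
    -- `carry` before that column.
    turn-roof : ∀ {F x} → InMarks (marks (turn j) (0 , 0 , 1)) (F , Y) (x , 3 + Y , 0) → x ≡ 2 + F
    turn-roof (here (inj₁ e)) = case off-roof (0 , 0 , 1) e of λ ()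
    turn-roof (here (inj₂ (() , _)))
    turn-roof (there (here (inj₁ e))) = case off-roof (0 , 1 , 1) e of λ ()
    turn-roof (there (here (inj₂ (() , _))))
    turn-roof (there (there (here (inj₁ e)))) = case off-roof (0 , 1 , 0) e of λ ()
    turn-roof (there (there (here (inj₂ (_ , _ , y≤ , _))))) = contradiction y≤ 3+n≰n
    turn-roof (there (there (there (here (inj₁ e))))) = case off-roof (1 , 1 , 0) e of λ ()
    turn-roof (there (there (there (here (inj₂ (_ , _ , y≤ , _)))))) = contradiction y≤ 3+n≰n
    turn-roof (there (there (there (there (here (inj₁ e)))))) = case off-roof (2 , 1 , 0) e of λ ()
    turn-roof (there (there (there (there (here (inj₂ (_ , _ , y≤ , _))))))) = contradiction y≤ 3+n≰n
    turn-roof (there (there (there (there (there (here (inj₁ e))))))) = case off-roof (2 , 2 , 0) e of λ ()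
    turn-roof (there (there (there (there (there (here (inj₂ (() , _))))))))
    turn-roof (there (there (there (there (there (there (here (inj₁ e)))))))) = cong proj₁ e
    turn-roof (there (there (there (there (there (there (here (inj₂ (() , _)))))))))
    turn-roof (there (there (there (there (there (there (there (here (inj₁ e))))))))) = case off-roof (2 , 3 , 1) e of λ ()
    turn-roof (there (there (there (there (there (there (there (here (inj₂ (() , _))))))))))
    turn-roof (there (there (there (there (there (there (there (there (here (inj₁ e)))))))))) = case off-roof (1 , 3 , 1) e of λ ()
    turn-roof (there (there (there (there (there (there (there (there (here (inj₂ (() , _)))))))))))
    turn-roof (there (there (there (there (there (there (there (there (there (here (inj₁ e))))))))))) = case off-roof (0 , 3 , 1) e of λ ()
    turn-roof (there (there (there (there (there (there (there (there (there (here (inj₂ (() , _))))))))))))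
    turn-roof (there (there (there (there (there (there (there (there (there (there (here (inj₁ e)))))))))))) = case off-roof (0 , 2 , 1) e of λ ()
    turn-roof (there (there (there (there (there (there (there (there (there (there (here (inj₂ (() , _)))))))))))))
    turn-roof (there (there (there (there (there (there (there (there (there (there (there (here (inj₁ e))))))))))))) = case off-roof (0 , 2 , 0) e of λ ()
    turn-roof (there (there (there (there (there (there (there (there (there (there (there (here (inj₂ (() , _))))))))))))))

    write-cell : ∀ {q x y z} → InMarks (marks (write false j []) (1 , 2 , 0)) (q , Y) (x , y , z) →
                 x ≡ 1 + q × y ≡ 2 + Y × z ≡ 0
    write-cell (here (inj₁ refl)) = refl , refl , refl
    write-cell (here (inj₂ (() , _)))

    shade : ∀ X i {x y} → y ≤ 1 + Y → x ≡ i + X → InMark (X , Y) (x , y , 0) ((i , 1 , 0) , true)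
    shade X i y≤ x≡ with m≤n⇒m<n∨m≡n y≤
    shade X i y≤ x≡ | inj₁ (s≤s y≤′) = inj₂ (refl , x≡ , y≤′ , refl)
    shade X i y≤ refl | inj₂ refl = inj₁ refl

    at-column : ∀ {ρ x x′ y z} → x ≡ x′ → Tr ρ (x′ , y , z) → Tr ρ (x , y , z)
    at-column refl t = t

    -- The cycle ends just before `stop`, whether or not the digit overflows. The one cell of layer
    -- 0 still missing is the pocket, which `stop` fills in both cases.
    record Cycled (ρ : List Placed) (q : ℕ) (bs : List Bool) (A : ℕ) : Set where
      field
        {ρ′} : List Placed
        {F} : ℕ
        width : F ≡ A + (2 + endCol bs (2 + q))
        ready : Ready ρ′ (1 + F , 2 + Y , 0) (stop j bs , 0)
        ext : Ext ρ ρ′ (Box q (3 + F) (3 + Y))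
        stopFree : All (MarkFree ρ′ (F , Y)) stopMarks
        filled : ∀ x y → q ≤ x → x < 3 + F → y ≤ 3 + Y → Occ ρ′ (x , y , 0) ⊎ (x ≡ 1 + F × y ≡ 2 + Y)
        top : ∀ x → q ≤ x → x < 3 + F → Tr ρ′ (x , 3 + Y , 0)

    -- One increment: write the digit, run the lower digits, return to read it, carry it onward.
    module CycleProof (f : Bool) (bs : List Bool) (q A : ℕ) {ρ : List Placed} (j< : j < digits)
                      (len : length bs ≡ n) (sub : SubPass f A)
                      (r : Ready ρ (1 + q , 2 + Y , 0) (write f j bs , 0)) (lf : LoopFree ρ q) where

      -- The bits start in column `2 + q`: column `q` is kept for the climb of `lift`, and `write`
      -- stands in column `1 + q`.
      e : ℕ
      e = endCol bs (2 + q)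

      2+q≤e : 2 + q ≤ e
      2+q≤e = endCol-≥ bs (2 + q)

      q<e : q < e
      q<e = ≤-trans (n≤1+n _) 2+q≤e

      m₁ m₃ m₅ m₇ m₉ : List Mark
      m₁ = marks (write f j bs) (1 , 2 , 0)
      m₃ = marks (leave f j) (0 , 2 , 0)
      m₅ = marks (turn j) (0 , 0 , 1)
      m₇ = marks (dip j) (1 , 1 , 0)
      m₉ = marks (lift j bs) (1 , 1 , 0)

      opaque
        st₁ : Stage ρ (InMarks m₁ (q , Y)) m₁ (q , Y) (2 + q , 2 + Y , 0) (writeRest f j bs , 0)
        st₁ = run (write f j bs) (1 , 2 , 0) (q , Y) refl refl r
                ((lf (1 + q) (2 + Y) 0 (n≤1+n q) (n≤1+n _) (inj₁ refl) , λ ()) ∷ []) ([] ∷ [])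
                (λ _ → only-by (enter-writeRest f j bs) refl)

      m₁-col : ∀ {x y z} → InMarks m₁ (q , Y) (x , y , z) → x ≡ 1 + q × y ≡ 2 + Y × z ≡ 0
      m₁-col = write-cell

      opaque
        wr : Wrote f bs (2 + q) (Stage.ρ′ st₁)
        wr = writeBits f bs (2 + q) (ready st₁) λ x y z l u →
          Ext-free (ext st₁) (λ i → 1+n≰n (subst (2 + q ≤_) (proj₁ (m₁-col i)) l))
            (lf x y z (≤-trans (≤-trans (n≤1+n q) (n≤1+n _)) l) (≤-trans u (n≤1+n _)) (inj₂ l))
      module Wr = Wrote wr

      opaque
        free₂ : ∀ x y z → e ≤ x → y ≤ 3 + Y → ¬ Occ Wr.ρ′ (x , y , z)
        free₂ x y z l u = Ext-free Wr.ext (λ w → <⇒≱ (proj₁ (proj₂ (Written-bound bs w))) l)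
          (Ext-free (ext st₁) (λ i → 1+n≰n (≤-trans 2+q≤e (subst (e ≤_) (proj₁ (m₁-col i)) l)))
            (lf x y z (≤-trans (<⇒≤ q<e) l) u (inj₂ (≤-trans 2+q≤e l))))

      opaque
        st₃ : Stage Wr.ρ′ (InMarks m₃ (e , Y)) m₃ (e , Y) (2 + e , 1 + Y , 1) (enter f j , 0)
        st₃ = run (leave f j) (0 , 2 , 0) (e , Y) refl refl Wr.ready (box-out (Occ Wr.ρ′) 3 m₃ free₂) ([] ∷ [])
                (λ _ → only-by (enter-enter f j) refl)

      m₃-col : ∀ {x y z} → InMarks m₃ (e , Y) (x , y , z) → e ≤ x × x ≤ 1 + e × y ≤ 2 + Y × z ≤ 1
      m₃-col = marks-bound 1 2 m₃

      opaque
        sb : Passed (Stage.ρ′ st₃) (2 + e) j A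
        sb = sub (2 + e) (ready st₃) λ x y z l u →
          Ext-free (ext st₃) (λ i → <⇒≱ l (proj₁ (proj₂ (m₃-col i))))
            (free₂ x y z (≤-trans (m≤n+m e 2) l) (≤-trans u (m≤n+m _ 2)))
      module Sb = Passed sb

      F : ℕ
      F = suc Sb.f′

      ρ₄ : List Placed
      ρ₄ = ((Sb.f′ , base j , 1) , Sb.s) ∷ Sb.ρ′

      e<f′ : 2 + e ≤ Sb.f′
      e<f′ = Sb.wide

      e≤F : e ≤ F
      e≤F = ≤-trans (m≤n+m e 3) (s≤s e<f′)

      opaque
        free₄ : ∀ x y z → F ≤ x → y ≤ 3 + Y → ¬ Occ ρ₄ (x , y , z)
        free₄ x y z l u = Ext-free Sb.ext (λ (_ , lt , _) → <⇒≱ lt l)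
          (Ext-free (ext st₃) (λ i → <⇒≱ (≤-trans (s≤s (proj₁ (proj₂ (m₃-col i)))) (≤-trans e<f′ (n≤1+n _))) l)
            (free₂ x y z (≤-trans (≤-trans (m≤n+m e 3) (s≤s e<f′)) l) u))

      opaque
        st₅ : Stage ρ₄ (InMarks m₅ (F , Y)) m₅ (F , Y) (Sb.f′ , 2 + Y , 0) (back j , 0)
        st₅ = run (turn j) (0 , 0 , 1) (F , Y) refl refl (Passed-turn sb j<) (box-out (Occ ρ₄) 3 m₅ free₄) ([] ∷ [])
                (λ _ → only refl)

      m₅-col : ∀ {x y z} → InMarks m₅ (F , Y) (x , y , z) → F ≤ x × x ≤ 2 + F × y ≤ 3 + Y × z ≤ 1
      m₅-col = marks-bound 2 3 m₅

      back≡ : Sb.f′ ∸ suc e + suc e ≡ Sb.f′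
      back≡ = m∸n+n≡m (≤-trans (n≤1+n _) e<f′)

      opaque
        bk : Railed (Stage.ρ′ st₅) (suc e , 1 + Y , 0) (dip j , 0) (suc e) (Sb.f′ ∸ suc e + suc e) (2 + Y)
        bk = backRun (Sb.f′ ∸ suc e) e (subst (λ x → Ready (Stage.ρ′ st₅) (x , 2 + Y , 0) (back j , 0)) (sym back≡) (ready st₅))
          (λ x l u → tr (ext st₅) (Sb.top x l (subst (x ≤_) back≡ u)))
          -- The wall is the first tile of `leave`, in column `e`; its other tiles lie in the upper
          -- layer, which keeps the hole in column `1 + e` open.
          (tr (ext st₅) (tr Sb.ext (All.head (trs st₃))))
          (λ x l u → let u′ = subst (x ≤_) back≡ u in
            Ext-free (ext st₅) (λ i → <⇒≱ (proj₁ (m₅-col i)) u′)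
            (Ext-free Sb.ext (λ (_ , _ , y≤ , _) → 1+n≰n y≤)
            (Ext-free (ext st₃) (λ i → 1+n≰n (subst (suc e ≤_) (proj₁ (leave-floor i)) l)) (free₂ x (2 + Y) 0 (≤-trans (n≤1+n e) l) (n≤1+n _)))))
      module Bk = Railed bk

      bk-col : ∀ {x y z} → Lane (suc e) (Sb.f′ ∸ suc e + suc e) (2 + Y) (x , y , z) → suc e ≤ x × x ≤ Sb.f′ × y ≡ 2 + Y × z ≡ 0
      bk-col (l , u , p) = l , ≤-trans u (≤-reflexive back≡) , p

      opaque
        free₆ : ∀ x y → e ≤ x → x ≤ 1 + e → y ≤ 1 + Y → ¬ Occ Bk.ρ′ (x , y , 0)
        free₆ x y l u y≤ = Ext-free Bk.ext (λ (_ , _ , y≡ , _) → 1+n≰n (subst (_≤ 1 + Y) y≡ y≤))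
          (Ext-free (ext st₅) (λ i → <⇒≱ (≤-trans e<f′ (≤-trans (n≤1+n _) (proj₁ (m₅-col i)))) u)
          (Ext-free Sb.ext (λ (l′ , _) → <⇒≱ l′ u)
          (Ext-free (ext st₃) (λ i → 1+n≰n (subst (_≤ 1 + Y) (proj₂ (leave-floor i)) y≤)) (free₂ x y 0 l (≤-trans y≤ (m≤n+m _ 2))))))
      p : ℕ
      p = ℕ.pred e

      sp≡e : suc p ≡ e
      sp≡e = suc-pred e {{ℕ.>-nonZero (≤-trans (s≤s z≤n) 2+q≤e)}}

      opaque
        st₇ : Stage Bk.ρ′ (InMarks m₇ (e , Y)) m₇ (e , Y) (p , 1 + Y , 0) (read j [] , 0)
        st₇ = run (dip j) (1 , 1 , 0) (e , Y) refl refl Bk.ready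
                ((free₆ _ _ (n≤1+n e) ≤-refl ≤-refl , λ _ y y≤ → free₆ _ y (n≤1+n e) ≤-refl (≤-trans y≤ (n≤1+n Y))) ∷
                 (free₆ _ _ ≤-refl (n≤1+n e) ≤-refl , λ _ y y≤ → free₆ _ y ≤-refl (n≤1+n e) (≤-trans y≤ (n≤1+n Y))) ∷ [])
                (((λ e → case trans (sym (enter-read j [])) e of λ ()) ∷ []) ∷ [] ∷ [])
                (λ _ → only-by (enter-read j []) (step-west sp≡e))

      m₇-col : ∀ {x y z} → InMarks m₇ (e , Y) (x , y , z) → e ≤ x × x ≤ 1 + e × y ≤ 1 + Y × z ≤ 1
      m₇-col = marks-bound 1 1 m₇

      opaque
        legible₇ : Legible bs (2 + q) (Stage.ρ′ st₇)
        legible₇ = Legible-Ext bs (2 + q) (ext st₇) (λ _ _ _ i → proj₁ (m₇-col i))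
          (Legible-Ext bs (2 + q) Bk.ext (λ _ _ _ (l , _) → ≤-trans (n≤1+n e) l)
          (Legible-Ext bs (2 + q) (ext st₅) (λ _ _ _ i → ≤-trans (≤-trans (m≤n+m e 3) (s≤s e<f′)) (proj₁ (m₅-col i)))
          (Legible-Ext bs (2 + q) Sb.ext (λ _ _ _ (l , _) → ≤-trans (m≤n+m e 2) l)
          (Legible-Ext bs (2 + q) (ext st₃) (λ _ _ _ i → proj₁ (m₃-col i)) Wr.legible))))

      opaque
        rd : Read bs [] (2 + q) (1 + q) (Stage.ρ′ st₇)
        rd = readBits bs [] (2 + q) sp≡e refl (≤-reflexive (trans (+-identityʳ _) len)) (ready st₇) legible₇
      module Rd = Read rd

      opaque
        rd-ready : Ready Rd.ρ′ (1 + q , 1 + Y , 0) (lift j bs , 0)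
        rd-ready = subst (λ nd → Ready Rd.ρ′ (1 + q , 1 + Y , 0) (nd , 0))
          (trans (cong (read j) (++-identityʳ bs)) (read-full bs len)) Rd.ready

      opaque
        free₈ : ∀ x y → q ≤ x → x ≤ 1 + q → x ≡ q ⊎ y ≤ 1 + Y → y ≤ 3 + Y → ¬ Occ Rd.ρ′ (x , y , 0)
        free₈ x y l u c y≤ = Ext-free Rd.ext (λ s → <⇒≱ (proj₁ (Scanned-bound bs s)) u)
          (Ext-free (ext st₇) (λ i → <⇒≱ (≤-trans 2+q≤e (proj₁ (m₇-col i))) u)
          (Ext-free Bk.ext (λ (l′ , _) → <⇒≱ (≤-trans 2+q≤e (≤-trans (n≤1+n e) l′)) u)
          (Ext-free (ext st₅) (λ i → <⇒≱ (≤-trans 2+q≤e (≤-trans (≤-trans (m≤n+m e 3) (s≤s e<f′)) (proj₁ (m₅-col i)))) u)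
          (Ext-free Sb.ext (λ (l′ , _) → <⇒≱ (≤-trans 2+q≤e (≤-trans (m≤n+m e 2) l′)) u)
          (Ext-free (ext st₃) (λ i → <⇒≱ (≤-trans 2+q≤e (proj₁ (m₃-col i))) u)
          (Ext-free Wr.ext (λ w → <⇒≱ (proj₁ (Written-bound bs w)) u)
          (Ext-free (ext st₁) (λ i → ¬m₁ c (m₁-col i)) (lf x y 0 l y≤ (inj₁ refl)))))))))
          where
          ¬m₁ : x ≡ q ⊎ y ≤ 1 + Y → ¬ (x ≡ 1 + q × y ≡ 2 + Y × 0 ≡ 0)
          ¬m₁ (inj₁ a) (b , _) = 1+n≢n (trans (sym b) a)
          ¬m₁ (inj₂ a) (_ , b , _) = 1+n≰n (subst (_≤ 1 + Y) b a)

      opaque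
        st₉ : Stage Rd.ρ′ (InMarks m₉ (q , Y)) m₉ (q , Y) (1 + q , 3 + Y , 0) (carry j bs , 0)
        st₉ = run (lift j bs) (1 , 1 , 0) (q , Y) refl refl rd-ready
          ((free₈ _ _ (n≤1+n q) ≤-refl (inj₂ ≤-refl) (m≤n+m _ 2) ,
              λ _ y y≤ → free₈ _ y (n≤1+n q) ≤-refl (inj₂ (≤-trans y≤ (n≤1+n Y))) (≤-trans y≤ (m≤n+m Y 3))) ∷
           (free₈ _ _ ≤-refl (n≤1+n q) (inj₁ refl) (m≤n+m _ 2) ,
              λ _ y y≤ → free₈ _ y ≤-refl (n≤1+n q) (inj₁ refl) (≤-trans y≤ (m≤n+m Y 3))) ∷
           (free₈ _ _ ≤-refl (n≤1+n q) (inj₁ refl) (n≤1+n _) , λ ()) ∷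
           (free₈ _ _ ≤-refl (n≤1+n q) (inj₁ refl) ≤-refl , λ ()) ∷ [])
          ([] ∷ []) (λ _ → only refl)

      m₉-col : ∀ {x y z} → InMarks m₉ (q , Y) (x , y , z) → q ≤ x × x ≤ 1 + q × y ≤ 3 + Y × z ≤ 1
      m₉-col = marks-bound 1 3 m₉

      column : ∀ x → q ≤ x → x < 3 + F → Column q e Sb.f′ x
      column x l u = columnOf e<f′ l u

      opaque
        rail₉ : ∀ x → 1 + q ≤ x → x < 1 + F → Tr (Stage.ρ′ st₉) (x , 2 + Y , 0)
        rail₉ x l u = tr (ext st₉) (tr Rd.ext (tr (ext st₇) (go (column x (≤-trans (n≤1+n q) l) (≤-trans u (m≤n+m _ 2))))))
          where
          go : Column q e Sb.f′ x → Tr Bk.ρ′ (x , 2 + Y , 0)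
          go (at-q x≡) = contradiction (subst (1 + q ≤_) x≡ l) 1+n≰n
          go (at-1+q x≡) = at-column x≡ (tr Bk.ext (tr (ext st₅) (tr Sb.ext (tr (ext st₃) (tr Wr.ext (All.head (trs st₁)))))))
          go (region l u) = tr Bk.ext (tr (ext st₅) (tr Sb.ext (tr (ext st₃) (Wr.rail x l u))))
          go (at-e x≡) = at-column x≡ (tr Bk.ext (tr (ext st₅) (tr Sb.ext (All.head (trs st₃)))))
          go (at-1+e x≡) = at-column x≡ (Bk.rail (suc e) ≤-refl (m≤n+m _ _))
          go (below l u) = Bk.rail x (≤-trans (n≤1+n _) l) (≤-trans u (≤-reflexive (sym back≡)))
          -- The last tile of `turn` extends the floor to column `F`; in column `1 + F` the floor is
          -- missing, and this is the pocket.
          go (at-F x≡) = at-column x≡ (tr Bk.ext (All.lookup (trs st₅)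
            (there (there (there (there (there (there (there (there (there (there (there (here refl))))))))))))))
          go (at-1+F x≡) = contradiction (subst (_< 1 + F) x≡ u) (<-irrefl refl)
          go (at-2+F x≡) = contradiction (subst (_< 1 + F) x≡ u) (<⇒≱ (s≤s (n≤1+n _)))

      opaque
        -- The seventh tile of `turn`, next to the cell of row 3 above the pocket: there `carry` has
        -- no way left but south.
        pillar : Tr (Stage.ρ′ st₅) (2 + F , 3 + Y , 0)
        pillar = All.lookup (trs st₅) (there (there (there (there (there (there (here refl)))))))

      1+q≤1+F : 1 + q ≤ 1 + F
      1+q≤1+F = s≤s (≤-trans (<⇒≤ q<e) (≤-trans (m≤n+m e 3) (s≤s e<f′)))

      opaque
        cr : Railed (Stage.ρ′ st₉) (1 + F , 2 + Y , 0) (stop j bs , 0) (1 + q) (1 + F) (3 + Y)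
        cr = carryRun bs (1 + F ∸ (1 + q)) (1 + q) (m∸n+n≡m 1+q≤1+F) (ready st₉) rail₉
          (tr (ext st₉) (tr Rd.ext (tr (ext st₇) (tr Bk.ext pillar))))
          λ x l u → Ext-free (ext st₉) (λ i → 1+n≰n (subst (1 + q ≤_) (lift-roof i) l))
            (Ext-free Rd.ext (λ s → high (proj₁ (proj₂ (proj₂ (Scanned-bound bs s)))))
            (Ext-free (ext st₇) (λ i → high (proj₁ (proj₂ (proj₂ (m₇-col i)))))
            (Ext-free Bk.ext (λ (_ , _ , y≡ , _) → 1+n≢n y≡)
            (Ext-free (ext st₅) (λ i → 1+n≰n (subst (_≤ 1 + F) (turn-roof i) u))
            (Ext-free Sb.ext (λ (_ , _ , y≤ , _) → high y≤)
            (Ext-free (ext st₃) (λ i → 1+n≰n (proj₁ (proj₂ (proj₂ (m₃-col i)))))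
            (Ext-free Wr.ext (λ w → 1+n≰n (proj₁ (proj₂ (proj₂ (Written-bound bs w)))))
            (Ext-free (ext st₁) (λ i → 1+n≢n (proj₁ (proj₂ (m₁-col i))))
              (lf x (3 + Y) 0 (≤-trans (n≤1+n q) l) ≤-refl (inj₁ refl))))))))))
          where
          high : ¬ (3 + Y ≤ 1 + Y)
          high le = 1+n≰n (≤-trans (n≤1+n _) le)
      module Cr = Railed cr

      opaque
        stopFree : All (MarkFree Cr.ρ′ (F , Y)) stopMarks
        stopFree = still-free Cr.ext (((λ (_ , _ , y≡ , _) → 1+n≢n (sym y≡)) , λ ()) ∷ ((λ (_ , _ , y≡ , _) → 1+n≢n (sym y≡)) , λ ()) ∷ ((λ (_ , _ , y≡ , _) → 1+n≢n (sym y≡)) , λ ()) ∷ [])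
          (still-free (ext st₉) (left-out (InMarks m₉ (q , Y)) stopMarks λ _ _ _ i → ≤-trans (s≤s (proj₁ (proj₂ (m₉-col i)))) (≤-trans 2+q≤e e≤F))
          (still-free Rd.ext (left-out (Scanned bs (2 + q)) stopMarks λ _ _ _ s → ≤-trans (proj₁ (proj₂ (Scanned-bound bs s))) e≤F)
          (still-free (ext st₇) (left-out (InMarks m₇ (e , Y)) stopMarks λ _ _ _ i → ≤-trans (s≤s (proj₁ (proj₂ (m₇-col i)))) (≤-trans e<f′ (n≤1+n _)))
          (still-free Bk.ext (left-out (Lane (suc e) (Sb.f′ ∸ suc e + suc e) (2 + Y)) stopMarks λ _ _ _ l → s≤s (proj₁ (proj₂ (bk-col l))))
          (still-free (ext st₅) (marks-out m₅ stopMarks) (box-out (Occ ρ₄) 3 stopMarks free₄))))))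


      opaque
        top : ∀ x → q ≤ x → x < 3 + F → Tr Cr.ρ′ (x , 3 + Y , 0)
        top x l u = go (m≤n⇒m<n∨m≡n l) (m≤n⇒m<n∨m≡n (s≤s⁻¹ u))
          where
          go : q < x ⊎ q ≡ x → x < 2 + F ⊎ x ≡ 2 + F → Tr Cr.ρ′ (x , 3 + Y , 0)
          go (inj₂ x≡) _ = at-column (sym x≡) (tr Cr.ext (All.lookup (trs st₉) (there (there (there (here refl))))))
          go (inj₁ l) (inj₁ u) = Cr.rail x l (s≤s⁻¹ u)
          go (inj₁ l) (inj₂ x≡) = at-column x≡ (tr Cr.ext (tr (ext st₉) (tr Rd.ext (tr (ext st₇) (tr Bk.ext pillar)))))

      opaque
        filled : ∀ x y → q ≤ x → x < 3 + F → y ≤ 3 + Y → Occ Cr.ρ′ (x , y , 0) ⊎ (x ≡ 1 + F × y ≡ 2 + Y)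
        filled x y l u y≤ = go₃ (m≤n⇒m<n∨m≡n y≤)
          where
          from₅ : InMarks m₅ (F , Y) (x , y , 0) → Occ Cr.ρ′ (x , y , 0)
          from₅ i = old Cr.ext (old (ext st₉) (old Rd.ext (old (ext st₇) (old Bk.ext (occs st₅ i)))))
          go₁ : y ≤ 1 + Y → Column q e Sb.f′ x → Occ Cr.ρ′ (x , y , 0)
          go₁ y≤ (at-q x≡) = old Cr.ext (occs st₉ (there (here (shade q 0 y≤ x≡))))
          go₁ y≤ (at-1+q x≡) = old Cr.ext (occs st₉ (here (shade q 1 y≤ x≡)))
          go₁ y≤ (region l u) =
            [ (λ w → old Cr.ext (old (ext st₉) (old Rd.ext (old (ext st₇) (old Bk.ext (old (ext st₅) (old Sb.ext
                       (old (ext st₃) (Wr.occs w)))))))))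
            , (λ s → old Cr.ext (old (ext st₉) (Rd.occs s))) ]′ (region-filled bs x y l u y≤)
          go₁ y≤ (at-e x≡) = old Cr.ext (old (ext st₉) (old Rd.ext (occs st₇ (there (here (shade e 0 y≤ x≡))))))
          go₁ y≤ (at-1+e x≡) = old Cr.ext (old (ext st₉) (old Rd.ext (occs st₇ (here (shade e 1 y≤ x≡)))))
          go₁ y≤ (below l u) = old Cr.ext (old (ext st₉) (old Rd.ext (old (ext st₇) (old Bk.ext (old (ext st₅)
                                (Sb.filled x y l u y≤))))))
          go₁ y≤ (at-F x≡) = from₅ (there (there (here (shade F 0 y≤ x≡))))
          go₁ y≤ (at-1+F x≡) = from₅ (there (there (there (here (shade F 1 y≤ x≡)))))
          go₁ y≤ (at-2+F x≡) = from₅ (there (there (there (there (here (shade F 2 y≤ x≡))))))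
          onRail : 1 + q ≤ x → x < 1 + F → Occ Cr.ρ′ (x , 2 + Y , 0)
          onRail l u = Tr-Occ (tr Cr.ext (rail₉ x l u))
          go₂ : Column q e Sb.f′ x → Occ Cr.ρ′ (x , 2 + Y , 0) ⊎ x ≡ 1 + F
          go₂ (at-q x≡) = inj₁ (Tr-Occ (at-column x≡ (tr Cr.ext (All.lookup (trs st₉) (there (there (here refl)))))))
          go₂ (at-1+F x≡) = inj₂ x≡
          go₂ (at-2+F x≡) = inj₁ (Tr-Occ (at-column x≡ (tr Cr.ext (tr (ext st₉) (tr Rd.ext (tr (ext st₇) (tr Bk.ext
            (All.lookup (trs st₅) (there (there (there (there (there (here refl))))))))))))))
          go₂ (at-1+q x≡) = inj₁ (onRail (≤-reflexive (sym x≡)) (s≤s (≤-trans (≤-reflexive x≡) (≤-trans (≤-trans (n≤1+n _) 2+q≤e) e≤F))))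
          go₂ (region l u) = inj₁ (onRail (≤-trans (n≤1+n _) l) (s≤s (≤-trans (<⇒≤ u) e≤F)))
          go₂ (at-e x≡) = inj₁ (onRail (≤-trans q<e (≤-reflexive (sym x≡))) (s≤s (≤-trans (≤-reflexive x≡) e≤F)))
          go₂ (at-1+e x≡) = inj₁ (onRail (≤-trans q<e (≤-trans (n≤1+n e) (≤-reflexive (sym x≡)))) (s≤s (≤-trans (≤-reflexive x≡) (≤-trans (n≤1+n _) (≤-trans e<f′ (n≤1+n _))))))
          go₂ (below l u) = inj₁ (onRail (≤-trans q<e (≤-trans (m≤n+m e 2) l)) (s≤s (≤-trans u (n≤1+n _))))
          go₂ (at-F x≡) = inj₁ (onRail (≤-trans q<e (≤-trans e≤F (≤-reflexive (sym x≡)))) (s≤s (≤-reflexive x≡)))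
          go₃ : y < 3 + Y ⊎ y ≡ 3 + Y → Occ Cr.ρ′ (x , y , 0) ⊎ (x ≡ 1 + F × y ≡ 2 + Y)
          go₃ (inj₂ y≡) = inj₁ (subst (λ y → Occ Cr.ρ′ (x , y , 0)) (sym y≡) (Tr-Occ (top x l u)))
          go₃ (inj₁ y<) with m≤n⇒m<n∨m≡n (s≤s⁻¹ y<)
          ... | inj₁ y<′ = inj₁ (go₁ (s≤s⁻¹ y<′) (column x l u))
          ... | inj₂ y≡ = [ (λ o → inj₁ (subst (λ y → Occ Cr.ρ′ (x , y , 0)) (sym y≡) o)) , (λ x≡ → inj₂ (x≡ , y≡)) ]′
                            (go₂ (column x l u))

      opaque
        total : Ext ρ Cr.ρ′ (Box q (3 + F) (3 + Y))
        total =
          (Ext-weaken (λ i → let a , b , c = m₁-col i in ≤-trans (n≤1+n q) (≤-reflexive (sym a)) , ≤-trans (s≤s (≤-trans (≤-reflexive a) q<e)) (s≤s (≤-trans (n≤1+n e) e<3+F)) , ≤-trans (≤-reflexive b) (n≤1+n _) , ≤-trans (≤-reflexive c) z≤n) (ext st₁)) ⨾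
          ((Ext-weaken (λ w → let a , b , c , d = Written-bound bs w
                              in ≤-trans (≤-trans (n≤1+n q) (n≤1+n _)) a , <-≤-trans b (≤-trans e≤F (m≤n+m F 3)) , m≤n⇒m≤1+n c , d) Wr.ext) ⨾
          ((Ext-weaken (λ i → let a , b , c , d = m₃-col i
                              in ≤-trans (<⇒≤ q<e) a , ≤-trans (s≤s b) (≤-trans e<f′ (m≤n+m Sb.f′ 4)) , m≤n⇒m≤1+n c , d) (ext st₃)) ⨾
          ((Ext-weaken (λ (a , b , c , d) → ≤-trans (<⇒≤ q<e) (≤-trans (m≤n+m e 2) a) , ≤-trans b (m≤n+m F 3) , ≤-trans c (m≤n+m _ 2) , d) Sb.ext) ⨾
          ((Ext-weaken (λ i → let a , b , c , d = m₅-col i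
                              in ≤-trans (<⇒≤ q<e) (≤-trans e≤F a) , s≤s b , c , d) (ext st₅)) ⨾
          ((Ext-weaken (λ l → let a , b , c , d = bk-col l in
                              ≤-trans (<⇒≤ q<e) (≤-trans (n≤1+n e) a) , s≤s (≤-trans b (m≤n+m Sb.f′ 3)) , ≤-trans (≤-reflexive c) (n≤1+n _) , ≤-trans (≤-reflexive d) z≤n) Bk.ext) ⨾
          ((Ext-weaken (λ i → let a , b , c , d = m₇-col i
                              in ≤-trans (<⇒≤ q<e) a , ≤-trans (s≤s b) (≤-trans e<f′ (m≤n+m Sb.f′ 4)) , ≤-trans c (m≤n+m _ 2) , d) (ext st₇)) ⨾
          ((Ext-weaken (λ s → let a , b , c , d = Scanned-bound bs s
                              in ≤-trans (≤-trans (n≤1+n q) (n≤1+n _)) a , <-≤-trans b (≤-trans e≤F (m≤n+m F 3)) , ≤-trans c (m≤n+m _ 2) , d) Rd.ext) ⨾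
          ((Ext-weaken (λ i → let a , b , c , d = m₉-col i
                              in a , ≤-trans (s≤s b) (≤-trans 2+q≤e (≤-trans e≤F (m≤n+m F 3))) , c , d) (ext st₉)) ⨾
          (Ext-weaken (λ (a , b , c , d) → ≤-trans (n≤1+n q) a , s≤s (≤-trans b (n≤1+n _)) , ≤-reflexive c , ≤-trans (≤-reflexive d) z≤n) Cr.ext)))))))))
          where
          e<3+F : suc e ≤ 2 + F
          e<3+F = s≤s (≤-trans e≤F (n≤1+n F))
          infixr 4 _⨾_
          _⨾_ : ∀ {ρ ρ′ ρ″ P} → Ext ρ ρ′ P → Ext ρ′ ρ″ P → Ext ρ ρ″ P
          a ⨾ b = Ext-weaken [ (λ p → p) , (λ p → p) ]′ (Ext-trans a b)

    cycle : ∀ f bs q A {ρ} → j < digits → length bs ≡ n → SubPass f A →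
            Ready ρ (1 + q , 2 + Y , 0) (write f j bs , 0) → LoopFree ρ q → Cycled ρ q bs A
    cycle f bs q A j< len sub r lf = record
      { width = Sb.width
      ; ready = Cr.ready
      ; ext = total
      ; stopFree = stopFree
      ; filled = filled
      ; top = top }
      where open CycleProof f bs q A j< len sub r lf

-- Repeating the cycle until overflow, and stacking the digits.

-- the number of increments before a digit overflows
togo : List Bool → ℕ
togo [] = 0
togo (true ∷ bs) = togo bs + togo bs
togo (false ∷ bs) = suc (togo bs + togo bs)

togo-zero : ∀ bs → togo bs ≡ 0 → allTrue bs ≡ true
togo-zero [] _ = refl
togo-zero (true ∷ bs) e = togo-zero bs (m+n≡0⇒m≡0 (togo bs) e)

togo-suc : ∀ bs {m} → togo bs ≡ suc m → allTrue bs ≡ false × togo (next bs) ≡ m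
togo-suc (false ∷ bs) refl = refl , refl
togo-suc (true ∷ bs) e with togo bs in eq
togo-suc (true ∷ bs) refl | suc t with togo-suc bs eq
... | a , refl = a , sym (+-suc _ _)

next-length : ∀ bs → length (next bs) ≡ length bs
next-length [] = refl
next-length (false ∷ bs) = refl
next-length (true ∷ bs) = cong suc (next-length bs)

module Towers (n digits padLen rowLen y₀ : ℕ) (initial : ℕ → List Bool) where
  open Passing n digits padLen rowLen y₀ initial public

  -- Four columns for each bit, two in front of the bits, two for `leave` and three for `turn`.
  stride : ℕ
  stride = n * 4 + 7

  width-last : ∀ A n q → 3 + (A + (2 + (n * 4 + (2 + q)))) ≡ n * 4 + 7 + A + 0 + q
  width-last = solve-∀

  width-more : ∀ A L n m q → n * 4 + 7 + L + m * (n * 4 + 7 + L) + (3 + (A + (2 + (n * 4 + (2 + q))))) ≡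
                             n * 4 + 7 + A + suc m * (n * 4 + 7 + L) + q
  width-more = solve-∀

  module Loop (j : ℕ) (j< : j < digits) {L : ℕ} (sub : Lanes.SubPass j false L) where
    open Lanes j

    stop-cell : ∀ {F x y z} → InMarks stopMarks (F , Y) (x , y , z) → 1 + F ≤ x × x ≤ 2 + F × y ≤ 3 + Y × z ≤ 1
    stop-cell (here (inj₁ refl)) = ≤-refl , n≤1+n _ , n≤1+n _ , z≤n
    stop-cell (here (inj₂ (() , _)))
    stop-cell (there (here (inj₁ refl))) = ≤-refl , n≤1+n _ , n≤1+n _ , ≤-refl
    stop-cell (there (here (inj₂ (() , _))))
    stop-cell (there (there (here (inj₁ refl)))) = n≤1+n _ , ≤-refl , n≤1+n _ , ≤-refl
    stop-cell (there (there (here (inj₂ (() , _)))))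

    againMarks : List Mark
    againMarks = marks (again j []) (3 , 2 , 1)

    again-cell : ∀ {F x y z} → InMarks againMarks (F , Y) (x , y , z) → 3 + F ≤ x × x ≤ 4 + F × y ≤ 3 + Y × z ≡ 1
    again-cell (here (inj₁ refl)) = ≤-refl , n≤1+n _ , n≤1+n _ , refl
    again-cell (here (inj₂ (() , _)))
    again-cell (there (here (inj₁ refl))) = n≤1+n _ , ≤-refl , n≤1+n _ , refl
    again-cell (there (here (inj₂ (() , _))))

    pocket : ∀ {F x y} → x ≡ 1 + F × y ≡ 2 + Y → InMarks stopMarks (F , Y) (x , y , 0)
    pocket (refl , refl) = here (inj₁ refl)

    -- `A` is the width of the lower run in the first cycle, which may start from the initial
    -- digits; in the `m` further cycles the lower digits start from zeros and take width `L`.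
    loop : ∀ m bs f A q {ρ} → length bs ≡ n → togo bs ≡ m → SubPass f A →
           Ready ρ (1 + q , 2 + Y , 0) (write f j bs , 0) → LoopFree ρ q →
           Passed ρ q (suc j) (stride + A + m * (stride + L))
    loop m bs f A q {ρ} len count sub₁ r lf = go m count
      where
      cy : Cycled ρ q bs A
      cy = cycle f bs q A j< len sub₁ r lf
      module C = Cycled cy
      F : ℕ
      F = C.F
      F≡ : F ≡ A + (2 + (n * 4 + (2 + q)))
      F≡ = trans C.width (cong (λ k → A + (2 + k)) (trans (endCol-length bs (2 + q)) (cong (λ l → l * 4 + (2 + q)) len)))
      2+q≤F : 2 + q ≤ F
      2+q≤F = ≤-trans (≤-trans (m≤n+m (2 + q) (2 + n * 4)) (m≤n+m (2 + (n * 4 + (2 + q))) A)) (≤-reflexive (sym F≡))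
      q≤F : q ≤ F
      q≤F = ≤-trans (m≤n+m q 2) 2+q≤F
      exits≡ : ∀ {b} → allTrue bs ≡ b → exits (stop j bs) ≡ (if b then ascend (suc j) else again j (next bs) ∷ [])
      exits≡ = cong (λ b → if b then ascend (suc j) else again j (next bs) ∷ [])
      go : ∀ m → togo bs ≡ m → Passed ρ q (suc j) (stride + A + m * (stride + L))
      -- All bits are true. The last tile of `stop` lies in row `base (suc j)` of the upper layer,
      -- just west of the cell where `turn (suc j)` would begin.
      go zero count = record
        { f′ = 2 + F
        ; width = trans (cong (λ k → 3 + k) F≡) (width-last A n q)
        ; wide = ≤-trans q≤F (m≤n+m F 2)
        ; pending = La.pending
        ; free = La.free
        ; unmarked = cong (moveTop (base j)) (proj₂ La.mark)
        ; outs≡ = trans (cong (continue (stop j bs) La.i) La.final) (cong (map first₀) (exits≡ (togo-zero bs count)))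
        ; ext = Ext-weaken (λ { (inj₁ b) → b ; (inj₂ i) → let a , b , c , d = stop-cell i
                                in ≤-trans q≤F (≤-trans (n≤1+n F) a) , s≤s b , c , d }) (Ext-trans C.ext La.ext)
        ; filled = λ x y l u y≤ → [ old La.ext , (λ p → La.occs (pocket p)) ]′ (C.filled x y l (s≤s u) y≤)
        ; top = λ x l u → tr La.ext (C.top x l (s≤s u)) }
        where
        module La = Last (runLast (stop j bs) (1 , 2 , 0) (F , Y) refl refl C.ready C.stopFree)
      go (suc m) count = Passed-cons ext₁₂ (≤-trans q≤F (m≤n+m F 3))
          (trans (cong (λ k → stride + L + m * (stride + L) + (3 + k)) F≡) (width-more A L n m q))
          rest inBox fill₁₂ top₁₂
        where
        more : allTrue bs ≡ false × togo (next bs) ≡ m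
        more = togo-suc bs count
        st₁₁ : Stage C.ρ′ (InMarks stopMarks (F , Y)) stopMarks (F , Y) (3 + F , 2 + Y , 1) (again j (next bs) , 0)
        st₁₁ = run (stop j bs) (1 , 2 , 0) (F , Y) refl refl C.ready C.stopFree
          (subst (λ ns → DistinctEnter (map first₀ ns ++ [])) (sym (exits≡ (proj₁ more))) ([] ∷ []))
          (λ _ → subst (λ ns → Go _ (2 + F , 2 + Y , 1) (map first₀ ns) (3 + F , 2 + Y , 1) (again j (next bs) , 0)) (sym (exits≡ (proj₁ more))) (only refl))
        free₁₁ : ∀ x y z → 3 + F ≤ x → y ≤ 3 + Y → ¬ Occ (Stage.ρ′ st₁₁) (x , y , z)
        free₁₁ x y z l y≤ = Ext-free (ext st₁₁) (λ i → <⇒≱ l (proj₁ (proj₂ (stop-cell i))))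
          (Ext-free C.ext (λ (_ , u , _) → <⇒≱ u l)
            (lf x y z (≤-trans q≤F (≤-trans (m≤n+m F 3) l)) y≤ (inj₂ (≤-trans 2+q≤F (≤-trans (m≤n+m F 3) l)))))
        st₁₂ : Stage (Stage.ρ′ st₁₁) (InMarks againMarks (F , Y)) againMarks (F , Y) (4 + F , 2 + Y , 0) (write false j (next bs) , 0)
        st₁₂ = run (again j (next bs)) (3 , 2 , 1) (F , Y) refl refl (ready st₁₁)
          ((free₁₁ _ _ _ ≤-refl (n≤1+n _) , λ ()) ∷ (free₁₁ _ _ _ (n≤1+n _) (n≤1+n _) , λ ()) ∷ []) ([] ∷ []) (λ _ → only refl)
        -- `again` advances in the upper layer only, so layer 0 is free for a new cycle from column
        -- `3 + F`.
        lf₁₂ : LoopFree (Stage.ρ′ st₁₂) (3 + F)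
        lf₁₂ x y z l y≤ c = Ext-free (ext st₁₂) (λ i → apart c (again-cell i)) (free₁₁ x y z l y≤)
          where
          apart : z ≡ 0 ⊎ 5 + F ≤ x → ¬ (3 + F ≤ x × x ≤ 4 + F × y ≤ 3 + Y × z ≡ 1)
          apart (inj₁ z≡0) (_ , _ , _ , z≡1) = case trans (sym z≡0) z≡1 of λ ()
          apart (inj₂ le) (_ , u , _) = <⇒≱ le u
        rest : Passed (Stage.ρ′ st₁₂) (3 + F) (suc j) (stride + L + m * (stride + L))
        rest = loop m (next bs) false L (3 + F) (trans (next-length bs) len) (proj₂ more) sub (ready st₁₂) lf₁₂
        module R = Passed rest
        ext₁₂ : Ext ρ (Stage.ρ′ st₁₂) _
        ext₁₂ = Ext-trans (Ext-trans C.ext (ext st₁₁)) (ext st₁₂)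
        5+F≤ : 5 + F ≤ suc R.f′
        5+F≤ = ≤-trans (+-monoˡ-≤ (3 + F) {2} {stride + L + m * (stride + L)}
                 (≤-trans (m≤n+m 2 (n * 4 + 5)) (≤-trans (≤-reflexive (+-assoc (n * 4) 5 2))
                    (≤-trans (m≤m+n stride L) (m≤m+n (stride + L) _)))))
                 (≤-reflexive (sym R.width))
        inBox : ∀ {x y z} → (Box q (3 + F) (3 + Y) (x , y , z) ⊎ InMarks stopMarks (F , Y) (x , y , z)) ⊎
                            InMarks againMarks (F , Y) (x , y , z) → Box q (suc R.f′) (3 + Y) (x , y , z)
        inBox (inj₁ (inj₁ (l , u , r))) = l , ≤-trans u (≤-trans (m≤n+m (3 + F) 2) 5+F≤) , r
        inBox (inj₁ (inj₂ i)) = let a , b , r = stop-cell i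
          in ≤-trans q≤F (≤-trans (n≤1+n F) a) , ≤-trans (s≤s b) (≤-trans (m≤n+m (3 + F) 2) 5+F≤) , r
        inBox (inj₂ i) = let a , b , c , d = again-cell i
          in ≤-trans q≤F (≤-trans (m≤n+m F 3) a) , ≤-trans (s≤s b) 5+F≤ , c , ≤-reflexive d
        fill₁₂ : ∀ x y → q ≤ x → x < 3 + F → y ≤ 3 + Y → Occ (Stage.ρ′ st₁₂) (x , y , 0)
        fill₁₂ x y l u y≤ = old (ext st₁₂) ([ old (ext st₁₁) , (λ p → occs st₁₁ (pocket p)) ]′ (C.filled x y l u y≤))
        top₁₂ : ∀ x → q ≤ x → x < 3 + F → Tr (Stage.ρ′ st₁₂) (x , 3 + Y , 0)
        top₁₂ x l u = tr (ext st₁₂) (tr (ext st₁₁) (C.top x l u))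

  digit : Bool → ℕ → List Bool
  digit true j = initial j
  digit false j = replicate n false

  exits-enter : ∀ f j → exits (enter f (suc j)) ≡ write f j (digit f j) ∷ []
  exits-enter true j = refl
  exits-enter false j = refl

  -- the number of columns of a run of the digits below j from the values digit f
  columns : Bool → ℕ → ℕ
  columns f zero = 2 + rowLen
  columns f (suc j) = stride + columns f j + togo (digit f j) * (stride + columns false j)

  rowRun : ∀ i x {ρ} → Ready ρ (x , 1 + y₀ , 0) (row (suc i) , 0) → FreeFrom ρ x (1 + y₀) → Passed ρ x 0 (suc i)
  rowRun zero x {ρ} r fr = Passed-cons (ext st) ≤-refl refl end
      (λ { (here (inj₁ refl)) → ≤-refl , ≤-refl , ≤-refl , z≤n
         ; (here (inj₂ (_ , refl , y≤ , refl))) → ≤-refl , ≤-refl , m≤n⇒m≤1+n y≤ , z≤n })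
      (λ _ _ l u _ → contradiction l (<⇒≱ u)) (λ _ l u → contradiction l (<⇒≱ u))
    where
    st : Stage ρ _ _ _ (x , 1 + y₀ , 1) (row 0 , 0)
    st = run (row 1) (0 , 1 , 0) (x , y₀) refl refl r (box-out (Occ ρ) 1 (marks (row 1) (0 , 1 , 0)) fr)
           (((λ ()) ∷ []) ∷ [] ∷ []) (λ _ → only refl)
    module La = Last (runLast (row 0) (0 , 1 , 1) (x , y₀) refl refl (ready st)
      (still-free (ext st) (marks-out (marks (row 1) (0 , 1 , 0)) (marks (row 0) (0 , 1 , 1)))
        (box-out (Occ ρ) 1 (marks (row 0) (0 , 1 , 1)) fr)))
    end : Passed (Stage.ρ′ st) x 0 1
    end = record
      { f′ = x
      ; width = refl
      ; wide = ≤-refl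
      ; pending = La.pending
      ; free = La.free
      ; unmarked = cong (moveTop y₀) (proj₂ La.mark)
      ; outs≡ = cong (continue (row 0) La.i) La.final
      ; ext = Ext-weaken (λ i → let a , b , c , d = marks-bound 0 1 (marks (row 0) (0 , 1 , 1)) i in a , s≤s b , c , d) La.ext
      ; filled = λ x′ y l u y≤ → old La.ext (occs st (here (shade x 0 y≤ (≤-antisym u l))))
      ; top = λ x′ l u → at-column (≤-antisym u l) (tr La.ext (All.head (trs st))) }
      where open Lanes 0 using (shade; at-column)
  rowRun (suc i) x {ρ} r fr = Passed-cons (ext st) (n≤1+n x) (+-suc (suc i) x) rest
      (λ { (here (inj₁ refl)) → ≤-refl , ≤-trans rest-wide (n≤1+n _) , ≤-refl , z≤n
         ; (here (inj₂ (_ , refl , y≤ , refl))) → ≤-refl , ≤-trans rest-wide (n≤1+n _) , m≤n⇒m≤1+n y≤ , z≤n })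
      (λ x′ y l u y≤ → occs st (here (shade x 0 y≤ (≤-antisym (s≤s⁻¹ u) l))))
      (λ x′ l u → at-column (≤-antisym (s≤s⁻¹ u) l) (All.head (trs st)))
    where
    open Lanes 0 using (shade; at-column)
    st : Stage ρ _ _ _ (suc x , 1 + y₀ , 0) (row (suc i) , 0)
    st = run (row (suc (suc i))) (0 , 1 , 0) (x , y₀) refl refl r (box-out (Occ ρ) 1 (marks (row 1) (0 , 1 , 0)) fr)
           (((λ ()) ∷ []) ∷ [] ∷ []) (λ _ → only refl)
    rest : Passed (Stage.ρ′ st) (suc x) 0 (suc i)
    rest = rowRun i (suc x) (ready st) λ x′ y z l u →
      Ext-free (ext st) (λ i → <⇒≱ l (proj₁ (proj₂ (marks-bound 0 1 (marks (row 1) (0 , 1 , 0)) i))))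
               (fr x′ y z (≤-trans (n≤1+n x) l) u)
    rest-wide : suc x ≤ Passed.f′ rest
    rest-wide = Passed.wide rest

  module _ (lengths : ∀ j → length (initial j) ≡ n) where

    digit-length : ∀ f j → length (digit f j) ≡ n
    digit-length true j = lengths j
    digit-length false j = length-replicate n

    -- The induction has to cover both flags: a first descent runs the level below once with `true`,
    -- and its later cycles run it with `false`.
    tower : ∀ j f → j ≤ digits → ∀ {ρ} X → Ready ρ (X , 1 + base j , 1) (enter f j , 0) →
            FreeFrom ρ X (1 + base j) → Passed ρ X j (columns f j)
    tower zero f _ {ρ} X r fr = Passed-cons (ext st) (n≤1+n X) (+-suc (suc rowLen) X) rest
        (λ { (here (inj₁ refl)) → ≤-refl , rest-wide , ≤-refl , ≤-refl
           ; (there (here (inj₁ refl))) → ≤-refl , rest-wide , ≤-refl , z≤n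
           ; (there (here (inj₂ (_ , refl , y≤ , refl)))) → ≤-refl , rest-wide , m≤n⇒m≤1+n y≤ , z≤n })
        (λ x′ y l u y≤ → occs st (there (here (shade X 0 y≤ (≤-antisym (s≤s⁻¹ u) l)))))
        (λ x′ l u → at-column (≤-antisym (s≤s⁻¹ u) l) (All.head (All.tail (trs st))))
      where
      open Lanes 0 using (shade; at-column)
      ms : List Mark
      ms = marks (enter f 0) (0 , 1 , 1)
      st : Stage ρ (InMarks ms (X , y₀)) ms (X , y₀) (suc X , 1 + y₀ , 0) (row (suc rowLen) , 0)
      st = run (enter f 0) (0 , 1 , 1) (X , y₀) refl refl r (box-out (Occ ρ) 1 ms fr)
             (((λ ()) ∷ []) ∷ [] ∷ []) (λ _ → only refl)
      rest : Passed (Stage.ρ′ st) (suc X) 0 (suc rowLen)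
      rest = rowRun rowLen (suc X) (ready st) λ x′ y z l u →
        Ext-free (ext st) (λ i → <⇒≱ l (proj₁ (proj₂ (marks-bound 0 1 ms i)))) (fr x′ y z (≤-trans (n≤1+n X) l) u)
      rest-wide : suc X ≤ suc (Passed.f′ rest)
      rest-wide = ≤-trans (Passed.wide rest) (n≤1+n _)
    tower (suc j) f j< {ρ} X r fr = Passed-cons (ext st) ≤-refl refl rest inBox
        (λ _ _ l u _ → contradiction l (<⇒≱ u)) (λ _ l u → contradiction l (<⇒≱ u))
      where
      open Lanes j
      lower : ∀ f → SubPass f (columns f j)
      lower f X r′ fr′ = tower j f (<⇒≤ j<) X r′ fr′
      open Loop j j< (lower false)
      ms : List Mark
      ms = marks (enter f (suc j)) (0 , 3 , 1)
      cells : ∀ {x y z} → InMarks ms (X , Y) (x , y , z) → X ≤ x × x ≤ 1 + X × y ≤ 3 + Y × z ≡ 1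
      cells (here (inj₁ refl)) = ≤-refl , n≤1+n _ , ≤-refl , refl
      cells (here (inj₂ (() , _)))
      cells (there (here (inj₁ refl))) = n≤1+n _ , ≤-refl , ≤-refl , refl
      cells (there (here (inj₂ (() , _))))
      cells (there (there (here (inj₁ refl)))) = n≤1+n _ , ≤-refl , n≤1+n _ , refl
      cells (there (there (here (inj₂ (() , _)))))
      st : Stage ρ (InMarks ms (X , Y)) ms (X , Y) (1 + X , 2 + Y , 0) (write f j (digit f j) , 0)
      st = run (enter f (suc j)) (0 , 3 , 1) (X , Y) refl refl r (box-out (Occ ρ) 3 ms fr)
             (subst (λ ns → DistinctEnter (map first₀ ns ++ [])) (sym (exits-enter f j)) ([] ∷ []))
             (λ _ → subst (λ ns → Go _ (1 + X , 2 + Y , 1) (map first₀ ns) (1 + X , 2 + Y , 0) (write f j (digit f j) , 0)) (sym (exits-enter f j)) (only refl))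
      rest : Passed (Stage.ρ′ st) X (suc j) (columns f (suc j))
      rest = loop (togo (digit f j)) (digit f j) f (columns f j) X (digit-length f j) refl
        (lower f) (ready st)
        λ x y z l y≤ c → Ext-free (ext st) (λ i → apart c (cells i)) (fr x y z l y≤)
        where
        apart : ∀ {x y z} → z ≡ 0 ⊎ 2 + X ≤ x → ¬ (X ≤ x × x ≤ 1 + X × y ≤ 3 + Y × z ≡ 1)
        apart (inj₁ z≡0) (_ , _ , _ , z≡1) = case trans (sym z≡0) z≡1 of λ ()
        apart (inj₂ le) (_ , u , _) = <⇒≱ le u
      inBox : ∀ {x y z} → InMarks ms (X , Y) (x , y , z) → Box X (suc (Passed.f′ rest)) (3 + Y) (x , y , z)
      inBox i = let a , b , c , d = cells i in a , ≤-trans (s≤s b) 2+X≤ , c , ≤-reflexive d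
        where
        2+X≤ : 2 + X ≤ suc (Passed.f′ rest)
        2+X≤ = ≤-trans (+-monoˡ-≤ X {2} {columns f (suc j)}
                 (≤-trans (m≤n+m 2 (n * 4 + 5)) (≤-trans (≤-reflexive (+-assoc (n * 4) 5 2))
                    (≤-trans (m≤m+n stride (columns f j)) (m≤m+n (stride + columns f j) _)))))
                 (≤-reflexive (sym (Passed.width rest)))

-- The complete path, from the seed through the padding to the last overflow.

module Whole (n digits padLen rowLen y₀ : ℕ) (initial : ℕ → List Bool)
             (lengths : ∀ j → length (initial j) ≡ n) where
  open Towers n digits padLen rowLen y₀ initial public

  roof : ℕ
  roof = 1 + base digits

  record Padded (ρ : List Placed) (x hi : ℕ) : Set where
    field
      {ρ′} : List Placed
      ready : Ready ρ′ (hi , roof , 1) (enter true digits , 0)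
      free : FreeFrom ρ′ hi roof
      ext : Ext ρ ρ′ (Box x hi roof)
      filled : ∀ x′ y → x ≤ x′ → x′ < hi → y ≤ roof → Occ ρ′ (x′ , y , 0)

  padMarks : List Mark
  padMarks = marks (pad 1) (0 , 1 , 0)

  pad-cells : ∀ {x x′ y z} → InMarks padMarks (x , base digits) (x′ , y , z) → x ≤ x′ × x′ ≤ x × y ≤ roof × z ≤ 1
  pad-cells = marks-bound 0 1 padMarks

  padRun : ∀ i x {ρ} → Ready ρ (x , roof , 0) (pad (suc i) , 0) → FreeFrom ρ x roof → Padded ρ x (suc i + x)
  padRun zero x {ρ} r fr = record
    { ready = ready st₂
    ; free = λ x′ y z l u → Ext-free (ext st₂) (λ i → <⇒≱ l (proj₁ (proj₂ (end-cells i))))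
                              (Ext-free (ext st₁) (λ i → <⇒≱ l (proj₁ (proj₂ (pad-cells i))))
                                (fr x′ y z (≤-trans (n≤1+n x) l) u))
    ; ext = Ext-weaken (λ { (inj₁ i) → let a , b , r = pad-cells i in a , s≤s b , r
                          ; (inj₂ i) → let a , b , r = end-cells i in a , s≤s b , r }) (Ext-trans (ext st₁) (ext st₂))
    ; filled = λ x′ y l u y≤ → old (ext st₂) (occs st₁ (here (Lanes.shade digits x 0 y≤ (≤-antisym (s≤s⁻¹ u) l)))) }
    where
    st₁ : Stage ρ (InMarks padMarks (x , base digits)) padMarks (x , base digits) (x , roof , 1) (pad 0 , 0)
    st₁ = run (pad 1) (0 , 1 , 0) (x , base digits) refl refl r (box-out (Occ ρ) 1 padMarks fr)
            (((λ ()) ∷ []) ∷ [] ∷ []) (λ _ → only refl)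
    endMarks : List Mark
    endMarks = marks (pad 0) (0 , 1 , 1)
    end-cells : ∀ {x′ y z} → InMarks endMarks (x , base digits) (x′ , y , z) → x ≤ x′ × x′ ≤ x × y ≤ roof × z ≤ 1
    end-cells = marks-bound 0 1 endMarks
    st₂ : Stage (Stage.ρ′ st₁) (InMarks endMarks (x , base digits)) endMarks (x , base digits)
                (suc x , roof , 1) (enter true digits , 0)
    st₂ = run (pad 0) (0 , 1 , 1) (x , base digits) refl refl (ready st₁)
            (still-free (ext st₁) (marks-out padMarks endMarks) (box-out (Occ ρ) 1 endMarks fr))
            ([] ∷ []) (λ _ → only-by (enter-enter true digits) refl)
  padRun (suc i) x {ρ} r fr = record
    { ready = subst (λ h → Ready R.ρ′ (h , roof , 1) (enter true digits , 0)) hi R.ready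
    ; free = subst (λ h → FreeFrom R.ρ′ h roof) hi R.free
    ; ext = Ext-weaken (λ { (inj₁ c) → let a , b , r = pad-cells c in a , ≤-trans (s≤s b) (s≤s (m≤n+m x (suc i))) , r
                          ; (inj₂ (a , b , r)) → ≤-trans (n≤1+n x) a , ≤-trans b (≤-reflexive hi) , r })
              (Ext-trans (ext st) R.ext)
    ; filled = λ x′ y l u y≤ → case x <? x′ of λ where
        (yes lt) → R.filled x′ y lt (≤-trans u (≤-reflexive (sym hi))) y≤
        (no ge) → old R.ext (occs st (here (Lanes.shade digits x 0 y≤ (≤-antisym (≮⇒≥ ge) l)))) }
    where
    st : Stage ρ (InMarks padMarks (x , base digits)) padMarks (x , base digits) (suc x , roof , 0) (pad (suc i) , 0)
    st = run (pad (suc (suc i))) (0 , 1 , 0) (x , base digits) refl refl r (box-out (Occ ρ) 1 padMarks fr)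
           (((λ ()) ∷ []) ∷ [] ∷ []) (λ _ → only refl)
    hi : suc i + suc x ≡ suc (suc i) + x
    hi = +-suc (suc i) x
    module R = Padded (padRun i (suc x) (ready st) λ x′ y z l u →
      Ext-free (ext st) (λ c → <⇒≱ l (proj₁ (proj₂ (pad-cells c)))) (fr x′ y z (≤-trans (n≤1+n x) l) u))

  -- The two extra columns are those of the seed and of `pad 1`.
  total : ℕ
  total = columns true digits + (2 + padLen)

  record Built : Set where
    field
      {ρ} : List Placed
      done : Finished ρ
      within : ∀ {x y z} → Occ ρ (x , y , z) → x < total × y ≤ roof × z ≤ 1
      filled : ∀ x y → x < total → y ≤ roof → Occ ρ (x , y , 0)

  built : Built
  built = record
    { done = finished T.pending T.free distinct outs≡′
    ; within = λ o → bound (occ whole o)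
    ; filled = fill₁ }
    where
    originMarks : List Mark
    originMarks = marks origin (0 , 1 , 0)
    st : Stage [] (InMarks originMarks (0 , base digits)) originMarks (0 , base digits) (1 , roof , 0) (pad (suc padLen) , 0)
    st = run origin (0 , 1 , 0) (0 , base digits) refl refl init (((λ ()) , λ _ _ _ ()) ∷ [])
           (((λ ()) ∷ []) ∷ [] ∷ []) (λ _ → only refl)
    origin-cells : ∀ {x y z} → InMarks originMarks (0 , base digits) (x , y , z) → 0 ≤ x × x ≤ 0 × y ≤ roof × z ≤ 1
    origin-cells = marks-bound 0 1 originMarks
    module P = Padded (padRun padLen 1 (ready st) λ x y z l u →
      Ext-free (ext st) (λ i → <⇒≱ l (proj₁ (proj₂ (origin-cells i)))) λ ())
    tw : Passed P.ρ′ (suc padLen + 1) digits (columns true digits)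
    tw = tower lengths digits true ≤-refl (suc padLen + 1) P.ready P.free
    module T = Passed tw
    outs≡′ : trunkOuts T.s ≡ []
    outs≡′ = trans T.outs≡ (cong (map first₀) ascend-top)
    distinct : Distinct T.s
    distinct rewrite outs≡′ | T.unmarked = []
    width : suc T.f′ ≡ total
    width = trans T.width (cong (λ k → columns true digits + k) (+-comm (suc padLen) 1))
    whole : Ext [] _ _
    whole = Ext-trans (ext st) (Ext-trans P.ext T.ext)
    pad<total : suc padLen + 1 ≤ total
    pad<total = ≤-trans (≤-reflexive (+-comm (suc padLen) 1)) (m≤n+m (2 + padLen) (columns true digits))
    bound : ∀ {x y z} → (InMarks originMarks (0 , base digits) (x , y , z) ⊎
                         (Box 1 (suc padLen + 1) roof (x , y , z) ⊎ Box (suc padLen + 1) (suc T.f′) roof (x , y , z))) ⊎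
                        Occ [] (x , y , z) → x < total × y ≤ roof × z ≤ 1
    bound (inj₁ (inj₁ i)) = let _ , b , r = origin-cells i in ≤-trans (s≤s b) (≤-trans (s≤s z≤n) pad<total) , r
    bound (inj₁ (inj₂ (inj₁ (_ , b , r)))) = ≤-trans b pad<total , r
    bound (inj₁ (inj₂ (inj₂ (_ , b , r)))) = ≤-trans b (≤-reflexive width) , r
    fill₁ : ∀ x y → x < total → y ≤ roof → Occ _ (x , y , 0)
    fill₁ zero y u y≤ = old T.ext (old P.ext (occs st (here (Lanes.shade digits 0 0 y≤ refl))))
    fill₁ (suc x) y u y≤ with suc x <? suc padLen + 1
    ... | yes lt = old T.ext (P.filled (suc x) y (s≤s z≤n) lt y≤)
    ... | no ge = T.filled (suc x) y (≮⇒≥ ge) (s≤s⁻¹ (≤-trans u (≤-reflexive (sym width)))) y≤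

-- Counting the tile types.

record Retract (A : Set) (V : A → Set) (m : ℕ) : Set where
  field
    enc : A → Fin m
    dec : Fin m → A
    -- The round trip is asked of valid elements only, and `enc` may send the others anywhere: an
    -- upper bound on the number of types is all that is wanted.
    dec-enc : ∀ {a} → V a → dec (enc a) ≡ a

retractℕ : ∀ b → Retract ℕ (_≤ b) (suc b)
retractℕ b = record { enc = enc ; dec = toℕ ; dec-enc = dec-enc }
  where
  enc : ℕ → Fin (suc b)
  enc i with i <? suc b
  ... | yes lt = fromℕ< lt
  ... | no _ = Fin.zero
  dec-enc : ∀ {i} → i ≤ b → toℕ (enc i) ≡ i
  dec-enc {i} le with i <? suc b
  ... | yes lt = toℕ-fromℕ< lt
  ... | no ¬lt = contradiction (s≤s le) ¬lt

retractBool : Retract Bool (λ _ → ⊤) 2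
retractBool = record
  { enc = λ b → if b then Fin.zero else Fin.suc Fin.zero
  ; dec = λ { Fin.zero → true ; (Fin.suc _) → false }
  ; dec-enc = λ { {true} _ → refl ; {false} _ → refl } }

-- The number of bit lists of length at most `n`, that is `2 ^ suc n - 1`.
words : ℕ → ℕ
words zero = 1
words (suc n) = suc (words n + words n)

retractWord : ∀ n → Retract (List Bool) (λ w → length w ≤ n) (words n)
retractWord zero = record
  { enc = λ _ → Fin.zero ; dec = λ _ → [] ; dec-enc = λ { {[]} _ → refl } }
retractWord (suc n) = record { enc = enc ; dec = dec ; dec-enc = dec-enc }
  where
  module R = Retract (retractWord n)
  enc : List Bool → Fin (words (suc n))
  enc [] = Fin.zero
  enc (false ∷ w) = Fin.suc (R.enc w ↑ˡ words n)
  enc (true ∷ w) = Fin.suc (words n ↑ʳ R.enc w)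
  dec : Fin (words (suc n)) → List Bool
  dec Fin.zero = []
  dec (Fin.suc i) = [ (λ i → false ∷ R.dec i) , (λ i → true ∷ R.dec i) ]′ (splitAt (words n) i)
  dec-enc : ∀ {w} → length w ≤ suc n → dec (enc w) ≡ w
  dec-enc {[]} _ = refl
  dec-enc {false ∷ w} (s≤s le) rewrite splitAt-↑ˡ (words n) (R.enc w) (words n) = cong (false ∷_) (R.dec-enc le)
  dec-enc {true ∷ w} (s≤s le) rewrite splitAt-↑ʳ (words n) (words n) (R.enc w) = cong (true ∷_) (R.dec-enc le)

retract× : ∀ {A B V V′ m k} → Retract A V m → Retract B V′ k → Retract (A × B) (λ (a , b) → V a × V′ b) (m * k)
retract× {m = m} {k} r s = record
  { enc = λ (a , b) → combine (R.enc a) (S.enc b)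
  ; dec = λ i → R.dec (proj₁ (remQuot {m} k i)) , S.dec (proj₂ (remQuot {m} k i))
  ; dec-enc = λ { {a , b} (v , w) → trans
      (cong (λ (i , j) → R.dec i , S.dec j) (remQuot-combine (R.enc a) (S.enc b)))
      (cong₂ _,_ (R.dec-enc v) (S.dec-enc w)) } }
  where
  module R = Retract r
  module S = Retract s

retract⊎ : ∀ {A B V V′ m k} → Retract A V m → Retract B V′ k → Retract (A ⊎ B) [ V , V′ ]′ (m + k)
retract⊎ {A} {B} {V} {V′} {m} {k} r s = record { enc = enc ; dec = dec ; dec-enc = dec-enc }
  where
  module R = Retract r
  module S = Retract s
  enc : A ⊎ B → Fin (m + k)
  enc (inj₁ a) = R.enc a ↑ˡ k
  enc (inj₂ b) = m ↑ʳ S.enc b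
  dec : Fin (m + k) → A ⊎ B
  dec i = [ (λ i → inj₁ (R.dec i)) , (λ i → inj₂ (S.dec i)) ]′ (splitAt m i)
  dec-enc : ∀ {a} → [ V , V′ ]′ a → dec (enc a) ≡ a
  dec-enc {inj₁ a} v rewrite splitAt-↑ˡ m (R.enc a) k = cong inj₁ (R.dec-enc v)
  dec-enc {inj₂ b} w rewrite splitAt-↑ʳ m k (S.enc b) = cong inj₂ (S.dec-enc w)

retract-via : ∀ {A B V m} (f : B → A) (g : A → B) → (∀ b → g (f b) ≡ b) → Retract A V m → Retract B (V ∘ f) m
retract-via f g gf r = record
  { enc = R.enc ∘ f ; dec = g ∘ R.dec ; dec-enc = λ {b} v → trans (cong g (R.dec-enc v)) (gf b) }
  where module R = Retract r

-- All nodes share one product of a tag, a flag, a level, and a word or a number, with fixed values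
-- in the places that a node does not use. The waste is a factor independent of the width.
Code : Set
Code = ℕ × Bool × ℕ × (List Bool ⊎ ℕ)

code : Node → Code
code origin = 0 , false , 0 , inj₂ 0
code (pad i) = 1 , false , 0 , inj₂ i
code (enter f j) = 2 , f , j , inj₂ 0
code (row i) = 3 , false , 0 , inj₂ i
code (turn j) = 4 , false , j , inj₂ 0
code (back j) = 5 , false , j , inj₂ 0
code (dip j) = 6 , false , j , inj₂ 0
-- The dummy bit makes validity say `length bs < n`, as the successors carry one bit more.
code (test j bs) = 7 , false , j , inj₁ (false ∷ bs)
code (bit j b bs) = 8 , false , j , inj₁ (b ∷ bs)
code (lift j bs) = 9 , false , j , inj₁ bs
code (carry j bs) = 10 , false , j , inj₁ bs
code (stop j bs) = 11 , false , j , inj₁ bs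
code (again j bs) = 12 , false , j , inj₁ bs
code (write f j bs) = 13 , f , j , inj₁ bs
code (wbit f j b bs) = 14 , f , j , inj₁ (b ∷ bs)
code (leave f j) = 15 , f , j , inj₂ 0
code (fill h) = 16 , false , 0 , inj₂ h

decode : Code → Node
decode (1 , _ , _ , inj₂ i) = pad i
decode (2 , f , j , _) = enter f j
decode (3 , _ , _ , inj₂ i) = row i
decode (4 , _ , j , _) = turn j
decode (5 , _ , j , _) = back j
decode (6 , _ , j , _) = dip j
decode (7 , _ , j , inj₁ (_ ∷ bs)) = test j bs
decode (8 , _ , j , inj₁ (b ∷ bs)) = bit j b bs
decode (9 , _ , j , inj₁ bs) = lift j bs
decode (10 , _ , j , inj₁ bs) = carry j bs
decode (11 , _ , j , inj₁ bs) = stop j bs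
decode (12 , _ , j , inj₁ bs) = again j bs
decode (13 , f , j , inj₁ bs) = write f j bs
decode (14 , f , j , inj₁ (b ∷ bs)) = wbit f j b bs
decode (15 , f , j , _) = leave f j
decode (16 , _ , _ , inj₂ h) = fill h
decode _ = origin

decode-code : ∀ nd → decode (code nd) ≡ nd
decode-code origin = refl
decode-code (pad i) = refl
decode-code (enter f j) = refl
decode-code (row i) = refl
decode-code (turn j) = refl
decode-code (back j) = refl
decode-code (dip j) = refl
decode-code (test j bs) = refl
decode-code (bit j b bs) = refl
decode-code (lift j bs) = refl
decode-code (carry j bs) = refl
decode-code (stop j bs) = refl
decode-code (again j bs) = refl
decode-code (write f j bs) = refl
decode-code (wbit f j b bs) = refl
decode-code (leave f j) = refl
decode-code (fill h) = refl

at-length : ∀ ms i {m} → at ms i ≡ just m → i < length ms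
at-length (_ ∷ ms) zero _ = s≤s z≤n
at-length (_ ∷ ms) (suc i) e = s≤s (at-length ms i e)

prog-length : ∀ nd → length (prog nd) ≤ 12
prog-length origin = s≤s z≤n
prog-length (pad zero) = s≤s z≤n
prog-length (pad (suc i)) = s≤s z≤n
prog-length (enter f zero) = s≤s (s≤s z≤n)
prog-length (enter f (suc j)) = s≤s (s≤s (s≤s z≤n))
prog-length (row zero) = s≤s (s≤s z≤n)
prog-length (row (suc i)) = s≤s z≤n
prog-length (turn j) = ≤-refl
prog-length (back j) = s≤s z≤n
prog-length (dip j) = s≤s (s≤s z≤n)
prog-length (test j bs) = s≤s z≤n
prog-length (bit j false bs) = s≤s (s≤s (s≤s z≤n))
prog-length (bit j true bs) = s≤s (s≤s (s≤s (s≤s (s≤s z≤n))))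
prog-length (lift j bs) = s≤s (s≤s (s≤s (s≤s z≤n)))
prog-length (carry j bs) = s≤s z≤n
prog-length (stop j bs) = s≤s (s≤s (s≤s z≤n))
prog-length (again j bs) = s≤s (s≤s z≤n)
prog-length (write f j bs) = s≤s z≤n
prog-length (wbit f j false bs) = s≤s (s≤s (s≤s (s≤s (s≤s (s≤s (s≤s (s≤s z≤n)))))))
prog-length (wbit f j true bs) = s≤s (s≤s (s≤s (s≤s (s≤s (s≤s z≤n)))))
prog-length (leave f j) = s≤s (s≤s (s≤s (s≤s z≤n)))
prog-length (fill h) = s≤s z≤n

module Tiles (n digits padLen rowLen y₀ : ℕ) (initial : ℕ → List Bool)
             (lengths : ∀ j → length (initial j) ≡ n) where
  open Whole n digits padLen rowLen y₀ initial lengths public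

  -- A common bound for the three sorts of numbers in nodes: positions in the padding, positions in
  -- the row, and heights of fillers.
  counters : ℕ
  counters = (2 + padLen) + (2 + rowLen) + base digits

  size : ℕ
  size = (17 * (2 * (suc digits * (words n + suc counters)))) * 12

  ValidCode : Code → Set
  ValidCode (t , f , j , p) = t ≤ 16 × ⊤ × j ≤ digits × [ (λ w → length w ≤ n) , (λ i → i ≤ counters) ]′ p

  ValidState : State → Set
  ValidState (nd , i) = ValidCode (code nd) × i ≤ 11

  stateRetract : Retract State ValidState size
  stateRetract = retract×
    (retract-via code decode decode-code
      (retract× (retractℕ 16) (retract× retractBool (retract× (retractℕ digits) (retract⊎ (retractWord n) (retractℕ counters))))))
    (retractℕ 11)

  open Retract stateRetract

  base-mono : ∀ {i j} → i ≤ j → base i ≤ base j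
  base-mono {zero} {zero} z≤n = ≤-refl
  base-mono {zero} {suc j} z≤n = ≤-trans (base-mono {zero} {j} z≤n) (m≤n+m (base j) 2)
  base-mono {suc i} {suc j} (s≤s le) = s≤s (s≤s (base-mono le))

  base≤ : ∀ {j} → j ≤ digits → base j ≤ counters
  base≤ le = ≤-trans (base-mono le) (m≤n+m (base digits) _)

  tag≤ : ∀ k {w : True (k ≤? 16)} → k ≤ 16
  tag≤ k {w} = toWitness w

  V-node : Node → Set
  V-node nd = ValidCode (code nd)

  valid-ascend : ∀ j → All V-node (ascend j)
  valid-ascend j with j <? digits
  ... | yes lt = (tag≤ 4 , tt , <⇒≤ lt , z≤n) ∷ []
  ... | no _ = []

  valid-read : ∀ j bs → j ≤ digits → length bs ≤ n → V-node (read j bs)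
  valid-read j bs j≤ le with length bs ℕ.≟ n
  ... | yes _ = tag≤ 9 , tt , j≤ , le
  ... | no ne = tag≤ 7 , tt , j≤ , ≤∧≢⇒< le ne

  valid-writeRest : ∀ f j bs → j ≤ digits → length bs ≤ n → V-node (writeRest f j bs)
  valid-writeRest f j [] j≤ le = tag≤ 15 , tt , j≤ , z≤n
  valid-writeRest f j (b ∷ bs) j≤ le = tag≤ 14 , tt , j≤ , le

  valid-exits : ∀ nd → V-node nd → All V-node (exits nd)
  valid-exits origin v = (tag≤ 1 , tt , z≤n , ≤-trans (s≤s (n≤1+n padLen)) (≤-trans (m≤m+n (2 + padLen) _) (m≤m+n _ (base digits)))) ∷ []
  valid-exits (pad zero) v = (tag≤ 2 , tt , ≤-refl , z≤n) ∷ []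
  valid-exits (pad (suc i)) (_ , _ , _ , le) = (tag≤ 1 , tt , z≤n , ≤-trans (n≤1+n i) le) ∷ []
  valid-exits (enter f zero) v = (tag≤ 3 , tt , z≤n , ≤-trans (s≤s (n≤1+n rowLen)) (≤-trans (m≤n+m (2 + rowLen) (2 + padLen)) (m≤m+n _ (base digits)))) ∷ []
  valid-exits (enter true (suc j)) (_ , _ , j≤ , _) = (tag≤ 13 , tt , <⇒≤ j≤ , ≤-reflexive (lengths j)) ∷ []
  valid-exits (enter false (suc j)) (_ , _ , j≤ , _) = (tag≤ 13 , tt , <⇒≤ j≤ , ≤-reflexive (digit-length lengths false j)) ∷ []
  valid-exits (row zero) v = valid-ascend 0
  valid-exits (row (suc i)) (_ , _ , _ , le) = (tag≤ 3 , tt , z≤n , ≤-trans (n≤1+n i) le) ∷ []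
  valid-exits (turn j) (_ , _ , j≤ , _) = (tag≤ 5 , tt , j≤ , z≤n) ∷ []
  valid-exits (back j) (_ , _ , j≤ , _) = (tag≤ 5 , tt , j≤ , z≤n) ∷ (tag≤ 6 , tt , j≤ , z≤n) ∷ []
  valid-exits (dip j) (_ , _ , j≤ , _) = valid-read j [] j≤ z≤n ∷ []
  valid-exits (test j bs) (_ , _ , j≤ , le) = (tag≤ 8 , tt , j≤ , le) ∷ (tag≤ 8 , tt , j≤ , le) ∷ []
  valid-exits (bit j b bs) (_ , _ , j≤ , le) = valid-read j (b ∷ bs) j≤ le ∷ []
  valid-exits (lift j bs) (_ , _ , j≤ , le) = (tag≤ 10 , tt , j≤ , le) ∷ []
  valid-exits (carry j bs) (_ , _ , j≤ , le) = (tag≤ 10 , tt , j≤ , le) ∷ (tag≤ 11 , tt , j≤ , le) ∷ []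
  valid-exits (stop j bs) (_ , _ , j≤ , le) with allTrue bs
  ... | true = valid-ascend (suc j)
  ... | false = (tag≤ 12 , tt , j≤ , ≤-trans (≤-reflexive (next-length bs)) le) ∷ []
  valid-exits (again j bs) (_ , _ , j≤ , le) = (tag≤ 13 , tt , j≤ , le) ∷ []
  valid-exits (write f j bs) (_ , _ , j≤ , le) = valid-writeRest f j bs j≤ le ∷ []
  valid-exits (wbit f j b bs) (_ , _ , j≤ , le) = valid-writeRest f j bs j≤ (≤-trans (n≤1+n _) le) ∷ []
  valid-exits (leave f j) (_ , _ , j≤ , _) = (tag≤ 2 , tt , j≤ , z≤n) ∷ []
  valid-exits (fill zero) v = []
  valid-exits (fill (suc h)) (_ , _ , _ , le) = (tag≤ 16 , tt , z≤n , ≤-trans (n≤1+n h) le) ∷ []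

  height≤ : ∀ nd → V-node nd → height nd ≤ counters
  height≤ origin v = base≤ ≤-refl
  height≤ (pad _) v = base≤ ≤-refl
  height≤ (enter _ zero) v = base≤ z≤n
  height≤ (enter _ (suc j)) (_ , _ , j≤ , _) = base≤ (<⇒≤ j≤)
  height≤ (row _) v = base≤ z≤n
  height≤ (turn j) (_ , _ , j≤ , _) = base≤ j≤
  height≤ (back j) (_ , _ , j≤ , _) = base≤ j≤
  height≤ (dip j) (_ , _ , j≤ , _) = base≤ j≤
  height≤ (test j _) (_ , _ , j≤ , _) = base≤ j≤
  height≤ (bit j _ _) (_ , _ , j≤ , _) = base≤ j≤
  height≤ (lift j _) (_ , _ , j≤ , _) = base≤ j≤
  height≤ (carry j _) (_ , _ , j≤ , _) = base≤ j≤
  height≤ (stop j _) (_ , _ , j≤ , _) = base≤ j≤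
  height≤ (again j _) (_ , _ , j≤ , _) = base≤ j≤
  height≤ (write _ j _) (_ , _ , j≤ , _) = base≤ j≤
  height≤ (wbit _ j _ _) (_ , _ , j≤ , _) = base≤ j≤
  height≤ (leave _ j) (_ , _ , j≤ , _) = base≤ j≤
  height≤ (fill h) (_ , _ , _ , le) = le

  dec-valid : ∀ s → ValidState s → dec (enc s) ≡ s
  dec-valid s = dec-enc {s}

  valid-outs : ∀ s → ValidState s → All ValidState (outs s)
  valid-outs (nd , i) (v , _) = ++⁺ trunk (fills (at (prog nd) i))
    where
    trunk : All ValidState (trunkOuts (nd , i))
    trunk with at (prog nd) (suc i) in eq
    ... | just _ = (v , s≤s⁻¹ (≤-trans (at-length (prog nd) (suc i) eq) (prog-length nd))) ∷ []
    ... | nothing = map⁺ (All.map (λ w → w , z≤n) (valid-exits nd v))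
    fills : ∀ m → All ValidState (fillOuts (moveTop (height nd) m))
    fills nothing = []
    fills (just (_ , false)) = []
    fills (just (_ , true)) = ((tag≤ 16 , tt , z≤n , height≤ nd v) , z≤n) ∷ []

  exits-≢-origin : ∀ nd → All (_≢ origin) (exits nd)
  exits-≢-origin origin = (λ ()) ∷ []
  exits-≢-origin (pad zero) = (λ ()) ∷ []
  exits-≢-origin (pad (suc i)) = (λ ()) ∷ []
  exits-≢-origin (enter f zero) = (λ ()) ∷ []
  exits-≢-origin (enter true (suc j)) = (λ ()) ∷ []
  exits-≢-origin (enter false (suc j)) = (λ ()) ∷ []
  exits-≢-origin (row zero) with 0 <? digits
  ... | yes _ = (λ ()) ∷ []
  ... | no _ = []
  exits-≢-origin (row (suc i)) = (λ ()) ∷ []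
  exits-≢-origin (turn j) = (λ ()) ∷ []
  exits-≢-origin (back j) = (λ ()) ∷ (λ ()) ∷ []
  exits-≢-origin (dip j) with 0 ℕ.≟ n
  ... | yes _ = (λ ()) ∷ []
  ... | no _ = (λ ()) ∷ []
  exits-≢-origin (test j bs) = (λ ()) ∷ (λ ()) ∷ []
  exits-≢-origin (bit j b bs) with suc (length bs) ℕ.≟ n
  ... | yes _ = (λ ()) ∷ []
  ... | no _ = (λ ()) ∷ []
  exits-≢-origin (lift j bs) = (λ ()) ∷ []
  exits-≢-origin (carry j bs) = (λ ()) ∷ (λ ()) ∷ []
  exits-≢-origin (stop j bs) with allTrue bs | suc j <? digits
  ... | true | yes _ = (λ ()) ∷ []
  ... | true | no _ = []
  ... | false | _ = (λ ()) ∷ []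
  exits-≢-origin (again j bs) = (λ ()) ∷ []
  exits-≢-origin (write f j []) = (λ ()) ∷ []
  exits-≢-origin (write f j (b ∷ bs)) = (λ ()) ∷ []
  exits-≢-origin (wbit f j b []) = (λ ()) ∷ []
  exits-≢-origin (wbit f j b (_ ∷ bs)) = (λ ()) ∷ []
  exits-≢-origin (leave f j) = (λ ()) ∷ []
  exits-≢-origin (fill zero) = []
  exits-≢-origin (fill (suc h)) = (λ ()) ∷ []

  outs-≢-start : ∀ s → All (_≢ (origin , 0)) (outs s)
  outs-≢-start (nd , i) = ++⁺ trunk (fills (at (prog nd) i))
    where
    trunk : All (_≢ (origin , 0)) (trunkOuts (nd , i))
    trunk with at (prog nd) (suc i)
    ... | just _ = (λ ()) ∷ []
    ... | nothing = map⁺ (All.map (λ ne e → ne (cong proj₁ e)) (exits-≢-origin nd))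
    fills : ∀ m → All (_≢ (origin , 0)) (fillOuts (moveTop (height nd) m))
    fills nothing = []
    fills (just (_ , false)) = []
    fills (just (_ , true)) = (λ ()) ∷ []

  open Assemble enc dec ValidState dec-valid ((z≤n , tt , z≤n , z≤n) , z≤n) valid-outs outs-≢-start
    ((λ ()) ∷ (λ ()) ∷ []) (λ _ → refl) (λ _ → refl) refl (λ _ → refl)

  open Built built

  -- A rectangle may contain any part of the upper layer, so the cells of the path can be taken as
  -- they are once layer 0 is full.
  Region : Pos → Set
  Region p = ∃[ q ] p ≡ emb q × Occ ρ q

  region-rect : IsRect3 (suc roof) total Region
  region-rect = (λ x y x< y≤ → (x , y , 0) , refl , filled x y x< (s≤s⁻¹ y≤)) ,
    λ p ((x , y , z) , e , o) → let x< , y≤ , z≤ = within o in x , y , z , e , x< , s≤s y≤ , z≤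

  region-assembles : KUSA≤ 1 Region size
  region-assembles = 𝒯 , refl , ≤-refl , assembles done (λ p r → r) (λ q o → q , refl , o)

-- Choosing the initial digits for a prescribed width.

fullColumns : ℕ → ℕ → ℕ → ℕ → ℕ
fullColumns s b w zero = w
fullColumns s b w (suc j) = b * (s + fullColumns s b w j)

-- The width when digit `j` starts with `m j` increments left: one cycle over the initial lower
-- digits, then `m j` cycles over full lower runs.
partColumns : ℕ → ℕ → ℕ → (ℕ → ℕ) → ℕ → ℕ
partColumns s b w m zero = w
partColumns s b w m (suc j) = s + partColumns s b w m j + m j * (s + fullColumns s b w j)

partColumns-cong : ∀ {s b w m m′} j → (∀ i → i < j → m i ≡ m′ i) → partColumns s b w m j ≡ partColumns s b w m′ j
partColumns-cong zero eq = refl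
partColumns-cong {s} {b} {w} (suc j) eq = cong₂ (λ p a → s + p + a * (s + fullColumns s b w j))
  (partColumns-cong j (λ i lt → eq i (m≤n⇒m≤1+n lt))) (eq j ≤-refl)

fullColumns-≥ : ∀ s b w j → b ^ j * w ≤ fullColumns s b w j
fullColumns-≥ s b w zero = ≤-reflexive (+-identityʳ w)
fullColumns-≥ s b w (suc j) = ≤-trans (≤-reflexive (*-assoc b (b ^ j) w))
  (*-monoʳ-≤ b (≤-trans (fullColumns-≥ s b w j) (m≤n+m _ s)))

-- Division by `M` with slack `e`: subtraction stops as soon as the rest is below `M + e`, which
-- keeps the quotient within the range of a digit.
greedyDigit : ∀ b M e t → t < suc b * M + e → ∃[ a ] ∃[ t′ ] a ≤ b × t ≡ a * M + t′ × t′ < M + e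
greedyDigit zero M e t lt = 0 , t , z≤n , refl , subst (λ x → t < x + e) (+-identityʳ M) lt
greedyDigit (suc b) M e t lt with t <? M + e
... | yes lt′ = 0 , t , z≤n , refl , lt′
... | no ge with greedyDigit b M e (t ∸ M)
                  (+-cancelˡ-< M _ _ (subst₂ _<_ (sym (m+[n∸m]≡n M≤t)) (+-assoc M (suc b * M) e) lt))
  where
  M≤t : M ≤ t
  M≤t = ≤-trans (m≤m+n M e) (≮⇒≥ ge)
...   | a , t′ , a≤ , t≡ , t′< = suc a , t′ , s≤s a≤ ,
        trans (sym (m+[n∸m]≡n (≤-trans (m≤m+n M e) (≮⇒≥ ge)))) (trans (cong (λ k → M + k) t≡) (sym (+-assoc M (a * M) t′))) , t′<

override : ℕ → ℕ → (ℕ → ℕ) → ℕ → ℕ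
override j a m i with i ℕ.≟ j
... | yes _ = a
... | no _ = m i

-- The initial digits are chosen greedily; what they miss becomes the padding p.
greedy : ∀ s b w j e t → t < fullColumns s (suc b) w j + e →
         ∃[ m ] ∃[ p ] (∀ i → m i ≤ b) × partColumns s (suc b) w m j + p ≡ j * s + w + t × p < w + e + j * s
greedy s b w zero e t lt = (λ _ → 0) , t , (λ _ → z≤n) , refl , ≤-trans lt (≤-reflexive (sym (+-identityʳ (w + e))))
greedy s b w (suc j) e t lt with greedyDigit b (s + fullColumns s (suc b) w j) e t lt
-- The rest is below `s + fullColumns … + e`, so `s` joins the slack. In the end the padding stays
-- below the row length plus the initial slack and one stride per digit.
... | a , t′ , a≤ , t≡ , t′< with greedy s b w j (s + e) t′
        (≤-trans t′< (≤-reflexive (trans (cong (_+ e) (+-comm s _)) (+-assoc _ s e))))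
...   | m , p , m≤ , eq , p< = m′ , p , m′≤ , eq′ , ≤-trans p< (≤-reflexive (regroup w s e (j * s)))
  where
  M : ℕ
  M = s + fullColumns s (suc b) w j
  m′ : ℕ → ℕ
  m′ = override j a m
  m′≤ : ∀ i → m′ i ≤ b
  m′≤ i with i ℕ.≟ j
  ... | yes _ = a≤
  ... | no _ = m≤ i
  m′-below : ∀ i → i < j → m′ i ≡ m i
  m′-below i lt with i ℕ.≟ j
  ... | yes refl = contradiction lt (<-irrefl refl)
  ... | no _ = refl
  m′-top : m′ j ≡ a
  m′-top with j ℕ.≟ j
  ... | yes _ = refl
  ... | no ne = contradiction refl ne
  regroup : ∀ w s e x → w + (s + e) + x ≡ w + e + (s + x)
  regroup = solve-∀
  shuffle : ∀ s q am p → s + q + am + p ≡ s + am + (q + p)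
  shuffle = solve-∀
  collect : ∀ s am x w t′ → s + am + (x + w + t′) ≡ s + x + w + (am + t′)
  collect = solve-∀
  eq′ : partColumns s (suc b) w m′ (suc j) + p ≡ suc j * s + w + t
  eq′ = begin
    s + partColumns s (suc b) w m′ j + m′ j * M + p
      ≡⟨ cong₂ (λ q c → s + q + c * M + p) (partColumns-cong j m′-below) m′-top ⟩
    s + partColumns s (suc b) w m j + a * M + p
      ≡⟨ shuffle s _ (a * M) p ⟩
    s + a * M + (partColumns s (suc b) w m j + p)
      ≡⟨ cong (λ q → s + a * M + q) eq ⟩
    s + a * M + (j * s + w + t′)
      ≡⟨ collect s (a * M) (j * s) w t′ ⟩
    s + j * s + w + (a * M + t′)
      ≡⟨ cong (λ q → s + j * s + w + q) (sym t≡) ⟩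
    suc j * s + w + t ∎
    where open ≡-Reasoning

iterate : ∀ {A : Set} → ℕ → (A → A) → A → A
iterate zero f x = x
iterate (suc i) f x = iterate i f (f x)

iterate-togo : ∀ a bs {v} → togo bs ≡ a + v → togo (iterate a next bs) ≡ v
iterate-togo zero bs e = e
iterate-togo (suc a) bs e = iterate-togo a (next bs) (proj₂ (togo-suc bs e))

iterate-length : ∀ a bs → length (iterate a next bs) ≡ length bs
iterate-length zero bs = refl
iterate-length (suc a) bs = trans (iterate-length a (next bs)) (next-length bs)

togo-zeros : ∀ n → suc (togo (replicate n false)) ≡ 2 ^ n
togo-zeros zero = refl
togo-zeros (suc n) = trans (cong suc (sym (+-suc t t)))
  (trans (cong (λ k → k + k) (togo-zeros n)) (cong (λ k → 2 ^ n + k) (sym (+-identityʳ (2 ^ n)))))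
  where
  t : ℕ
  t = togo (replicate n false)

-- Zeros have the largest `togo` and each `next` lowers it by one, so a word with a prescribed count
-- is found by counting up.
word : ℕ → ℕ → List Bool
word n v = iterate (togo (replicate n false) ∸ v) next (replicate n false)

word-length : ∀ n v → length (word n v) ≡ n
word-length n v = trans (iterate-length (togo (replicate n false) ∸ v) (replicate n false)) (length-replicate n)

word-togo : ∀ n v → v ≤ togo (replicate n false) → togo (word n v) ≡ v
word-togo n v le = iterate-togo (togo (replicate n false) ∸ v) (replicate n false) (sym (m∸n+n≡m le))

words-≤ : ∀ n → suc (words n) ≤ 2 * 2 ^ n
words-≤ zero = ≤-refl
words-≤ (suc n) = ≤-trans (s≤s (≤-reflexive (sym (+-suc (words n) (words n)))))
  (≤-trans (+-mono-≤ (words-≤ n) (words-≤ n)) (≤-reflexive (double (2 ^ n))))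
  where
  double : ∀ x → 2 * x + 2 * x ≡ 2 * (2 * x)
  double = solve-∀

module Fitted (n g w₀ y₀ : ℕ) (m : ℕ → ℕ) (p : ℕ) (m≤ : ∀ i → m i ≤ togo (replicate n false)) where
  open Tiles n g p w₀ y₀ (λ i → word n (m i)) (λ i → word-length n (m i)) public

  b : ℕ
  b = togo (replicate n false)

  columns-false : ∀ j → columns false j ≡ fullColumns stride (suc b) (2 + w₀) j
  columns-false zero = refl
  columns-false (suc j) = cong (λ c → stride + c + b * (stride + c)) (columns-false j)

  columns-true : ∀ j → columns true j ≡ partColumns stride (suc b) (2 + w₀) m j
  columns-true zero = refl
  columns-true (suc j) = trans
    (cong₂ (λ c t → stride + c + t * (stride + columns false j)) (columns-true j) (word-togo n (m j) (m≤ j)))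
    (cong (λ c → stride + partColumns stride (suc b) (2 + w₀) m j + m j * (stride + c)) (columns-false j))

  base-closed : ∀ j → base j ≡ y₀ + j * 2
  base-closed zero = sym (+-identityʳ y₀)
  base-closed (suc j) = trans (cong (λ k → 2 + k) (base-closed j)) (rot y₀ (j * 2))
    where
    rot : ∀ y x → 2 + (y + x) ≡ y + (2 + x)
    rot = solve-∀

KUSA≤-weaken : ∀ {X B B′} → B ≤ B′ → KUSA≤ 1 X B → KUSA≤ 1 X B′
KUSA≤-weaken le (𝒯 , t , s , u) = 𝒯 , t , ≤-trans s le , u

opaque
  -- 17 kinds of nodes, a flag, g levels and 12 positions in a program
  tileCount : ℕ → ℕ → ℕ
  tileCount g q = 17 * (2 * (g * q)) * 12

  tileCount-mono : ∀ g {q q′} → q ≤ q′ → tileCount g q ≤ tileCount g q′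
  tileCount-mono g le = *-monoˡ-≤ 12 (*-monoʳ-≤ 17 (*-monoʳ-≤ 2 (*-monoʳ-≤ g le)))

  tileCount-* : ∀ g q y → tileCount g (q * y) ≡ tileCount g q * y
  tileCount-* g q y = pull 17 12 g q y
    where
    pull : ∀ u v g q y → u * (2 * (g * (q * y))) * v ≡ u * (2 * (g * q)) * v * y
    pull = solve-∀

  tileCount-def : ∀ g q → tileCount g q ≡ 17 * (2 * (g * q)) * 12
  tileCount-def g q = refl

assemble : ∀ k g n w₀ m p → k / 2 ≡ suc g → (∀ i → m i ≤ togo (replicate n false)) → ∀ width →
  partColumns (n * 4 + 7) (suc (togo (replicate n false))) (2 + w₀) m g + (2 + p) ≡ width →
  ∃[ R ] IsRect3 k width R × KUSA≤ 1 R (tileCount (suc g) (words n + suc ((2 + p) + (2 + w₀) + k)))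
assemble k g n w₀ m p k≡ m≤ width width≡ =
  F.Region , subst₂ (λ k′ x → IsRect3 k′ x F.Region) rows cols F.region-rect ,
  KUSA≤-weaken (≤-trans (≤-reflexive (sym (tileCount-def (suc g) _)))
    (tileCount-mono (suc g) (+-monoʳ-≤ (words n) (s≤s (+-monoʳ-≤ (2 + p + (2 + w₀)) base≤k))))) F.region-assembles
  where
  -- For odd `k` this leaves a bottom row that only fillers enter. The pair of rows above it serves
  -- the hard-coded run, and `g` pairs remain for the digits.
  module F = Fitted n g w₀ (k % 2) m p m≤
  rows : suc F.roof ≡ k
  rows = trans (cong (λ x → 2 + x) (F.base-closed g)) (trans (swap (k % 2) (g * 2))
    (sym (trans (m≡m%n+[m/n]*n k 2) (cong (λ d → k % 2 + d * 2) k≡))))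
    where
    swap : ∀ y x → 2 + (y + x) ≡ y + (2 + x)
    swap = solve-∀
  cols : F.total ≡ width
  cols = trans (cong (_+ (2 + p)) (F.columns-true g)) width≡
  base≤k : F.base g ≤ k
  base≤k = ≤-trans (m≤n+m (F.base g) 2) (≤-reflexive rows)

-- Choice of the base, and the bound on the number of tile types.

n<2^n : ∀ n → n < 2 ^ n
n<2^n zero = s≤s z≤n
n<2^n (suc n) = ≤-trans (+-mono-≤ (≤-trans (s≤s z≤n) (n<2^n n)) (n<2^n n)) (≤-reflexive (cong (λ k → 2 ^ n + k) (sym (+-identityʳ (2 ^ n)))))

-- `i` is fuel: the exponent sought is among the `i` values from `n` on, and it is the last one
-- whose power does not exceed `x`.
log-search : ∀ d x i n → (2 ^ n) ^ d ≤ x → x < (2 ^ (i + n)) ^ d →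
             ∃[ n′ ] n ≤ n′ × (2 ^ n′) ^ d ≤ x × x < (2 ^ suc n′) ^ d
log-search d x zero n le lt = contradiction le (<⇒≱ lt)
log-search d x (suc i) n le lt with (2 ^ suc n) ^ d ≤? x
... | no gt = n , ≤-refl , le , ≰⇒> gt
... | yes le′ with log-search d x i (suc n) le′ (subst (λ e → x < (2 ^ e) ^ d) (sym (+-suc i n)) lt)
...   | n′ , a , r = n′ , ≤-trans (n≤1+n n) a , r

-- This trades the power of two found by the search for any `r` that bounds the root from above, the
-- form in which the theorem refers to the root.
root-≤ : ∀ d x {b r} → b ^ suc d ≤ x → x ≤ r ^ suc d → b ≤ r
root-≤ d x {b} {r} lo hi with b ≤? r
... | yes le = le
... | no gt = contradiction (≤-trans lo hi) (<⇒≱ (^-monoˡ-< (suc d) (≰⇒> gt)))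

^-* : ∀ d x y → (x * y) ^ d ≡ x ^ d * y ^ d
^-* zero x y = refl
^-* (suc d) x y = trans (cong (λ q → x * y * q) (^-* d x y)) ([m*n]*[o*p]≡[m*o]*[n*p] x y (x ^ d) (y ^ d))

-- k / 2 = 1: no digits, only a row of hard-coded tiles
fits-one : ∀ k → k / 2 ≡ 1 → ∃[ c ] ∃[ x₀ ] ∀ x → x₀ ≤ x →
           ∃[ R ] IsRect3 k x R × (∀ r l → x ≤ r ^ (k / 2) → x ≤ 2 ^ l → KUSA≤ 1 R (c * (r + l)))
fits-one k k≡ = tileCount 1 (3 + k) , 4 , fit
  where
  fit : ∀ x → 4 ≤ x → ∃[ R ] IsRect3 k x R ×
        (∀ r l → x ≤ r ^ (k / 2) → x ≤ 2 ^ l → KUSA≤ 1 R (tileCount 1 (3 + k) * (r + l)))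
  fit x 4≤x = proj₁ built , proj₁ (proj₂ built) , λ r l x≤ _ → KUSA≤-weaken (bound r l (x≤r r x≤)) (proj₂ (proj₂ built))
    where
    built : ∃[ R ] IsRect3 k x R × KUSA≤ 1 R (tileCount 1 (1 + suc (2 + (2 + (x ∸ 4)) + k)))
    -- Four columns are always present: those of the seed, of `pad 1`, of `enter` and of `row 1`.
    built = assemble k 0 0 (x ∸ 4) (λ _ → 0) 0 k≡ (λ _ → z≤n) x
              (trans (+-comm (2 + (x ∸ 4)) 2) (m+[n∸m]≡n 4≤x))
    x≤r : ∀ r → x ≤ r ^ (k / 2) → x ≤ r
    x≤r r le = ≤-trans le (≤-reflexive (trans (cong (r ^_) k≡) (*-identityʳ r)))
    expand : ∀ x k → 2 * x + (x + k * x) ≡ (3 + k) * x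
    expand = solve-∀
    grow : ∀ a → a ≤ a * x
    grow a = m≤m*n a x {{ℕ.>-nonZero (≤-trans (s≤s z≤n) 4≤x)}}
    bound : ∀ r l → x ≤ r → tileCount 1 (1 + suc (2 + (2 + (x ∸ 4)) + k)) ≤ tileCount 1 (3 + k) * (r + l)
    bound r l x≤ = begin
      tileCount 1 (2 + ((4 + (x ∸ 4)) + k))
        ≡⟨ cong (λ y → tileCount 1 (2 + (y + k))) (m+[n∸m]≡n 4≤x) ⟩
      tileCount 1 (2 + (x + k))
        ≤⟨ tileCount-mono 1 (+-mono-≤ (grow 2) (+-monoʳ-≤ x (grow k))) ⟩
      tileCount 1 (2 * x + (x + k * x))
        ≡⟨ cong (tileCount 1) (expand x k) ⟩
      tileCount 1 ((3 + k) * x)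
        ≡⟨ tileCount-* 1 (3 + k) x ⟩
      tileCount 1 (3 + k) * x
        ≤⟨ *-monoʳ-≤ (tileCount 1 (3 + k)) (≤-trans x≤ (m≤m+n r l)) ⟩
      tileCount 1 (3 + k) * (r + l) ∎
      where open ≤-Reasoning

module Many (k g′ : ℕ) (k≡ : k / 2 ≡ suc (suc g′)) where

  -- With `B = 2 ^ n`, the row has length `a * B`, where `a` makes up for rounding the root down to
  -- `B`. A stride is at most `11 * B`, so the least possible width is at most `n₀ * B`, which fits
  -- once `n₀ ≤ n`. In `c`, the words account for 2, the padding with its two extra columns for
  -- `2 + a + g * 11`, the row for `a` and the heights for `k`.
  g a n₀ c x₀ : ℕ
  g = suc g′
  a = 2 ^ suc g
  n₀ = a + g * 11 + 2
  c = tileCount (suc g) (4 + a + g * 11 + a + k)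
  x₀ = (2 ^ n₀) ^ suc g

  module _ (x : ℕ) (x₀≤x : x₀ ≤ x) where

    B^-≥ : ∀ b → 1 ≤ b → b ≤ b ^ suc g
    B^-≥ b 1≤b = m≤m*n b (b ^ g) {{ℕ.>-nonZero (m^n>0 b {{ℕ.>-nonZero 1≤b}} g)}}

    found : ∃[ n ] n₀ ≤ n × (2 ^ n) ^ suc g ≤ x × x < (2 ^ suc n) ^ suc g
    found = log-search (suc g) x x n₀ x₀≤x
      (≤-trans (≤-trans (s≤s (m≤m+n x n₀)) (n<2^n (x + n₀))) (B^-≥ (2 ^ (x + n₀)) (m^n>0 2 (x + n₀))))

    n B b s w t : ℕ
    n = proj₁ found
    B = 2 ^ n
    b = togo (replicate n false)
    s = n * 4 + 7
    w = a * B
    -- The excess over the width that results when every digit starts at all ones: `g` strides, the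
    -- row, and the columns of the seed and `pad 1`.
    t = x ∸ (g * s + w + 2)

    1≤B : 1 ≤ B
    1≤B = m^n>0 2 n

    s≤ : s ≤ B * 11
    s≤ = ≤-trans (+-mono-≤ (*-monoˡ-≤ 4 (<⇒≤ (n<2^n n))) (*-monoˡ-≤ 7 1≤B)) (≤-reflexive (eleven B))
      where
      eleven : ∀ y → y * 4 + y * 7 ≡ y * 11
      eleven = solve-∀

    start≤ : g * s + w + 2 ≤ x
    start≤ = begin
      g * s + w + 2               ≤⟨ +-mono-≤ (+-monoˡ-≤ w (*-monoʳ-≤ g s≤)) (*-monoʳ-≤ 2 1≤B) ⟩
      g * (B * 11) + a * B + 2 * B ≡⟨ factor g B a ⟩
      n₀ * B                      ≤⟨ *-monoˡ-≤ B (≤-trans (proj₁ (proj₂ found)) (<⇒≤ (n<2^n n))) ⟩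
      -- The exponent `suc g` must be at least 2 here, which is why `k / 2 ≡ 1` is treated
      -- separately.
      B * B                       ≤⟨ *-monoʳ-≤ B (m≤m*n B (B ^ g′) {{ℕ.>-nonZero (m^n>0 B {{ℕ.>-nonZero 1≤B}} g′)}}) ⟩
      B ^ suc g                   ≤⟨ proj₁ (proj₂ (proj₂ found)) ⟩
      x                           ∎
      where
      open ≤-Reasoning
      factor : ∀ g y a → g * (y * 11) + a * y + 2 * y ≡ (a + g * 11 + 2) * y
      factor = solve-∀

    t< : t < fullColumns s (suc b) w g + 0
    t< = begin-strict
      t                           ≤⟨ m∸n≤m x (g * s + w + 2) ⟩
      x                           <⟨ proj₂ (proj₂ (proj₂ found)) ⟩
      -- Maximality of `n` bounds `x` only by a power of `2 * B`; the factor `a` that splits off is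
      -- absorbed by the length `w` of the row.
      (2 * B) ^ suc g             ≡⟨ ^-* (suc g) 2 B ⟩
      a * (B * B ^ g)             ≡⟨ rotate a B (B ^ g) ⟩
      B ^ g * w                   ≡⟨ cong (λ y → y ^ g * w) (sym (togo-zeros n)) ⟩
      suc b ^ g * w               ≤⟨ fullColumns-≥ s (suc b) w g ⟩
      fullColumns s (suc b) w g   ≡⟨ sym (+-identityʳ _) ⟩
      fullColumns s (suc b) w g + 0 ∎
      where
      open ≤-Reasoning
      rotate : ∀ a y z → a * (y * z) ≡ z * (a * y)
      rotate = solve-∀

    digits : ∃[ m ] ∃[ p ] (∀ i → m i ≤ b) × partColumns s (suc b) w m g + p ≡ g * s + w + t × p < w + 0 + g * s
    digits = greedy s b w g 0 t t<

    m : ℕ → ℕ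
    m = proj₁ digits

    p : ℕ
    p = proj₁ (proj₂ digits)

    p≤ : p ≤ w + g * s
    p≤ = ≤-trans (<⇒≤ (proj₂ (proj₂ (proj₂ (proj₂ digits))))) (≤-reflexive (cong (_+ g * s) (+-identityʳ w)))

    2≤w : 2 ≤ w
    2≤w = *-mono-≤ {2} {a} {1} {B} (m≤m*n 2 (2 ^ g) {{ℕ.>-nonZero (m^n>0 2 g)}}) 1≤B

    w≡ : 2 + (w ∸ 2) ≡ w
    w≡ = m+[n∸m]≡n 2≤w

    width : partColumns s (suc b) (2 + (w ∸ 2)) m g + (2 + p) ≡ x
    width = begin
      partColumns s (suc b) (2 + (w ∸ 2)) m g + (2 + p) ≡⟨ cong (λ w → partColumns s (suc b) w m g + (2 + p)) w≡ ⟩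
      partColumns s (suc b) w m g + (2 + p)             ≡⟨ out2 (partColumns s (suc b) w m g) p ⟩
      partColumns s (suc b) w m g + p + 2               ≡⟨ cong (_+ 2) (proj₁ (proj₂ (proj₂ (proj₂ digits)))) ⟩
      g * s + w + t + 2                                 ≡⟨ in2 (g * s + w) t ⟩
      g * s + w + 2 + t                                 ≡⟨ m+[n∸m]≡n start≤ ⟩
      x                                                 ∎
      where
      open ≡-Reasoning
      out2 : ∀ q p → q + (2 + p) ≡ q + p + 2
      out2 = solve-∀
      in2 : ∀ q t → q + t + 2 ≡ q + 2 + t
      in2 = solve-∀

    tiles≤ : tileCount (suc g) (words n + suc ((2 + p) + (2 + (w ∸ 2)) + k)) ≤ c * B
    tiles≤ = begin
      tileCount (suc g) (words n + suc ((2 + p) + (2 + (w ∸ 2)) + k))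
        ≡⟨ cong (λ w → tileCount (suc g) (words n + suc ((2 + p) + w + k))) w≡ ⟩
      tileCount (suc g) (words n + suc ((2 + p) + w + k))
        ≤⟨ tileCount-mono (suc g) inner ⟩
      tileCount (suc g) ((4 + a + g * 11 + a + k) * B)
        ≡⟨ tileCount-* (suc g) (4 + a + g * 11 + a + k) B ⟩
      c * B ∎
      where
      open ≤-Reasoning
      gather : ∀ y a g k → 2 * y + ((2 * y + (a * y + g * (y * 11))) + a * y + k * y) ≡ (4 + a + g * 11 + a + k) * y
      gather = solve-∀
      inner : words n + suc ((2 + p) + w + k) ≤ (4 + a + g * 11 + a + k) * B
      inner = begin
        words n + suc ((2 + p) + w + k)
          ≡⟨ +-suc (words n) _ ⟩
        suc (words n) + ((2 + p) + w + k)
          ≤⟨ +-mono-≤ (words-≤ n) (+-mono-≤ (+-monoˡ-≤ w (+-mono-≤ (*-monoʳ-≤ 2 1≤B)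
               (≤-trans p≤ (+-monoʳ-≤ w (*-monoʳ-≤ g s≤))))) (m≤m*n k B {{ℕ.>-nonZero 1≤B}})) ⟩
        2 * B + ((2 * B + (a * B + g * (B * 11))) + a * B + k * B)
          ≡⟨ gather B a g k ⟩
        (4 + a + g * 11 + a + k) * B ∎

    fit : ∃[ R ] IsRect3 k x R × (∀ r l → x ≤ r ^ (k / 2) → x ≤ 2 ^ l → KUSA≤ 1 R (c * (r + l)))
    fit = proj₁ built , proj₁ (proj₂ built) , λ r l x≤ _ → KUSA≤-weaken
        (≤-trans tiles≤ (*-monoʳ-≤ c (≤-trans
          (root-≤ g x (proj₁ (proj₂ (proj₂ found))) (≤-trans x≤ (≤-reflexive (cong (r ^_) k≡)))) (m≤m+n r l))))
        (proj₂ (proj₂ built))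
      where
      built : ∃[ R ] IsRect3 k x R × KUSA≤ 1 R (tileCount (suc g) (words n + suc ((2 + p) + (2 + (w ∸ 2)) + k)))
      built = assemble k g n (w ∸ 2) m p k≡ (proj₁ (proj₂ (proj₂ digits))) x width

fits : ∀ k e → k / 2 ≡ suc e → ∃[ c ] ∃[ x₀ ] ∀ x → x₀ ≤ x →
       ∃[ R ] IsRect3 k x R × (∀ r l → x ≤ r ^ (k / 2) → x ≤ 2 ^ l → KUSA≤ 1 R (c * (r + l)))
fits k zero k≡ = fits-one k k≡
fits k (suc g′) k≡ = c , x₀ , fit
  where open Many k g′ k≡

theorem2 : ∀ (k : ℕ) → 2 ≤ k →
  ∃[ c ] ∃[ N₀ ] ∀ (N : ℕ) → N₀ ≤ N →
    ∃[ R ] IsRect3 k N R ×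
      (∀ (r l : ℕ) → N ≤ r ^ (k / 2) → N ≤ 2 ^ l → KUSA≤ 1 R (c * (r + l)))
theorem2 k 2≤k = fits k (ℕ.pred (k / 2)) (sym (suc-pred (k / 2) {{ℕ.>-nonZero (m≥n⇒m/n>0 2≤k)}}))
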